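{- Assume the Schanuel conjecture. Then: for every $b\in\overline{\mathbb{Q}}\setminus\{0,1\}$ and every nonzero value $\ln b$ of its logarithm, $\ln b\notin EL^{alg}$; in particular $\pi\notin EL^{alg}$ and $e\notin EL^{alg}$; and for every $a\in EL^{alg}\setminus\{0,1\}$, no value of $\ln a$ lies in $EL^{alg}$.
   Context: Schanuel conjecture: if $z_1,\dots,z_n\in\mathbb{C}$ are linearly independent over $\mathbb{Q}$, then at least $n$ of $z_1,\dots,z_n,e^{z_1},\dots,e^{z_n}$ are algebraically independent over $\mathbb{Q}$. For $b\in\mathbb{C}\setminus\{0,1\}$ fix a nonzero value $\ln b$ and define $b^x:=e^{x\ln b}$. For $S\subseteq\mathbb{C}$ let $b^{S}=\{b^x:x\in S\}$ and $\mathrm{Log}_b(S)=\{w: b^w\in S\}$. $\overline{F}$ is the algebraic closure in $\mathbb{C}$ of a field $F$. Define $EL_0:=\mathbb{Q}$, $EL_n:=\overline{EL_{n-1}\big(b^{EL_{n-1}},\mathrm{Log}_b(EL_{n-1})\big)}$, $EL^{(b)}:=\bigcup_{n\ge0}EL_n$; equivalently the smallest algebraically closed subfield $F\subseteq\mathbb{C}$ with $x\in F\iff b^x\in F$. $EL^{alg}:=EL^{(-1)}$ with $\ln(-1)=i\pi$; it equals $EL^{(b)}$ for every algebraic $b\ne0,1$ (any choice of $\ln b$). Its elements are the algebraically based numbers. -}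

module Defs where

open import Data.Fin.Base using (Fin; zero; suc)
open import Data.Integer.Base as ℤ using (+_)
import Data.Integer.Properties as ℤ
open import Data.List.Base using (List; []; _∷_; foldr)
open import Data.List.Relation.Unary.All using (All)
open import Data.List.Relation.Unary.Any using (Any)
open import Data.Nat.Base as ℕ using (ℕ; zero; suc)
import Data.Nat.Properties as ℕ
open import Data.Product.Base using (∃-syntax; _×_; _,_; proj₁; proj₂)
open import Data.Rational.Base
open import Data.Rational.Properties
open import Data.Rational.Solver using (module +-*-Solver)
import Data.Rational.Unnormalised.Base as ℚᵘ
import Data.Rational.Unnormalised.Properties as ℚᵘ
open import Data.Sum.Base using (inj₁; inj₂)
open import Data.Vec.Functional as Vector using (Vector; _++_)
open import Function.Base using (_∘_)
open import Function.Definitions using (Injective)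
open import Level using (0ℓ)
open import Relation.Binary.PropositionalEquality using (_≡_; refl; sym; trans; cong; cong₂; subst; subst₂)
open import Relation.Nullary using (¬_)
open import Relation.Nullary.Decidable using (from-yes)
open import Relation.Unary using (Pred; _∪_)

open +-*-Solver using (solve; _:=_; _:+_; _:*_; _:-_; :-_; con)

ι : ℕ → ℚ
ι zero    = 0ℚ
ι (suc n) = 1ℚ + ι n

inv : ℕ → ℚ
inv k = + 1 / suc k

ι≡ : ∀ n → ι n ≡ + n / 1
ι≡ zero    = refl
ι≡ (suc n) = trans (cong (λ q → 1ℚ + q) (ι≡ n)) (toℚᵘ-injective (begin
  toℚᵘ (1ℚ + (+ n / 1))              ≈⟨ toℚᵘ-homo-+ 1ℚ (+ n / 1) ⟩
  toℚᵘ 1ℚ ℚᵘ.+ toℚᵘ (+ n / 1)        ≈⟨ ℚᵘ.+-congʳ (toℚᵘ 1ℚ) (toℚᵘ-fromℚᵘ (ℚᵘ.mkℚᵘ (+ n) 0)) ⟩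
  ℚᵘ.1ℚᵘ ℚᵘ.+ ℚᵘ.mkℚᵘ (+ n) 0        ≈⟨ ℚᵘ.*≡* (cong (λ k → (+ 1 ℤ.+ k) ℤ.* + 1) (ℤ.*-identityʳ (+ n))) ⟩
  ℚᵘ.mkℚᵘ (+ suc n) 0                ≈⟨ ℚᵘ.≃-sym (toℚᵘ-fromℚᵘ (ℚᵘ.mkℚᵘ (+ suc n) 0)) ⟩
  toℚᵘ (+ suc n / 1)                 ∎))
  where open ℚᵘ.≃-Reasoning

inv-ι : ∀ n → inv n * ι (suc n) ≡ 1ℚ
inv-ι n = trans (cong (inv n *_) (ι≡ (suc n))) (toℚᵘ-injective (begin
  toℚᵘ (inv n * (+ suc n / 1))                  ≈⟨ toℚᵘ-homo-* (inv n) (+ suc n / 1) ⟩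
  toℚᵘ (inv n) ℚᵘ.* toℚᵘ (+ suc n / 1)          ≈⟨ ℚᵘ.*-cong (toℚᵘ-fromℚᵘ (ℚᵘ.mkℚᵘ (+ 1) n)) (toℚᵘ-fromℚᵘ (ℚᵘ.mkℚᵘ (+ suc n) 0)) ⟩
  ℚᵘ.mkℚᵘ (+ 1) n ℚᵘ.* ℚᵘ.mkℚᵘ (+ suc n) 0      ≈⟨ ℚᵘ.*≡* (ℤ.*-assoc (+ 1) (+ suc n) (+ 1)) ⟩
  toℚᵘ 1ℚ                                       ∎))
  where open ℚᵘ.≃-Reasoning

*-mono : ∀ {a b c d} → 0ℚ ≤ a → a ≤ b → 0ℚ ≤ c → c ≤ d → a * c ≤ b * d
*-mono {a} {b} {c} {d} 0≤a a≤b 0≤c c≤d = ≤-trans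
  (*-monoˡ-≤-nonNeg a {{nonNegative 0≤a}} c≤d)
  (*-monoʳ-≤-nonNeg d {{nonNegative (≤-trans 0≤c c≤d)}} a≤b)

*-nonneg : ∀ {a b} → 0ℚ ≤ a → 0ℚ ≤ b → 0ℚ ≤ a * b
*-nonneg {a} {b} 0≤a 0≤b = subst (_≤ a * b) (*-zeroˡ 0ℚ) (*-mono ≤-refl 0≤a ≤-refl 0≤b)

+-nonneg : ∀ {a b} → 0ℚ ≤ a → 0ℚ ≤ b → 0ℚ ≤ a + b
+-nonneg {a} {b} 0≤a 0≤b = subst (_≤ a + b) (+-identityˡ 0ℚ) (+-mono-≤ 0≤a 0≤b)

0<1 : 0ℚ < 1ℚ
0<1 = from-yes (0ℚ <? 1ℚ)

0≤inv : ∀ n → 0ℚ ≤ inv n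
0≤inv n = nonNegative⁻¹ (inv n) {{normalize-nonNeg 1 (suc n)}}

0<inv : ∀ n → 0ℚ < inv n
0<inv n = positive⁻¹ (inv n) {{normalize-pos 1 (suc n)}}

0≤ι : ∀ n → 0ℚ ≤ ι n
0≤ι zero    = ≤-refl
0≤ι (suc n) = +-nonneg (<⇒≤ 0<1) (0≤ι n)

ι-mono : ∀ {m n} → m ℕ.≤ n → ι m ≤ ι n
ι-mono {n = n} ℕ.z≤n = 0≤ι n
ι-mono (ℕ.s≤s m≤n)   = +-monoʳ-≤ 1ℚ (ι-mono m≤n)

half-pos : ∀ {ε} → 0ℚ < ε → 0ℚ < ½ * ε
half-pos {ε} 0<ε = subst (_< ½ * ε) (*-zeroʳ ½) (*-monoʳ-<-pos ½ 0<ε)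

halves : ∀ ε → ½ * ε + ½ * ε ≡ ε
halves ε = trans (sym (*-distribʳ-+ ε ½ ½)) (*-identityˡ ε)

archimedean : ∀ p → ∃[ N ] p ≤ ι N
archimedean p@(mkℚ n d _) = ℤ.∣ n ∣ , subst (p ≤_) (sym (ι≡ ℤ.∣ n ∣)) (toℚᵘ-cancel-≤
  (ℚᵘ.≤-trans {_} {ℚᵘ.mkℚᵘ (+ ℤ.∣ n ∣) 0} (ℚᵘ.*≤* (bound n))
    (ℚᵘ.≤-reflexive (ℚᵘ.≃-sym (toℚᵘ-fromℚᵘ (ℚᵘ.mkℚᵘ (+ ℤ.∣ n ∣) 0))))))
  where
  bound : ∀ n → n ℤ.* + 1 ℤ.≤ + ℤ.∣ n ∣ ℤ.* + suc d
  bound (+ n)      = subst₂ ℤ._≤_ (ℤ.pos-* n 1) (ℤ.pos-* n (suc d))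
                       (ℤ.+≤+ (ℕ.*-monoʳ-≤ n (ℕ.s≤s ℕ.z≤n)))
  bound ℤ.-[1+ n ] = ℤ.≤-trans ℤ.-≤+ (subst (+ 0 ℤ.≤_) (ℤ.pos-* (suc n) (suc d)) (ℤ.+≤+ ℕ.z≤n))

scale : ∀ {K ε} → 0ℚ ≤ K → 0ℚ < ε → ∃[ δ ] 0ℚ < δ × K * δ < ε
scale {K} {ε} 0≤K 0<ε = δ , 0<δ , Kδ<ε
  where
  N : ℕ
  N = proj₁ (archimedean K)
  δ : ℚ
  δ = inv N * ε
  0<δ : 0ℚ < δ
  0<δ = subst (_< δ) (*-zeroʳ (inv N)) (*-monoʳ-<-pos (inv N) {{positive (0<inv N)}} 0<ε)
  K<ιsN : K < ι (suc N)
  K<ιsN = ≤-<-trans (proj₂ (archimedean K))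
    (subst (_< ι (suc N)) (+-identityˡ (ι N)) (+-monoˡ-< (ι N) 0<1))
  Kδ<ε : K * δ < ε
  Kδ<ε = <-≤-trans (*-monoˡ-<-pos δ {{positive 0<δ}} K<ιsN)
    (≤-reflexive (trans (solve 3 (λ a b c → a :* (b :* c) := (b :* a) :* c) refl (ι (suc N)) (inv N) ε)
      (trans (cong (_* ε) (inv-ι N)) (*-identityˡ ε))))

vanish : ∀ {K ε} → 0ℚ ≤ K → 0ℚ < ε → ∃[ N ] ∀ n → N ℕ.≤ n → inv n * K < ε
vanish {K} {ε} 0≤K 0<ε = N , λ n N≤n → ≤-<-trans (step n N≤n) δε<ε
  where
  s = scale 0≤K 0<ε
  δ = proj₁ s
  instance
    _ : Positive δ
    _ = positive (proj₁ (proj₂ s))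
    δ≢0 : NonZero δ
    δ≢0 = pos⇒nonZero δ
  N = proj₁ (archimedean (1/ δ))
  δε<ε = proj₂ (proj₂ s)
  0≤δ = <⇒≤ (proj₁ (proj₂ s))
  inv≤δ : ∀ n → N ℕ.≤ n → inv n ≤ δ
  inv≤δ n N≤n = subst₂ _≤_
    (trans (cong (inv n *_) (*-inverseˡ δ)) (*-identityʳ (inv n)))
    (trans (solve 3 (λ a b c → a :* (b :* c) := (a :* b) :* c) refl (inv n) (ι (suc n)) δ)
      (trans (cong (_* δ) (inv-ι n)) (*-identityˡ δ)))
    (*-monoˡ-≤-nonNeg (inv n) {{nonNegative (0≤inv n)}}
      (*-monoʳ-≤-nonNeg δ {{nonNegative 0≤δ}}
        (≤-trans (proj₂ (archimedean (1/ δ))) (ι-mono (ℕ.m≤n⇒m≤1+n N≤n)))))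
  step : ∀ n → N ℕ.≤ n → inv n * K ≤ K * δ
  step n N≤n = subst (_≤ K * δ) (*-comm K (inv n))
    (*-monoˡ-≤-nonNeg K {{nonNegative 0≤K}} (inv≤δ n N≤n))

∣-∣-sym : ∀ p q → ∣ p - q ∣ ≡ ∣ q - p ∣
∣-∣-sym p q = trans (cong ∣_∣ (solve 2 (λ p q → p :- q := :- (q :- p)) refl p q)) (∣-p∣≡∣p∣ (q - p))

∣-∣-triangle : ∀ p q r → ∣ p - r ∣ ≤ ∣ p - q ∣ + ∣ q - r ∣
∣-∣-triangle p q r = subst (λ e → ∣ e ∣ ≤ ∣ p - q ∣ + ∣ q - r ∣)
  (solve 3 (λ p q r → (p :- q) :+ (q :- r) := p :- r) refl p q r)
  (∣p+q∣≤∣p∣+∣q∣ (p - q) (q - r))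

∣*∣-≤ : ∀ p q {a b} → ∣ p ∣ ≤ a → ∣ q ∣ ≤ b → ∣ p * q ∣ ≤ a * b
∣*∣-≤ p q pa qb = subst (_≤ _) (sym (∣p*q∣≡∣p∣*∣q∣ p q)) (*-mono (0≤∣p∣ p) pa (0≤∣p∣ q) qb)

∣+∣-≤ : ∀ p q {a b} → ∣ p ∣ ≤ a → ∣ q ∣ ≤ b → ∣ p + q ∣ ≤ a + b
∣+∣-≤ p q pa qb = ≤-trans (∣p+q∣≤∣p∣+∣q∣ p q) (+-mono-≤ pa qb)

Cauchy : (ℕ → ℚ) → Set
Cauchy s = ∀ ε → 0ℚ < ε → ∃[ N ] ∀ m n → N ℕ.≤ m → N ℕ.≤ n → ∣ s m - s n ∣ < ε

-- Cauchy sequences of rationals, up to _≈ᴿ_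
record ℝ : Set where
  constructor mkℝ
  field
    seq    : ℕ → ℚ
    cauchy : Cauchy seq

open ℝ public

infix 4 _≈ᴿ_

_≈ᴿ_ : ℝ → ℝ → Set
x ≈ᴿ y = ∀ ε → 0ℚ < ε → ∃[ N ] ∀ n → N ℕ.≤ n → ∣ seq x n - seq y n ∣ < ε

cauchy-const : ∀ q → Cauchy (λ _ → q)
cauchy-const q ε 0<ε = 0 , λ _ _ _ _ → subst (_< ε) (sym (cong ∣_∣ (+-inverseʳ q))) 0<ε

cauchy-neg : ∀ {s} → Cauchy s → Cauchy (λ n → - s n)
cauchy-neg {s} cs ε 0<ε = proj₁ (cs ε 0<ε) , λ m n N≤m N≤n → subst (_< ε)
  (trans (∣-∣-sym (s m) (s n))
    (cong ∣_∣ (solve 2 (λ a b → b :- a := (:- a) :- (:- b)) refl (s m) (s n))))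
  (proj₂ (cs ε 0<ε) m n N≤m N≤n)

cauchy-+ : ∀ {s t} → Cauchy s → Cauchy t → Cauchy (λ n → s n + t n)
cauchy-+ {s} {t} cs ct ε 0<ε = N₁ ℕ.+ N₂ , λ m n N≤m N≤n →
  ≤-<-trans
    (subst (λ e → ∣ e ∣ ≤ ∣ s m - s n ∣ + ∣ t m - t n ∣)
      (solve 4 (λ a b c d → (a :- b) :+ (c :- d) := (a :+ c) :- (b :+ d)) refl (s m) (s n) (t m) (t n))
      (∣p+q∣≤∣p∣+∣q∣ (s m - s n) (t m - t n)))
    (subst (∣ s m - s n ∣ + ∣ t m - t n ∣ <_) (halves ε)
      (+-mono-< (proj₂ c₁ m n (ℕ.m+n≤o⇒m≤o N₁ N≤m) (ℕ.m+n≤o⇒m≤o N₁ N≤n))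
                (proj₂ c₂ m n (ℕ.m+n≤o⇒n≤o N₁ N≤m) (ℕ.m+n≤o⇒n≤o N₁ N≤n))))
  where
  c₁ = cs (½ * ε) (half-pos 0<ε)
  c₂ = ct (½ * ε) (half-pos 0<ε)
  N₁ = proj₁ c₁
  N₂ = proj₁ c₂

bounded : ∀ {s} → Cauchy s → ∃[ B ] 0ℚ ≤ B × ∃[ N ] ∀ n → N ℕ.≤ n → ∣ s n ∣ ≤ B
bounded {s} cs = 1ℚ + ∣ s N ∣ , +-nonneg (<⇒≤ 0<1) (0≤∣p∣ (s N)) , N , λ n N≤n →
  subst (λ e → ∣ e ∣ ≤ 1ℚ + ∣ s N ∣) (solve 2 (λ a b → (a :- b) :+ b := a) refl (s n) (s N))
    (∣+∣-≤ (s n - s N) (s N) (<⇒≤ (proj₂ (cs 1ℚ 0<1) n N N≤n ℕ.≤-refl)) ≤-refl)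
  where
  N = proj₁ (cs 1ℚ 0<1)

*-diff : ∀ a b c d → a * (c - d) + d * (a - b) ≡ a * c - b * d
*-diff = solve 4 (λ a b c d → a :* (c :- d) :+ d :* (a :- b) := a :* c :- b :* d) refl

∣*-diff∣-≤ : ∀ {B C δ} a b c d → ∣ a ∣ ≤ B → ∣ d ∣ ≤ C → ∣ a - b ∣ ≤ δ → ∣ c - d ∣ ≤ δ →
             ∣ a * c - b * d ∣ ≤ (B + C) * δ
∣*-diff∣-≤ {B} {C} {δ} a b c d aB dC ab cd = subst₂ (λ e f → ∣ e ∣ ≤ f)
  (*-diff a b c d) (sym (*-distribʳ-+ δ B C))
  (∣+∣-≤ (a * (c - d)) (d * (a - b)) (∣*∣-≤ a (c - d) aB cd) (∣*∣-≤ d (a - b) dC ab))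

cauchy-* : ∀ {s t} → Cauchy s → Cauchy t → Cauchy (λ n → s n * t n)
cauchy-* {s} {t} cs ct ε 0<ε = withBounds (bounded {s} cs) (bounded {t} ct)
  where
  withBounds : (∃[ B ] 0ℚ ≤ B × ∃[ N ] ∀ n → N ℕ.≤ n → ∣ s n ∣ ≤ B) →
               (∃[ B ] 0ℚ ≤ B × ∃[ N ] ∀ n → N ℕ.≤ n → ∣ t n ∣ ≤ B) →
               ∃[ N ] ∀ m n → N ℕ.≤ m → N ℕ.≤ n → ∣ s m * t m - s n * t n ∣ < ε
  withBounds (B₁ , 0≤B₁ , M₁ , b₁) (B₂ , 0≤B₂ , M₂ , b₂) = withδ (scale (+-nonneg 0≤B₁ 0≤B₂) 0<ε)
    where
    withδ : (∃[ δ ] 0ℚ < δ × (B₁ + B₂) * δ < ε) →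
            ∃[ N ] ∀ m n → N ℕ.≤ m → N ℕ.≤ n → ∣ s m * t m - s n * t n ∣ < ε
    withδ (δ , 0<δ , Kδ<ε) = withN (cs δ 0<δ) (ct δ 0<δ)
      where
      withN : (∃[ N ] ∀ m n → N ℕ.≤ m → N ℕ.≤ n → ∣ s m - s n ∣ < δ) →
              (∃[ N ] ∀ m n → N ℕ.≤ m → N ℕ.≤ n → ∣ t m - t n ∣ < δ) →
              ∃[ N ] ∀ m n → N ℕ.≤ m → N ℕ.≤ n → ∣ s m * t m - s n * t n ∣ < ε
      withN (N₁ , c₁) (N₂ , c₂) = (M₁ ℕ.+ M₂) ℕ.+ (N₁ ℕ.+ N₂) , λ m n N≤m N≤n →
        let M≤m = ℕ.m+n≤o⇒m≤o (M₁ ℕ.+ M₂) N≤m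
            M≤n = ℕ.m+n≤o⇒m≤o (M₁ ℕ.+ M₂) N≤n
            L≤m = ℕ.m+n≤o⇒n≤o (M₁ ℕ.+ M₂) N≤m
            L≤n = ℕ.m+n≤o⇒n≤o (M₁ ℕ.+ M₂) N≤n
        in ≤-<-trans
          (∣*-diff∣-≤ (s m) (s n) (t m) (t n)
            (b₁ m (ℕ.m+n≤o⇒m≤o M₁ M≤m)) (b₂ n (ℕ.m+n≤o⇒n≤o M₁ M≤n))
            (<⇒≤ (c₁ m n (ℕ.m+n≤o⇒m≤o N₁ L≤m) (ℕ.m+n≤o⇒m≤o N₁ L≤n)))
            (<⇒≤ (c₂ m n (ℕ.m+n≤o⇒n≤o N₁ L≤m) (ℕ.m+n≤o⇒n≤o N₁ L≤n))))
          Kδ<ε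

cauchy-ordered : ∀ {s} →
  (∀ ε → 0ℚ < ε → ∃[ N ] ∀ m n → N ℕ.≤ n → n ℕ.≤ m → ∣ s m - s n ∣ < ε) → Cauchy s
cauchy-ordered {s} c ε 0<ε = proj₁ (c ε 0<ε) , ordered
  where
  ordered : ∀ m n → proj₁ (c ε 0<ε) ℕ.≤ m → proj₁ (c ε 0<ε) ℕ.≤ n → ∣ s m - s n ∣ < ε
  ordered m n N≤m N≤n with ℕ.≤-total m n
  ... | inj₁ m≤n = subst (_< ε) (∣-∣-sym (s n) (s m)) (proj₂ (c ε 0<ε) n m N≤m m≤n)
  ... | inj₂ n≤m = proj₂ (c ε 0<ε) m n N≤n n≤m

fromℚᴿ : ℚ → ℝ
fromℚᴿ q = mkℝ (λ _ → q) (cauchy-const q)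

infixl 6 _+ᴿ_ _-ᴿ_
infixl 7 _*ᴿ_
infix  8 -ᴿ_

_+ᴿ_ _*ᴿ_ : ℝ → ℝ → ℝ
x +ᴿ y = mkℝ (λ n → seq x n + seq y n) (cauchy-+ {seq x} {seq y} (cauchy x) (cauchy y))
x *ᴿ y = mkℝ (λ n → seq x n * seq y n) (cauchy-* {seq x} {seq y} (cauchy x) (cauchy y))

-ᴿ_ : ℝ → ℝ
-ᴿ x = mkℝ (λ n → - seq x n) (cauchy-neg {seq x} (cauchy x))

_-ᴿ_ : ℝ → ℝ → ℝ
x -ᴿ y = x +ᴿ (-ᴿ y)

infix 5 _+i_

record ℂ : Set where
  constructor _+i_
  field
    Re Im : ℝ

open ℂ public

infix 4 _≈_ _≉_

_≈_ _≉_ : ℂ → ℂ → Set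
z ≈ w = Re z ≈ᴿ Re w × Im z ≈ᴿ Im w
z ≉ w = ¬ (z ≈ w)

fromℝ : ℝ → ℂ
fromℝ x = x +i fromℚᴿ 0ℚ

fromℚ : ℚ → ℂ
fromℚ q = fromℝ (fromℚᴿ q)

0ℂ 1ℂ : ℂ
0ℂ = fromℚ 0ℚ
1ℂ = fromℚ 1ℚ

infixl 6 _+ℂ_
infixl 7 _*ℂ_
infix  8 -ℂ_

_+ℂ_ _*ℂ_ : ℂ → ℂ → ℂ
z +ℂ w = Re z +ᴿ Re w +i Im z +ᴿ Im w
z *ℂ w = Re z *ᴿ Re w -ᴿ Im z *ᴿ Im w +i Re z *ᴿ Im w +ᴿ Im z *ᴿ Re w

-ℂ_ : ℂ → ℂ
-ℂ z = -ᴿ Re z +i -ᴿ Im z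

record ℚ[i] : Set where
  constructor _,i_
  field
    re im : ℚ

open ℚ[i] public

infixl 6 _⊕_ _⊝_
infixl 7 _⊛_ _·_

_⊕_ _⊝_ _⊛_ : ℚ[i] → ℚ[i] → ℚ[i]
z ⊕ w = (re z + re w) ,i (im z + im w)
z ⊝ w = (re z - re w) ,i (im z - im w)
z ⊛ w = (re z * re w - im z * im w) ,i (re z * im w + im z * re w)

_·_ : ℚ → ℚ[i] → ℚ[i]
q · z = (q * re z) ,i (q * im z)

-- expTerm k z = zᵏ / k!
expTerm : ℕ → ℚ[i] → ℚ[i]
expTerm zero    z = 1ℚ ,i 0ℚ
expTerm (suc k) z = inv k · (expTerm k z ⊛ z)

-- expSum n z = Σ_{k ≤ n} zᵏ / k!
expSum : ℕ → ℚ[i] → ℚ[i]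
expSum zero    z = expTerm zero z
expSum (suc n) z = expSum n z ⊕ expTerm (suc n) z

‖_‖ : ℚ[i] → ℚ
‖ z ‖ = ∣ re z ∣ + ∣ im z ∣

‖⊕‖-≤ : ∀ z w {a b} → ‖ z ‖ ≤ a → ‖ w ‖ ≤ b → ‖ z ⊕ w ‖ ≤ a + b
‖⊕‖-≤ z w za wb = ≤-trans
  (+-mono-≤ (∣p+q∣≤∣p∣+∣q∣ (re z) (re w)) (∣p+q∣≤∣p∣+∣q∣ (im z) (im w)))
  (≤-trans (≤-reflexive (solve 4 (λ a b c d → (a :+ b) :+ (c :+ d) := (a :+ c) :+ (b :+ d)) refl
             (∣ re z ∣) (∣ re w ∣) (∣ im z ∣) (∣ im w ∣)))
           (+-mono-≤ za wb))

0≤‖‖ : ∀ z → 0ℚ ≤ ‖ z ‖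
0≤‖‖ z = +-nonneg (0≤∣p∣ (re z)) (0≤∣p∣ (im z))

‖⊛‖-≤ : ∀ z w {a b} → ‖ z ‖ ≤ a → ‖ w ‖ ≤ b → ‖ z ⊛ w ‖ ≤ a * b
‖⊛‖-≤ (a ,i b) (c ,i d) {A} {B} za wb = ≤-trans
  (+-mono-≤
    (≤-trans (∣p-q∣≤∣p∣+∣q∣ (a * c) (b * d))
      (≤-reflexive (cong₂ _+_ (∣p*q∣≡∣p∣*∣q∣ a c) (∣p*q∣≡∣p∣*∣q∣ b d))))
    (≤-trans (∣p+q∣≤∣p∣+∣q∣ (a * d) (b * c))
      (≤-reflexive (cong₂ _+_ (∣p*q∣≡∣p∣*∣q∣ a d) (∣p*q∣≡∣p∣*∣q∣ b c)))))
  (≤-trans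
    (≤-reflexive (solve 4 (λ a b c d →
        (a :* c :+ b :* d) :+ (a :* d :+ b :* c) := (a :+ b) :* (c :+ d)) refl
      (∣ a ∣) (∣ b ∣) (∣ c ∣) (∣ d ∣)))
    (*-mono (0≤‖‖ (a ,i b)) za (0≤‖‖ (c ,i d)) wb))

‖·‖-≤ : ∀ q z {a} → 0ℚ ≤ q → ‖ z ‖ ≤ a → ‖ q · z ‖ ≤ q * a
‖·‖-≤ q z {a} 0≤q za = subst (_≤ q * a)
  (sym (trans (cong₂ _+_ (∣p*q∣≡∣p∣*∣q∣ q (re z)) (∣p*q∣≡∣p∣*∣q∣ q (im z)))
    (trans (sym (*-distribˡ-+ (∣ q ∣) (∣ re z ∣) (∣ im z ∣))) (cong (_* ‖ z ‖) (0≤p⇒∣p∣≡p 0≤q)))))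
  (*-monoˡ-≤-nonNeg q {{nonNegative 0≤q}} za)

-- τ B k = Bᵏ / k!, and D B k = k Bᵏ⁻¹ / k! bounds the Lipschitz constant
-- of zᵏ / k! on ‖ z ‖ ≤ B.
τ : ℚ → ℕ → ℚ
τ B zero    = 1ℚ
τ B (suc k) = inv k * (τ B k * B)

D : ℚ → ℕ → ℚ
D B zero    = 0ℚ
D B (suc k) = τ B k

Sτ : ℚ → ℕ → ℚ
Sτ B zero    = τ B 0
Sτ B (suc n) = Sτ B n + τ B (suc n)

SD : ℚ → ℕ → ℚ
SD B zero    = D B 0
SD B (suc n) = SD B n + D B (suc n)

inv-cancel : ∀ k x → inv k * (ι (suc k) * x) ≡ x
inv-cancel k x = trans (sym (*-assoc (inv k) (ι (suc k)) x))
  (trans (cong (_* x) (inv-ι k)) (*-identityˡ x))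

D-step : ∀ B k → inv k * (D B k * B + τ B k) ≡ D B (suc k)
D-step B zero    = trans (cong (λ e → inv 0 * (e + 1ℚ)) (*-zeroˡ B)) refl
D-step B (suc j) = trans (cong (λ e → inv (suc j) * (e + t)) τB)
  (trans (cong (inv (suc j) *_) (solve 2 (λ i t → i :* t :+ t := (con 1ℚ :+ i) :* t) refl (ι (suc j)) t))
    (inv-cancel (suc j) t))
  where
  t = τ B (suc j)
  τB : τ B j * B ≡ ι (suc j) * t
  τB = sym (trans (solve 3 (λ i v x → i :* (v :* x) := v :* (i :* x)) refl (ι (suc j)) (inv j) (τ B j * B))
    (inv-cancel j (τ B j * B)))

0≤τ : ∀ {B} → 0ℚ ≤ B → ∀ k → 0ℚ ≤ τ B k
0≤τ 0≤B zero    = <⇒≤ 0<1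
0≤τ 0≤B (suc k) = *-nonneg (0≤inv k) (*-nonneg (0≤τ 0≤B k) 0≤B)

τ-halves : ∀ {B} → 0ℚ ≤ B → ∀ k → B + B ≤ ι (suc k) → τ B (suc k) + τ B (suc k) ≤ τ B k
τ-halves {B} 0≤B k 2B≤ = subst₂ _≤_
  (solve 3 (λ v t b → v :* ((b :+ b) :* t) := v :* (t :* b) :+ v :* (t :* b)) refl (inv k) (τ B k) B)
  (inv-cancel k (τ B k))
  (*-monoˡ-≤-nonNeg (inv k) {{nonNegative (0≤inv k)}}
    (*-monoʳ-≤-nonNeg (τ B k) {{nonNegative (0≤τ 0≤B k)}} 2B≤))

term-bound : ∀ {B} z → ‖ z ‖ ≤ B → ∀ k → ‖ expTerm k z ‖ ≤ τ B k
term-bound z zB zero    = ≤-refl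
term-bound z zB (suc k) = ‖·‖-≤ (inv k) (expTerm k z ⊛ z) (0≤inv k)
  (‖⊛‖-≤ (expTerm k z) z (term-bound z zB k) zB)

∣im∣≤‖‖ : ∀ z → ∣ im z ∣ ≤ ‖ z ‖
∣im∣≤‖‖ z = subst (_≤ ‖ z ‖) (+-identityˡ (∣ im z ∣)) (+-monoˡ-≤ (∣ im z ∣) (0≤∣p∣ (re z)))

∣re∣≤‖‖ : ∀ z → ∣ re z ∣ ≤ ‖ z ‖
∣re∣≤‖‖ z = subst (_≤ ‖ z ‖) (+-identityʳ (∣ re z ∣)) (+-monoʳ-≤ (∣ re z ∣) (0≤∣p∣ (im z)))

term-lipschitz : ∀ {B δ} a b → ‖ a ‖ ≤ B → ‖ b ‖ ≤ B → ‖ a ⊝ b ‖ ≤ δ →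
                 ∀ k → ‖ expTerm k a ⊝ expTerm k b ‖ ≤ D B k * δ
term-lipschitz {B} {δ} a b aB bB ab zero    = ≤-reflexive (sym (*-zeroˡ δ))
term-lipschitz {B} {δ} a b aB bB ab (suc k) = subst₂ _≤_ (cong ‖_‖ split) const
  (‖·‖-≤ (inv k) ((s ⊝ t) ⊛ a ⊕ t ⊛ (a ⊝ b)) (0≤inv k)
    (‖⊕‖-≤ ((s ⊝ t) ⊛ a) (t ⊛ (a ⊝ b))
      (‖⊛‖-≤ (s ⊝ t) a (term-lipschitz a b aB bB ab k) aB)
      (‖⊛‖-≤ t (a ⊝ b) (term-bound b bB k) ab)))
  where
  s = expTerm k a
  t = expTerm k b
  split : inv k · ((s ⊝ t) ⊛ a ⊕ t ⊛ (a ⊝ b)) ≡ inv k · (s ⊛ a) ⊝ inv k · (t ⊛ b)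
  split = cong₂ _,i_
    (solve 9 (λ v s₁ s₂ t₁ t₂ a₁ a₂ b₁ b₂ →
        v :* (((s₁ :- t₁) :* a₁ :- (s₂ :- t₂) :* a₂) :+ (t₁ :* (a₁ :- b₁) :- t₂ :* (a₂ :- b₂)))
        := v :* (s₁ :* a₁ :- s₂ :* a₂) :- v :* (t₁ :* b₁ :- t₂ :* b₂))
      refl (inv k) (re s) (im s) (re t) (im t) (re a) (im a) (re b) (im b))
    (solve 9 (λ v s₁ s₂ t₁ t₂ a₁ a₂ b₁ b₂ →
        v :* (((s₁ :- t₁) :* a₂ :+ (s₂ :- t₂) :* a₁) :+ (t₁ :* (a₂ :- b₂) :+ t₂ :* (a₁ :- b₁)))
        := v :* (s₁ :* a₂ :+ s₂ :* a₁) :- v :* (t₁ :* b₂ :+ t₂ :* b₁))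
      refl (inv k) (re s) (im s) (re t) (im t) (re a) (im a) (re b) (im b))
  const : inv k * (D B k * δ * B + τ B k * δ) ≡ D B (suc k) * δ
  const = trans (solve 5 (λ v d e b t → v :* (d :* e :* b :+ t :* e) := v :* (d :* b :+ t) :* e) refl
      (inv k) (D B k) δ B (τ B k))
    (cong (_* δ) (D-step B k))

⊕-⊝ : ∀ a b c d → (a ⊝ b) ⊕ (c ⊝ d) ≡ (a ⊕ c) ⊝ (b ⊕ d)
⊕-⊝ a b c d = cong₂ _,i_ (eq (re a) (re b) (re c) (re d)) (eq (im a) (im b) (im c) (im d))
  where
  eq : ∀ a b c d → (a - b) + (c - d) ≡ (a + c) - (b + d)
  eq = solve 4 (λ a b c d → (a :- b) :+ (c :- d) := (a :+ c) :- (b :+ d)) refl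

sum-lipschitz : ∀ {B δ} a b → ‖ a ‖ ≤ B → ‖ b ‖ ≤ B → ‖ a ⊝ b ‖ ≤ δ →
                ∀ n → ‖ expSum n a ⊝ expSum n b ‖ ≤ SD B n * δ
sum-lipschitz a b aB bB ab zero    = term-lipschitz a b aB bB ab zero
sum-lipschitz {B} {δ} a b aB bB ab (suc n) = subst₂ (λ e f → ‖ e ‖ ≤ f)
  (⊕-⊝ (expSum n a) (expSum n b) (expTerm (suc n) a) (expTerm (suc n) b))
  (sym (*-distribʳ-+ δ (SD B n) (D B (suc n))))
  (‖⊕‖-≤ (expSum n a ⊝ expSum n b) (expTerm (suc n) a ⊝ expTerm (suc n) b)
    (sum-lipschitz a b aB bB ab n) (term-lipschitz a b aB bB ab (suc n)))

module Tail {B : ℚ} (0≤B : 0ℚ ≤ B) (M : ℕ) (2B≤M : B + B ≤ ι (suc M)) where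

  halve : ∀ k → M ℕ.≤ k → τ B (suc k) + τ B (suc k) ≤ τ B k
  halve k M≤k = τ-halves 0≤B k (≤-trans 2B≤M (ι-mono (ℕ.s≤s M≤k)))

  K : ℚ
  K = Sτ B M + τ B M

  0≤Sτ : ∀ n → 0ℚ ≤ Sτ B n
  0≤Sτ zero    = 0≤τ 0≤B 0
  0≤Sτ (suc n) = +-nonneg (0≤Sτ n) (0≤τ 0≤B (suc n))

  0≤K : 0ℚ ≤ K
  0≤K = +-nonneg (0≤Sτ M) (0≤τ 0≤B M)

  Sτ+τ≤K : ∀ j → Sτ B (j ℕ.+ M) + τ B (j ℕ.+ M) ≤ K
  Sτ+τ≤K zero    = ≤-refl
  Sτ+τ≤K (suc j) = ≤-trans
    (≤-reflexive (+-assoc (Sτ B n) (τ B (suc n)) (τ B (suc n))))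
    (≤-trans (+-monoʳ-≤ (Sτ B n) (halve n (ℕ.m≤n+m M j))) (Sτ+τ≤K j))
    where n = j ℕ.+ M

  SD≤Sτ : ∀ n → SD B n ≤ Sτ B n
  SD≤Sτ zero    = <⇒≤ 0<1
  SD≤Sτ (suc n) = subst (_≤ Sτ B (suc n)) (trans (+-identityʳ (Sτ B n)) (sym (shift n)))
    (+-monoʳ-≤ (Sτ B n) (0≤τ 0≤B (suc n)))
    where
    shift : ∀ n → SD B (suc n) ≡ Sτ B n
    shift zero    = refl
    shift (suc n) = cong (_+ τ B (suc n)) (shift n)

  Sτ≤K : ∀ n → M ℕ.≤ n → Sτ B n + τ B n ≤ K
  Sτ≤K n M≤n = subst (λ n → Sτ B n + τ B n ≤ K) (ℕ.m∸n+n≡m M≤n) (Sτ+τ≤K (n ℕ.∸ M))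

  SD≤K : ∀ n → M ℕ.≤ n → SD B n ≤ K
  SD≤K n M≤n = ≤-trans (SD≤Sτ n) (≤-trans
    (subst (_≤ Sτ B n + τ B n) (+-identityʳ (Sτ B n)) (+-monoʳ-≤ (Sτ B n) (0≤τ 0≤B n))) (Sτ≤K n M≤n))

  τ≤K : ∀ n → M ℕ.≤ n → τ B n ≤ K
  τ≤K n M≤n = ≤-trans
    (subst (_≤ Sτ B n + τ B n) (+-identityˡ (τ B n)) (+-monoˡ-≤ (τ B n) (0≤Sτ n))) (Sτ≤K n M≤n)

  τ-vanish : ∀ {ε} → 0ℚ < ε → ∃[ N ] ∀ n → N ℕ.≤ n → τ B n < ε
  τ-vanish {ε} 0<ε = fromN (vanish (*-nonneg 0≤K 0≤B) 0<ε)
    where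
    fromN : (∃[ N ] ∀ n → N ℕ.≤ n → inv n * (K * B) < ε) → ∃[ N ] ∀ n → N ℕ.≤ n → τ B n < ε
    fromN (N , v) = suc (M ℕ.+ N) , λ where
      (suc n) (ℕ.s≤s N≤n) → ≤-<-trans
        (*-monoˡ-≤-nonNeg (inv n) {{nonNegative (0≤inv n)}}
          (*-monoʳ-≤-nonNeg B {{nonNegative 0≤B}} (τ≤K n (ℕ.m+n≤o⇒m≤o M N≤n))))
        (v n (ℕ.m+n≤o⇒n≤o M N≤n))

  tail-≤ : ∀ z → ‖ z ‖ ≤ B → ∀ n → M ℕ.≤ n → ∀ j →
           ‖ expSum (j ℕ.+ n) z ⊝ expSum n z ‖ ≤ τ B n - τ B (j ℕ.+ n)
  tail-≤ z zB n M≤n zero    = ≤-reflexive (trans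
    (cong₂ (λ a b → ∣ a ∣ + ∣ b ∣) (+-inverseʳ (re s)) (+-inverseʳ (im s)))
    (sym (+-inverseʳ (τ B n))))
    where s = expSum n z
  tail-≤ z zB n M≤n (suc j) = ≤-trans
    (subst (λ e → ‖ e ‖ ≤ (τ B n - τ B m) + τ B (suc m)) rearrange
      (‖⊕‖-≤ (expSum m z ⊝ expSum n z) (expTerm (suc m) z) (tail-≤ z zB n M≤n j) (term-bound z zB (suc m))))
    (subst₂ _≤_
      (solve 3 (λ a b c → (a :- b :- c) :+ (c :+ c) := (a :- b) :+ c) refl (τ B n) (τ B m) (τ B (suc m)))
      (solve 3 (λ a b c → (a :- b :- c) :+ b := a :- c) refl (τ B n) (τ B m) (τ B (suc m)))
      (+-monoʳ-≤ (τ B n - τ B m - τ B (suc m)) (halve m (ℕ.≤-trans M≤n (ℕ.m≤n+m n j)))))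
    where
    m = j ℕ.+ n
    eq : ∀ a b c → (a - b) + c ≡ (a + c) - b
    eq = solve 3 (λ a b c → (a :- b) :+ c := (a :+ c) :- b) refl
    rearrange : (expSum m z ⊝ expSum n z) ⊕ expTerm (suc m) z ≡ expSum (suc m) z ⊝ expSum n z
    rearrange = cong₂ _,i_
      (eq (re (expSum m z)) (re (expSum n z)) (re (expTerm (suc m) z)))
      (eq (im (expSum m z)) (im (expSum n z)) (im (expTerm (suc m) z)))

  tail : ∀ z → ‖ z ‖ ≤ B → ∀ m n → M ℕ.≤ n → n ℕ.≤ m → ‖ expSum m z ⊝ expSum n z ‖ ≤ τ B n
  tail z zB m n M≤n n≤m = ≤-trans
    (subst (λ m → ‖ expSum m z ⊝ expSum n z ‖ ≤ τ B n - τ B m) (ℕ.m∸n+n≡m n≤m)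
      (tail-≤ z zB n M≤n (m ℕ.∸ n)))
    (subst (τ B n - τ B m ≤_) (+-identityʳ (τ B n))
      (+-monoʳ-≤ (τ B n) (neg-antimono-≤ (0≤τ 0≤B m))))

Bounded : (ℕ → ℚ[i]) → Set
Bounded s = ∃[ B ] 0ℚ ≤ B × ∃[ N ] ∀ n → N ℕ.≤ n → ‖ s n ‖ ≤ B

approx : ℂ → ℕ → ℚ[i]
approx z n = seq (Re z) n ,i seq (Im z) n

approx-bounded : ∀ z → Bounded (approx z)
approx-bounded z = fromBounds (bounded {seq (Re z)} (cauchy (Re z))) (bounded {seq (Im z)} (cauchy (Im z)))
  where
  fromBounds : (∃[ B ] 0ℚ ≤ B × ∃[ N ] ∀ n → N ℕ.≤ n → ∣ seq (Re z) n ∣ ≤ B) →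
               (∃[ B ] 0ℚ ≤ B × ∃[ N ] ∀ n → N ℕ.≤ n → ∣ seq (Im z) n ∣ ≤ B) → Bounded (approx z)
  fromBounds (B₁ , 0≤B₁ , N₁ , b₁) (B₂ , 0≤B₂ , N₂ , b₂) =
    B₁ + B₂ , +-nonneg 0≤B₁ 0≤B₂ , N₁ ℕ.+ N₂ , λ n N≤n →
      +-mono-≤ (b₁ n (ℕ.m+n≤o⇒m≤o N₁ N≤n)) (b₂ n (ℕ.m+n≤o⇒n≤o N₁ N≤n))

expSum-cauchy : ∀ z ε → 0ℚ < ε → ∃[ N ] ∀ m n → N ℕ.≤ n → n ℕ.≤ m →
                ‖ expSum m (approx z m) ⊝ expSum n (approx z n) ‖ < ε
expSum-cauchy z ε 0<ε = withBound (approx-bounded z)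
  where
  Goal : Set
  Goal = ∃[ N ] ∀ m n → N ℕ.≤ n → n ℕ.≤ m →
         ‖ expSum m (approx z m) ⊝ expSum n (approx z n) ‖ < ε
  withBound : Bounded (approx z) → Goal
  withBound (B , 0≤B , N₀ , zB) = withM (archimedean (B + B))
    where
    withM : (∃[ M ] B + B ≤ ι M) → Goal
    withM (M , 2B≤M) = choose (scale (+-nonneg 0≤K 0≤K) (half-pos 0<ε)) (τ-vanish (half-pos 0<ε))
      where
      open Tail 0≤B M (≤-trans 2B≤M (ι-mono (ℕ.n≤1+n M)))
      choose : (∃[ δ ] 0ℚ < δ × (K + K) * δ < ½ * ε) →
               (∃[ N ] ∀ n → N ℕ.≤ n → τ B n < ½ * ε) → Goal
      choose (δ , 0<δ , Kδ<) (N₁ , τ<) = atN (cauchy (Re z) δ 0<δ) (cauchy (Im z) δ 0<δ)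
        where
        atN : (∃[ N ] ∀ m n → N ℕ.≤ m → N ℕ.≤ n → ∣ seq (Re z) m - seq (Re z) n ∣ < δ) →
              (∃[ N ] ∀ m n → N ℕ.≤ m → N ℕ.≤ n → ∣ seq (Im z) m - seq (Im z) n ∣ < δ) → Goal
        atN (N₂ , c₂) (N₃ , c₃) = (M ℕ.+ N₀) ℕ.+ (N₁ ℕ.+ (N₂ ℕ.+ N₃)) , λ m n N≤n n≤m →
          let l≤n  = ℕ.m+n≤o⇒m≤o (M ℕ.+ N₀) N≤n
              r≤n  = ℕ.m+n≤o⇒n≤o (M ℕ.+ N₀) N≤n
              M≤n  = ℕ.m+n≤o⇒m≤o M l≤n
              N₀≤n = ℕ.m+n≤o⇒n≤o M l≤n
              N₁≤n = ℕ.m+n≤o⇒m≤o N₁ r≤n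
              c≤n  = ℕ.m+n≤o⇒n≤o N₁ r≤n
              N₂≤n = ℕ.m+n≤o⇒m≤o N₂ c≤n
              N₃≤n = ℕ.m+n≤o⇒n≤o N₂ c≤n
              a = approx z m
              b = approx z n
              aB = zB m (ℕ.≤-trans N₀≤n n≤m)
              bB = zB n N₀≤n
              ab : ‖ a ⊝ b ‖ ≤ δ + δ
              ab = +-mono-≤ (<⇒≤ (c₂ m n (ℕ.≤-trans N₂≤n n≤m) N₂≤n))
                            (<⇒≤ (c₃ m n (ℕ.≤-trans N₃≤n n≤m) N₃≤n))
              lip : ‖ expSum m a ⊝ expSum m b ‖ ≤ (K + K) * δ
              lip = ≤-trans (sum-lipschitz a b aB bB ab m)
                (≤-trans (*-monoʳ-≤-nonNeg (δ + δ) {{nonNegative (<⇒≤ (+-mono-< 0<δ 0<δ))}}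
                           (SD≤K m (ℕ.≤-trans M≤n n≤m)))
                  (≤-reflexive (solve 2 (λ k d → k :* (d :+ d) := (k :+ k) :* d) refl K δ)))
          in ≤-<-trans
               (subst (λ e → ‖ e ‖ ≤ (K + K) * δ + τ B n)
                 (⊝-telescope (expSum m a) (expSum m b) (expSum n b))
                 (‖⊕‖-≤ (expSum m a ⊝ expSum m b) (expSum m b ⊝ expSum n b)
                   lip (tail b bB m n M≤n n≤m)))
               (subst ((K + K) * δ + τ B n <_) (halves ε) (+-mono-< Kδ< (τ< n N₁≤n)))
          where
          eq : ∀ a b c → (a - b) + (b - c) ≡ a - c
          eq = solve 3 (λ a b c → (a :- b) :+ (b :- c) := a :- c) refl
          ⊝-telescope : ∀ a b c → (a ⊝ b) ⊕ (b ⊝ c) ≡ a ⊝ c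
          ⊝-telescope a b c = cong₂ _,i_ (eq (re a) (re b) (re c)) (eq (im a) (im b) (im c))

-- Diagonal of the power series: since Σ zᵏ / k! converges uniformly on
-- bounded sets, n ↦ Σ_{k ≤ n} (approx z n)ᵏ / k! has the same limit as the
-- series at z; see exp-series.
exp : ℂ → ℂ
exp z =
  mkℝ (λ n → re (expSum n (approx z n)))
    (cauchy-ordered {λ n → re (expSum n (approx z n))} λ ε 0<ε → proj₁ (expSum-cauchy z ε 0<ε) , λ m n N≤n n≤m →
      ≤-<-trans (∣re∣≤‖‖ (expSum m (approx z m) ⊝ expSum n (approx z n)))
        (proj₂ (expSum-cauchy z ε 0<ε) m n N≤n n≤m))
  +i
  mkℝ (λ n → im (expSum n (approx z n)))
    (cauchy-ordered {λ n → im (expSum n (approx z n))} λ ε 0<ε → proj₁ (expSum-cauchy z ε 0<ε) , λ m n N≤n n≤m →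
      ≤-<-trans (∣im∣≤‖‖ (expSum m (approx z m) ⊝ expSum n (approx z n)))
        (proj₂ (expSum-cauchy z ε 0<ε) m n N≤n n≤m))

infix 4 _⟶_

_⟶_ : (ℕ → ℂ) → ℂ → Set
s ⟶ z = ∀ ε → 0ℚ < ε → ∃[ N ] ∀ n → N ℕ.≤ n →
        ∃[ M ] ∀ m → M ℕ.≤ m → ‖ approx z m ⊝ approx (s n) m ‖ < ε

-- seriesTerm k z = zᵏ / k! and seriesSum n z = Σ_{k ≤ n} zᵏ / k!, in ℂ
seriesTerm seriesSum : ℕ → ℂ → ℂ
seriesTerm zero    z = 1ℂ
seriesTerm (suc k) z = fromℚ (inv k) *ℂ (seriesTerm k z *ℂ z)
seriesSum zero    z = seriesTerm zero z
seriesSum (suc n) z = seriesSum n z +ℂ seriesTerm (suc n) z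

approx-term : ∀ k z m → approx (seriesTerm k z) m ≡ expTerm k (approx z m)
approx-term zero    z m = refl
approx-term (suc k) z m = trans
  (cong₂ _,i_
    (solve 3 (λ q a b → q :* a :- con 0ℚ :* b := q :* a) refl (inv k) (re w) (im w))
    (solve 3 (λ q a b → q :* b :+ con 0ℚ :* a := q :* b) refl (inv k) (re w) (im w)))
  (cong (λ t → inv k · (t ⊛ approx z m)) (approx-term k z m))
  where w = approx (seriesTerm k z *ℂ z) m

approx-sum : ∀ n z m → approx (seriesSum n z) m ≡ expSum n (approx z m)
approx-sum zero    z m = refl
approx-sum (suc n) z m = cong₂ _⊕_ (approx-sum n z m) (approx-term (suc n) z m)

exp-series : ∀ z → (λ n → seriesSum n z) ⟶ exp z
exp-series z ε 0<ε = withBound (approx-bounded z)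
  where
  Goal : Set
  Goal = ∃[ N ] ∀ n → N ℕ.≤ n → ∃[ M ] ∀ m → M ℕ.≤ m → ‖ approx (exp z) m ⊝ approx (seriesSum n z) m ‖ < ε
  withBound : Bounded (approx z) → Goal
  withBound (B , 0≤B , N₀ , zB) = withM (archimedean (B + B))
    where
    withM : (∃[ M ] B + B ≤ ι M) → Goal
    withM (M , 2B≤M) = atN (τ-vanish 0<ε)
      where
      open Tail 0≤B M (≤-trans 2B≤M (ι-mono (ℕ.n≤1+n M)))
      atN : (∃[ N ] ∀ n → N ℕ.≤ n → τ B n < ε) → Goal
      atN (N , τ<) = M ℕ.+ N , λ n N≤n → n ℕ.+ N₀ , λ m n≤m →
        subst (λ e → ‖ expSum m (approx z m) ⊝ e ‖ < ε) (sym (approx-sum n z m))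
          (≤-<-trans
            (tail (approx z m) (zB m (ℕ.m+n≤o⇒n≤o n n≤m)) m n (ℕ.m+n≤o⇒m≤o M N≤n) (ℕ.m+n≤o⇒m≤o n n≤m))
            (τ< n (ℕ.m+n≤o⇒n≤o M N≤n)))

-- π / 6 is the unique solution of sin x = ½ with |x| ≤ 4/5; it is obtained
-- as the limit of x ↦ x + (½ - sin x), a contraction on that interval, with
-- the sine series truncated at order n in step n.  See sin-π/6 and ∣π/6∣≤β.
sixth : ℕ → ℚ
sixth zero    = 0ℚ
sixth (suc n) = sixth n + (½ - im (expSum n (0ℚ ,i sixth n)))

β θ : ℚ
β = + 4 / 5
θ = + 7 / 20

0≤β : 0ℚ ≤ β
0≤β = from-yes (0ℚ ≤? β)

-- Majorants on |x| ≤ β for the real and imaginary parts of (ix)ᵏ / k!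
-- (ρ, σ) and for their Lipschitz constants (dρ, dσ).
ρ σ dρ dσ : ℕ → ℚ
ρ zero    = 1ℚ
ρ (suc k) = inv k * (σ k * β)
σ zero    = 0ℚ
σ (suc k) = inv k * (ρ k * β)
dρ zero    = 0ℚ
dρ (suc k) = inv k * (dσ k * β + σ k)
dσ zero    = 0ℚ
dσ (suc k) = inv k * (dρ k * β + ρ k)

0≤ρ : ∀ k → 0ℚ ≤ ρ k
0≤σ : ∀ k → 0ℚ ≤ σ k
0≤ρ zero    = <⇒≤ 0<1
0≤ρ (suc k) = *-nonneg (0≤inv k) (*-nonneg (0≤σ k) 0≤β)
0≤σ zero    = ≤-refl
0≤σ (suc k) = *-nonneg (0≤inv k) (*-nonneg (0≤ρ k) 0≤β)

0≤dρ : ∀ k → 0ℚ ≤ dρ k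
0≤dσ : ∀ k → 0ℚ ≤ dσ k
0≤dρ zero    = ≤-refl
0≤dρ (suc k) = *-nonneg (0≤inv k) (+-nonneg (*-nonneg (0≤dσ k) 0≤β) (0≤σ k))
0≤dσ zero    = ≤-refl
0≤dσ (suc k) = *-nonneg (0≤inv k) (+-nonneg (*-nonneg (0≤dρ k) 0≤β) (0≤ρ k))

ρ+σ : ∀ k → ρ k + σ k ≡ τ β k
ρ+σ zero    = refl
ρ+σ (suc k) = trans
  (solve 4 (λ v r s b → v :* (s :* b) :+ v :* (r :* b) := v :* ((r :+ s) :* b)) refl (inv k) (ρ k) (σ k) β)
  (cong (λ t → inv k * (t * β)) (ρ+σ k))

dρ+dσ : ∀ k → dρ k + dσ k ≡ D β k
dρ+dσ zero    = refl
dρ+dσ (suc k) = trans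
  (solve 6 (λ v r s dr ds b → v :* (ds :* b :+ s) :+ v :* (dr :* b :+ r) := v :* ((dr :+ ds) :* b :+ (r :+ s)))
    refl (inv k) (ρ k) (σ k) (dρ k) (dσ k) β)
  (trans (cong₂ (λ d t → inv k * (d * β + t)) (dρ+dσ k) (ρ+σ k)) (D-step β k))

dσ≤D : ∀ k → dσ k ≤ D β k
dσ≤D k = subst₂ _≤_ (+-identityˡ (dσ k)) (dρ+dσ k) (+-monoˡ-≤ (dσ k) (0≤dρ k))

re-term : ∀ k x → re (expTerm (suc k) (0ℚ ,i x)) ≡ - (inv k * (im (expTerm k (0ℚ ,i x)) * x))
re-term k x = solve 4 (λ v r s x → v :* (r :* con 0ℚ :- s :* x) := :- (v :* (s :* x))) refl
  (inv k) (re (expTerm k (0ℚ ,i x))) (im (expTerm k (0ℚ ,i x))) x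

im-term : ∀ k x → im (expTerm (suc k) (0ℚ ,i x)) ≡ inv k * (re (expTerm k (0ℚ ,i x)) * x)
im-term k x = solve 4 (λ v r s x → v :* (r :* x :+ s :* con 0ℚ) := v :* (r :* x)) refl
  (inv k) (re (expTerm k (0ℚ ,i x))) (im (expTerm k (0ℚ ,i x))) x

∣inv*∣-≤ : ∀ k q {a} → ∣ q ∣ ≤ a → ∣ inv k * q ∣ ≤ inv k * a
∣inv*∣-≤ k q qa = ∣*∣-≤ (inv k) q (≤-reflexive (0≤p⇒∣p∣≡p (0≤inv k))) qa

re-bound : ∀ {x} → ∣ x ∣ ≤ β → ∀ k → ∣ re (expTerm k (0ℚ ,i x)) ∣ ≤ ρ k
im-bound : ∀ {x} → ∣ x ∣ ≤ β → ∀ k → ∣ im (expTerm k (0ℚ ,i x)) ∣ ≤ σ k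
re-bound xβ zero    = ≤-refl
re-bound {x} xβ (suc k) = subst (_≤ ρ (suc k))
  (sym (trans (cong ∣_∣ (re-term k x)) (∣-p∣≡∣p∣ (inv k * (im (expTerm k (0ℚ ,i x)) * x)))))
  (∣inv*∣-≤ k (im (expTerm k (0ℚ ,i x)) * x) (∣*∣-≤ (im (expTerm k (0ℚ ,i x))) x (im-bound xβ k) xβ))
im-bound xβ zero    = ≤-refl
im-bound {x} xβ (suc k) = subst (λ e → ∣ e ∣ ≤ σ (suc k)) (sym (im-term k x))
  (∣inv*∣-≤ k (re (expTerm k (0ℚ ,i x)) * x) (∣*∣-≤ (re (expTerm k (0ℚ ,i x))) x (re-bound xβ k) xβ))

lipschitz-step : ∀ {d r δ} k s t x y → ∣ s - t ∣ ≤ d * δ → ∣ t ∣ ≤ r → ∣ x ∣ ≤ β → ∣ x - y ∣ ≤ δ →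
                 ∣ inv k * (s * x) - inv k * (t * y) ∣ ≤ inv k * (d * β + r) * δ
lipschitz-step {d} {r} {δ} k s t x y st tr xβ xy = subst₂ (λ e f → ∣ e ∣ ≤ f)
  (solve 5 (λ v s t x y → v :* ((s :- t) :* x :+ t :* (x :- y)) := v :* (s :* x) :- v :* (t :* y)) refl (inv k) s t x y)
  (solve 5 (λ v d r e b → v :* (d :* e :* b :+ r :* e) := v :* (d :* b :+ r) :* e) refl (inv k) d r δ β)
  (∣inv*∣-≤ k ((s - t) * x + t * (x - y))
    (∣+∣-≤ ((s - t) * x) (t * (x - y)) (∣*∣-≤ (s - t) x st xβ) (∣*∣-≤ t (x - y) tr xy)))

module _ {x y δ : ℚ} (xβ : ∣ x ∣ ≤ β) (yβ : ∣ y ∣ ≤ β) (xy : ∣ x - y ∣ ≤ δ) where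

  re-lipschitz : ∀ k → ∣ re (expTerm k (0ℚ ,i x)) - re (expTerm k (0ℚ ,i y)) ∣ ≤ dρ k * δ
  im-lipschitz : ∀ k → ∣ im (expTerm k (0ℚ ,i x)) - im (expTerm k (0ℚ ,i y)) ∣ ≤ dσ k * δ
  re-lipschitz zero    = ≤-reflexive (sym (*-zeroˡ δ))
  re-lipschitz (suc k) = subst (_≤ dρ (suc k) * δ)
    (sym (trans (cong₂ (λ a b → ∣ a - b ∣) (re-term k x) (re-term k y))
      (trans (cong ∣_∣ (solve 2 (λ a b → (:- a) :- (:- b) := :- (a :- b)) refl a b)) (∣-p∣≡∣p∣ (a - b)))))
    (lipschitz-step {dσ k} {σ k} k (im (expTerm k (0ℚ ,i x))) (im (expTerm k (0ℚ ,i y))) x y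
      (im-lipschitz k) (im-bound yβ k) xβ xy)
    where
    a = inv k * (im (expTerm k (0ℚ ,i x)) * x)
    b = inv k * (im (expTerm k (0ℚ ,i y)) * y)
  im-lipschitz zero    = ≤-reflexive (sym (*-zeroˡ δ))
  im-lipschitz (suc k) = subst (_≤ dσ (suc k) * δ)
    (sym (cong₂ (λ a b → ∣ a - b ∣) (im-term k x) (im-term k y)))
    (lipschitz-step {dρ k} {ρ k} k (re (expTerm k (0ℚ ,i x))) (re (expTerm k (0ℚ ,i y))) x y
      (re-lipschitz k) (re-bound yβ k) xβ xy)

-- DS n = Σ_{2 ≤ k ≤ n + 1} dσ k
DS : ℕ → ℚ
DS zero    = 0ℚ
DS (suc n) = DS n + dσ (suc (suc n))

β-halves : ∀ n → τ β (suc (suc n)) + τ β (suc (suc n)) ≤ τ β (suc n)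
β-halves n = τ-halves 0≤β (suc n)
  (≤-trans (from-yes (β + β ≤? ι 2)) (ι-mono (ℕ.s≤s (ℕ.s≤s (ℕ.z≤n {n})))))

DS≤θ : ∀ n → DS n ≤ θ
DS≤θ 0 = from-yes (DS 0 ≤? θ)
DS≤θ 1 = from-yes (DS 1 ≤? θ)
DS≤θ 2 = from-yes (DS 2 ≤? θ)
DS≤θ 3 = from-yes (DS 3 ≤? θ)
DS≤θ 4 = from-yes (DS 4 ≤? θ)
DS≤θ (suc (suc (suc (suc (suc n))))) = ≤-trans
  (subst (_≤ DS (5 ℕ.+ n) + τ β (5 ℕ.+ n)) (+-identityʳ (DS (5 ℕ.+ n)))
    (+-monoʳ-≤ (DS (5 ℕ.+ n)) (0≤τ 0≤β (5 ℕ.+ n))))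
  (go n)
  where
  go : ∀ n → DS (5 ℕ.+ n) + τ β (5 ℕ.+ n) ≤ θ
  go zero    = from-yes (DS 5 + τ β 5 ≤? θ)
  go (suc n) = ≤-trans
    (≤-reflexive (+-assoc (DS (5 ℕ.+ n)) (dσ (7 ℕ.+ n)) (τ β (6 ℕ.+ n))))
    (≤-trans
      (+-monoʳ-≤ (DS (5 ℕ.+ n)) (≤-trans (+-monoˡ-≤ (τ β (6 ℕ.+ n)) (dσ≤D (7 ℕ.+ n))) (β-halves (4 ℕ.+ n))))
      (go n))

sinSum : ℕ → ℚ → ℚ
sinSum n x = im (expSum n (0ℚ ,i x))

contraction : ∀ {x y δ} → ∣ x ∣ ≤ β → ∣ y ∣ ≤ β → ∣ x - y ∣ ≤ δ → ∀ n →
              ∣ (x - y) - (sinSum (suc n) x - sinSum (suc n) y) ∣ ≤ θ * δ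
contraction {x} {y} {δ} xβ yβ xy n = ≤-trans (go n)
  (*-monoʳ-≤-nonNeg δ {{nonNegative (≤-trans (0≤∣p∣ (x - y)) xy)}} (DS≤θ n))
  where
  sinSum₁ : ∀ x → sinSum 1 x ≡ x
  sinSum₁ = solve 1 (λ x → con 0ℚ :+ con 1ℚ :* (con 1ℚ :* x :+ con 0ℚ :* con 0ℚ) := x) refl
  go : ∀ n → ∣ (x - y) - (sinSum (suc n) x - sinSum (suc n) y) ∣ ≤ DS n * δ
  go zero    = ≤-reflexive (trans
    (cong₂ (λ a b → ∣ (x - y) - (a - b) ∣) (sinSum₁ x) (sinSum₁ y))
    (trans (cong ∣_∣ (+-inverseʳ (x - y))) (sym (*-zeroˡ δ))))
  go (suc n) = subst₂ (λ e f → ∣ e ∣ ≤ f)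
    (solve 5 (λ d A B a b → (d :- (A :- B)) :+ :- (a :- b) := d :- ((A :+ a) :- (B :+ b))) refl (x - y)
      (sinSum (suc n) x) (sinSum (suc n) y) a b)
    (sym (*-distribʳ-+ δ (DS n) (dσ (suc (suc n)))))
    (∣+∣-≤ ((x - y) - (sinSum (suc n) x - sinSum (suc n) y)) (- (a - b)) (go n)
      (subst (_≤ dσ (suc (suc n)) * δ) (sym (∣-p∣≡∣p∣ (a - b))) (im-lipschitz xβ yβ xy (suc (suc n)))))
    where
    a = im (expTerm (suc (suc n)) (0ℚ ,i x))
    b = im (expTerm (suc (suc n)) (0ℚ ,i y))

sinSum-0 : ∀ n → sinSum n 0ℚ ≡ 0ℚ
sinSum-0 zero    = refl
sinSum-0 (suc n) = trans (cong₂ _+_ (sinSum-0 n) (trans (im-term n 0ℚ)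
  (trans (cong (inv n *_) (*-zeroʳ (re (expTerm n (0ℚ ,i 0ℚ))))) (*-zeroʳ (inv n))))) refl

∣sixth∣≤β : ∀ n → ∣ sixth n ∣ ≤ β
∣sixth∣≤β 0 = from-yes (∣ sixth 0 ∣ ≤? β)
∣sixth∣≤β 1 = from-yes (∣ sixth 1 ∣ ≤? β)
∣sixth∣≤β (suc (suc n)) = ≤-trans
  (subst (λ e → ∣ e ∣ ≤ ½ + θ * β) eq
    (∣+∣-≤ ½ ((x - 0ℚ) - (s - sinSum (suc n) 0ℚ)) ≤-refl
      (contraction (∣sixth∣≤β (suc n)) 0≤β (subst (λ e → ∣ e ∣ ≤ β) (sym (+-identityʳ x)) (∣sixth∣≤β (suc n))) n)))
  (from-yes (½ + θ * β ≤? β))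
  where
  x = sixth (suc n)
  s = sinSum (suc n) x
  eq : ½ + ((x - 0ℚ) - (s - sinSum (suc n) 0ℚ)) ≡ x + (½ - s)
  eq = trans (cong (λ e → ½ + ((x - 0ℚ) - (s - e))) (sinSum-0 (suc n)))
    (solve 3 (λ h x s → h :+ ((x :- con 0ℚ) :- (s :- con 0ℚ)) := x :+ (h :- s)) refl ½ x s)

pow½ : ℕ → ℚ
pow½ zero    = 1ℚ
pow½ (suc n) = ½ * pow½ n

0≤pow½ : ∀ n → 0ℚ ≤ pow½ n
0≤pow½ zero    = <⇒≤ 0<1
0≤pow½ (suc n) = *-nonneg (from-yes (0ℚ ≤? ½)) (0≤pow½ n)

τ≤pow½ : ∀ n → τ β (suc n) ≤ pow½ n
τ≤pow½ zero    = from-yes (τ β 1 ≤? 1ℚ)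
τ≤pow½ (suc n) = ≤-trans
  (subst (_≤ ½ * τ β (suc n))
    (trans (*-distribˡ-+ ½ t t) (halves t))
    (*-monoˡ-≤-nonNeg ½ (β-halves n)))
  (*-monoˡ-≤-nonNeg ½ (τ≤pow½ n))
  where t = τ β (suc (suc n))

8ℚ 16ℚ : ℚ
8ℚ  = + 8 / 1
16ℚ = + 16 / 1

sixth-step : ∀ n → ∣ sixth (suc n) - sixth n ∣ ≤ 8ℚ * pow½ n
sixth-step 0 = from-yes (∣ sixth 1 - sixth 0 ∣ ≤? 8ℚ * pow½ 0)
sixth-step 1 = from-yes (∣ sixth 2 - sixth 1 ∣ ≤? 8ℚ * pow½ 1)
sixth-step (suc (suc n)) = ≤-trans
  (subst (λ e → ∣ e ∣ ≤ θ * (8ℚ * pow½ (suc n)) + pow½ (suc n))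
    (solve 6 (λ h x y A B a → ((x :- y) :- (A :- B)) :+ :- a := (x :+ (h :- (A :+ a))) :- (y :+ (h :- B))) refl
      ½ x y (sinSum (suc n) x) (sinSum (suc n) y) a)
    (∣+∣-≤ ((x - y) - (sinSum (suc n) x - sinSum (suc n) y)) (- a)
      (contraction (∣sixth∣≤β (suc (suc n))) (∣sixth∣≤β (suc n)) (sixth-step (suc n)) n)
      (subst (_≤ pow½ (suc n)) (sym (∣-p∣≡∣p∣ a))
        (≤-trans (im-bound (∣sixth∣≤β (suc (suc n))) (suc (suc n)))
          (≤-trans (subst₂ _≤_ (+-identityˡ (σ (suc (suc n)))) (ρ+σ (suc (suc n)))
                     (+-monoˡ-≤ (σ (suc (suc n))) (0≤ρ (suc (suc n)))))
            (τ≤pow½ (suc n)))))))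
  (subst₂ _≤_
    (solve 3 (λ t e q → (t :* e :+ con 1ℚ) :* q := t :* (e :* q) :+ q) refl θ 8ℚ (pow½ (suc n)))
    (solve 3 (λ e h q → (e :* h) :* q := e :* (h :* q)) refl 8ℚ ½ (pow½ (suc n)))
    (*-monoʳ-≤-nonNeg (pow½ (suc n)) {{nonNegative (0≤pow½ (suc n))}} (from-yes (θ * 8ℚ + 1ℚ ≤? 8ℚ * ½))))
  where
  x = sixth (suc (suc n))
  y = sixth (suc n)
  a = im (expTerm (suc (suc n)) (0ℚ ,i x))

pow½≤inv : ∀ n → pow½ n ≤ inv n
pow½≤inv n = subst₂ _≤_
  (trans (cong (inv n *_) (*-comm (pow½ n) (ι (suc n)))) (inv-cancel n (pow½ n))) (*-identityʳ (inv n))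
  (*-monoˡ-≤-nonNeg (inv n) {{nonNegative (0≤inv n)}} (go n))
  where
  go : ∀ n → pow½ n * ι (suc n) ≤ 1ℚ
  go zero    = ≤-refl
  go (suc n) = ≤-trans
    (subst₂ _≤_
      (solve 3 (λ h q i → (h :* q) :* (i :+ con 1ℚ) := (h :* q) :* (con 1ℚ :+ i)) refl ½ (pow½ n) (ι (suc n)))
      (trans (solve 3 (λ h q i → (h :* q) :* (i :+ i) := (h :+ h) :* (q :* i)) refl ½ (pow½ n) (ι (suc n)))
        (*-identityˡ (pow½ n * ι (suc n))))
      (*-monoˡ-≤-nonNeg (½ * pow½ n) {{nonNegative (0≤pow½ (suc n))}}
        (+-monoʳ-≤ (ι (suc n)) (ι-mono {1} (ℕ.s≤s (ℕ.z≤n {n}))))))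
    (go n)

sixth-tail : ∀ n j → ∣ sixth (j ℕ.+ n) - sixth n ∣ ≤ 16ℚ * pow½ n - 16ℚ * pow½ (j ℕ.+ n)
sixth-tail n zero    = ≤-reflexive (trans (cong ∣_∣ (+-inverseʳ (sixth n))) (sym (+-inverseʳ (16ℚ * pow½ n))))
sixth-tail n (suc j) = ≤-trans (∣-∣-triangle (sixth (suc m)) (sixth m) (sixth n))
  (≤-trans (+-mono-≤ (sixth-step m) (sixth-tail n j))
    (≤-reflexive (solve 2 (λ p q → con 8ℚ :* p :+ (con 16ℚ :* q :- con 16ℚ :* p)
                                   := con 16ℚ :* q :- con 16ℚ :* (con ½ :* p)) refl (pow½ m) (pow½ n))))
  where m = j ℕ.+ n

sixth-cauchy : Cauchy sixth
sixth-cauchy = cauchy-ordered {sixth} λ ε 0<ε → fromN ε (vanish {16ℚ} (from-yes (0ℚ ≤? 16ℚ)) 0<ε)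
  where
  fromN : ∀ ε → (∃[ N ] ∀ n → N ℕ.≤ n → inv n * 16ℚ < ε) →
          ∃[ N ] ∀ m n → N ℕ.≤ n → n ℕ.≤ m → ∣ sixth m - sixth n ∣ < ε
  fromN ε (N , v) = N , λ m n N≤n n≤m → ≤-<-trans
    (≤-trans
      (subst (λ m → ∣ sixth m - sixth n ∣ ≤ 16ℚ * pow½ n - 16ℚ * pow½ m) (ℕ.m∸n+n≡m n≤m) (sixth-tail n (m ℕ.∸ n)))
      (≤-trans
        (subst (16ℚ * pow½ n - 16ℚ * pow½ m ≤_) (+-identityʳ (16ℚ * pow½ n))
          (+-monoʳ-≤ (16ℚ * pow½ n) (neg-antimono-≤ (*-nonneg (from-yes (0ℚ ≤? 16ℚ)) (0≤pow½ m)))))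
        (subst (16ℚ * pow½ n ≤_) (*-comm 16ℚ (inv n)) (*-monoˡ-≤-nonNeg 16ℚ (pow½≤inv n)))))
    (v n N≤n)

π/6 : ℝ
π/6 = mkℝ sixth sixth-cauchy

π : ℝ
π = fromℚᴿ (+ 6 / 1) *ᴿ π/6

∣π/6∣≤β : ∀ n → ∣ seq π/6 n ∣ ≤ + 4 / 5
∣π/6∣≤β = ∣sixth∣≤β

sin-π/6 : Im (exp (fromℚᴿ 0ℚ +i π/6)) ≈ᴿ fromℚᴿ ½
sin-π/6 ε 0<ε = fromN (vanish {8ℚ} (from-yes (0ℚ ≤? 8ℚ)) 0<ε)
  where
  fromN : (∃[ N ] ∀ n → N ℕ.≤ n → inv n * 8ℚ < ε) →
          ∃[ N ] ∀ n → N ℕ.≤ n → ∣ sinSum n (sixth n) - ½ ∣ < ε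
  fromN (N , v) = N , λ n N≤n → ≤-<-trans
    (subst (_≤ 8ℚ * pow½ n)
      (trans (cong ∣_∣ (solve 3 (λ x h s → (x :+ (h :- s)) :- x := h :- s) refl (sixth n) ½ (sinSum n (sixth n))))
        (∣-∣-sym ½ (sinSum n (sixth n))))
      (sixth-step n))
    (≤-<-trans (subst (8ℚ * pow½ n ≤_) (*-comm 8ℚ (inv n)) (*-monoˡ-≤-nonNeg 8ℚ (pow½≤inv n))) (v n N≤n))

e : ℂ
e = exp 1ℂ

Σ[_] : ∀ {n} → Vector ℂ n → ℂ
Σ[_] = Vector.foldr _+ℂ_ 0ℂ

LinearlyIndependent : ∀ {n} → Vector ℂ n → Set
LinearlyIndependent {n} z = (q : Vector ℚ n) → Σ[ (λ i → fromℚ (q i) *ℂ z i) ] ≈ 0ℂ → ∀ i → q i ≡ 0ℚ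

-- Polynomials over ℚ in n variables, as iterated univariate polynomials
-- given by coefficient lists in ascending degree (trailing zeros allowed).
Polynomial : ℕ → Set
Polynomial zero    = ℚ
Polynomial (suc n) = List (Polynomial n)

IsZero : ∀ n → Polynomial n → Set
IsZero zero    q = q ≡ 0ℚ
IsZero (suc n) p = All (IsZero n) p

evaluate : ∀ n → Polynomial n → Vector ℂ n → ℂ
evaluate zero    q w = fromℚ q
evaluate (suc n) p w = foldr (λ c v → evaluate n c (w ∘ suc) +ℂ w zero *ℂ v) 0ℂ p

AlgebraicallyIndependent : ∀ {n} → Vector ℂ n → Set
AlgebraicallyIndependent {n} w = (p : Polynomial n) → evaluate n p w ≈ 0ℂ → IsZero n p

-- The double negation is the classical existential quantifier: no choice of
-- the independent entries has to be computed from z.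
SchanuelConjecture : Set
SchanuelConjecture = ∀ n (z : Vector ℂ n) → LinearlyIndependent z →
  ¬ ¬ (∃[ f ] Injective {A = Fin n} {B = Fin (n ℕ.+ n)} _≡_ _≡_ f ×
              AlgebraicallyIndependent ((z ++ (exp ∘ z)) ∘ f))

Rational : Pred ℂ 0ℓ
Rational z = ∃[ q ] z ≈ fromℚ q

-- The subfield of ℂ generated by S.  The inverse is specified by its defining
-- equation, since x ≉ 0ℂ alone does not compute one.
data Generated (S : Pred ℂ 0ℓ) : Pred ℂ 0ℓ where
  gen        : ∀ {x} → S x → Generated S x
  ≈-closed   : ∀ {x y} → x ≈ y → Generated S x → Generated S y
  0-closed   : Generated S 0ℂ
  1-closed   : Generated S 1ℂ
  +-closed   : ∀ {x y} → Generated S x → Generated S y → Generated S (x +ℂ y)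
  neg-closed : ∀ {x} → Generated S x → Generated S (-ℂ x)
  *-closed   : ∀ {x y} → Generated S x → Generated S y → Generated S (x *ℂ y)
  ⁻¹-closed  : ∀ {x y} → Generated S x → x *ℂ y ≈ 1ℂ → Generated S y

-- Coefficient lists in ascending degree
evaluate₁ : List ℂ → ℂ → ℂ
evaluate₁ p x = foldr (λ c v → c +ℂ x *ℂ v) 0ℂ p

AlgebraicOver : Pred ℂ 0ℓ → Pred ℂ 0ℓ
AlgebraicOver F x = ∃[ p ] All F p × Any (_≉ 0ℂ) p × evaluate₁ p x ≈ 0ℂ

-- In what follows l is the chosen value of ln b.
power : ℂ → ℂ → ℂ
power l x = exp (x *ℂ l)

Power : ℂ → Pred ℂ 0ℓ → Pred ℂ 0ℓ
Power l S y = ∃[ x ] S x × y ≈ power l x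

Log : ℂ → Pred ℂ 0ℓ → Pred ℂ 0ℓ
Log l S w = S (power l w)

ELₙ : ℂ → ℕ → Pred ℂ 0ℓ
ELₙ l zero    = Rational
ELₙ l (suc n) = AlgebraicOver (Generated (ELₙ l n ∪ Power l (ELₙ l n) ∪ Log l (ELₙ l n)))

EL : ℂ → Pred ℂ 0ℓ
EL l x = ∃[ n ] ELₙ l n x

-- b = -1 with ln b = iπ
ELᵃˡᵍ : Pred ℂ 0ℓ
ELᵃˡᵍ = EL (fromℚᴿ 0ℚ +i π)

{-# OPTIONS --safe #-}
-- Write l = iπ, and b^x = exp (x l).  Every element of EL is obtained from ℚ
-- by finitely many steps, each of which solves a polynomial equation over
-- what has been found, or adds b^x for a known x, or x for a known b^x.  Keep
-- 1 = x₀, x₁, …, xₖ, linearly independent over ℚ, among the exponents x, such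
-- that everything found so far is algebraic over k elements: a new exponent is
-- either independent of the old ones, and then k grows by one together with
-- the transcendence degree, or a rational combination of them, and then b^x is
-- algebraic over the known elements.  Suppose now that w ≠ 0 and exp w are
-- among the elements found.  If w is independent of the xⱼ l, then Schanuel's
-- conjecture for w, x₀ l, …, xₖ l gives k + 2 algebraically independent numbers
-- in a field of transcendence degree ≤ k + 1, generated by l and the elements
-- found.  Otherwise w = x l with x ≠ 0 found, hence l is algebraic over the
-- elements found, and the conjecture for x₀ l, …, xₖ l gives k + 1 independent
-- numbers in transcendence degree k.
--
-- Transcendence degrees are bounded by counting: the polynomials of degree ≤ L
-- in the elements found span, up to a common denominator, a ℚ-vector space of
-- dimension O(Lᵏ), which has no room for the monomials in k + 1 algebraically
-- independent elements.
module Submission where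

open import Algebra.Bundles using (CommutativeRing)
open import Algebra.Solver.Ring.AlmostCommutativeRing using (_-Raw-AlmostCommutative⟶_; fromCommutativeRing)
open import Data.Rational.Base as ℚ using (ℚ; mkℚ; 0ℚ; 1ℚ)
open import Level using (0ℓ)
open import Relation.Nullary using (¬_)

-- The counting is done in an abstract integral domain over ℚ, later instantiated by ℂ. `cancel-0`
-- excludes zero divisors, and `stable` allows equations to be proved by contradiction, since
-- equality in ℂ is not decided.
module AlgebraicDependence
  (R : CommutativeRing 0ℓ 0ℓ)
  (embedding : ℚ.+-*-rawRing -Raw-AlmostCommutative⟶ fromCommutativeRing R)
  (stable : ∀ x y → ¬ ¬ CommutativeRing._≈_ R x y → CommutativeRing._≈_ R x y)
  (cancel-0 : ∀ x y → ¬ CommutativeRing._≈_ R x (CommutativeRing.0# R) →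
              CommutativeRing._≈_ R (CommutativeRing._*_ R x y) (CommutativeRing.0# R) →
              CommutativeRing._≈_ R y (CommutativeRing.0# R))
  (1≉0 : ¬ CommutativeRing._≈_ R (CommutativeRing.1# R) (CommutativeRing.0# R))
  where

  open import Defs using (Polynomial; IsZero; ι; ι≡)
  open import Data.Empty using (⊥; ⊥-elim)
  open import Data.Fin.Base using (zero; suc; punchIn; splitAt)
  open import Data.Fin.Properties using (any?; splitAt⁻¹-↑ˡ; splitAt⁻¹-↑ʳ)
  import Data.Integer.Base as ℤ
  import Data.Integer.Properties as ℤ
  open import Data.List.Base as List using (List; []; _∷_; length; foldr)
  open import Data.List.Properties using (length-++; length-map)
  open import Data.List.Relation.Unary.All as All using (All; []; _∷_)
  import Data.List.Relation.Unary.All.Properties as All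
  open import Data.List.Relation.Unary.Any using (Any; here; there)
  open import Data.Maybe.Base as Maybe using (Maybe)
  open import Data.Nat.Base as ℕ using (ℕ; zero; suc)
  import Data.Nat.Properties as ℕ
  open import Data.Product.Base using (∃-syntax; _×_; _,_; proj₁; proj₂)
  import Data.Rational.Properties as ℚ
  import Data.Rational.Unnormalised.Base as ℚᵘ
  import Data.Rational.Unnormalised.Properties as ℚᵘ
  open import Data.Sum.Base using (_⊎_; inj₁; inj₂)
  open import Data.Sum.Properties using ([,]-map)
  open import Data.Vec.Functional as Vector using (Vector; _++_; take; drop; insertAt)
  open import Data.Vec.Functional.Properties using (insertAt-lookup; insertAt-punchIn)
  open import Function.Base using (_∘_)
  open import Relation.Binary.Consequences using (dec⇒weaklyDec)
  open import Relation.Binary.PropositionalEquality as ≡ using (_≡_; _≢_)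
  open import Relation.Nullary using (yes; no)
  open import Relation.Nullary.Decidable using (¬?; decidable-stable)
  open import Relation.Unary using (Pred; _∪_; _⊆_)

  open CommutativeRing R hiding (zero)
  open _-Raw-AlmostCommutative⟶_ embedding
  open import Algebra.Properties.Ring ring using (-0#≈0#)
  open import Algebra.Properties.Semiring.Exp semiring using (_^_)
  open import Algebra.Properties.Semiring.Sum semiring using (sum; sum-cong-≋; sum-remove; ∑-distrib-+; sum-replicate-zero; *-distribˡ-sum; *-distribʳ-sum)
  open import Relation.Binary.Reasoning.Setoid setoid

  private
    ⟦⟧-weaklyDecidable : ∀ p q → Maybe (⟦ p ⟧ ≈ ⟦ q ⟧)
    ⟦⟧-weaklyDecidable p q = Maybe.map (λ p≡q → reflexive (≡.cong ⟦_⟧ p≡q)) (dec⇒weaklyDec ℚ._≟_ p q)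

  open import Algebra.Solver.Ring ℚ.+-*-rawRing (fromCommutativeRing R) embedding ⟦⟧-weaklyDecidable
    using (solve; _:=_; _:+_; _:*_; _:-_; :-_)

  -- Linear algebra over ℚ

  *-≉0 : ∀ {x y} → x ≉ 0# → y ≉ 0# → x * y ≉ 0#
  *-≉0 {x} {y} x≉0 y≉0 xy≈0 = y≉0 (cancel-0 x y x≉0 xy≈0)

  ^-≉0 : ∀ {x} → x ≉ 0# → ∀ n → x ^ n ≉ 0#
  ^-≉0 x≉0 zero    = 1≉0
  ^-≉0 x≉0 (suc n) = *-≉0 x≉0 (^-≉0 x≉0 n)

  -- The coefficients are split off one at a time, so that elimination of the head `w` finds its
  -- coefficient as a first projection.
  Span : List Carrier → Carrier → Set
  Span []       u = u ≈ 0#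
  Span (w ∷ ws) u = ∃[ q ] Span ws (u - ⟦ q ⟧ * w)

  span-resp : ∀ ws {u v} → u ≈ v → Span ws u → Span ws v
  span-resp []       u≈v u≈0     = trans (sym u≈v) u≈0
  span-resp (w ∷ ws) u≈v (q , s) = q , span-resp ws (+-congʳ u≈v) s

  span-drop : ∀ ws w {q u} → ⟦ q ⟧ ≈ 0# → Span ws (u - ⟦ q ⟧ * w) → Span ws u
  span-drop ws w {q} {u} q≈0 = span-resp ws (begin
    u - ⟦ q ⟧ * w  ≈⟨ +-congˡ (-‿cong (trans (*-congʳ q≈0) (zeroˡ w))) ⟩
    u - 0#         ≈⟨ +-congˡ -0#≈0# ⟩
    u + 0#         ≈⟨ +-identityʳ u ⟩
    u              ∎)

  span-skip : ∀ ws w {u} → Span ws u → Span (w ∷ ws) u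
  span-skip ws w {u} s = 0ℚ , span-resp ws (begin
    u              ≈⟨ sym (+-identityʳ u) ⟩
    u + 0#         ≈⟨ +-congˡ (sym -0#≈0#) ⟩
    u - 0#         ≈⟨ +-congˡ (-‿cong (sym (trans (*-congʳ 0-homo) (zeroˡ w)))) ⟩
    u - ⟦ 0ℚ ⟧ * w ∎) s

  span-0 : ∀ ws → Span ws 0#
  span-0 []       = refl
  span-0 (w ∷ ws) = span-skip ws w (span-0 ws)

  span-+ : ∀ ws {u v} → Span ws u → Span ws v → Span ws (u + v)
  span-+ []       u≈0 v≈0 = trans (+-cong u≈0 v≈0) (+-identityˡ 0#)
  span-+ (w ∷ ws) {u} {v} (p , s) (q , t) = p ℚ.+ q , span-resp ws
    (trans (solve 5 (λ u v w p q → (u :- p :* w) :+ (v :- q :* w) := (u :+ v) :- (p :+ q) :* w) refl u v w ⟦ p ⟧ ⟦ q ⟧)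
      (+-congˡ (-‿cong (*-congʳ (sym (+-homo p q))))))
    (span-+ ws s t)

  span-· : ∀ ws q {u} → Span ws u → Span ws (⟦ q ⟧ * u)
  span-· []       q u≈0 = trans (*-congˡ u≈0) (zeroʳ ⟦ q ⟧)
  span-· (w ∷ ws) q {u} (p , s) = q ℚ.* p , span-resp ws
    (trans (solve 4 (λ u w p q → q :* (u :- p :* w) := q :* u :- (q :* p) :* w) refl u w ⟦ p ⟧ ⟦ q ⟧)
      (+-congˡ (-‿cong (*-congʳ (sym (*-homo q p))))))
    (span-· ws q s)

  span-++ˡ : ∀ ws {vs u} → Span ws u → Span (ws List.++ vs) u
  span-++ˡ []       {vs} u≈0 = span-resp vs (sym u≈0) (span-0 vs)
  span-++ˡ (w ∷ ws) (q , s)  = q , span-++ˡ ws s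

  span-++ʳ : ∀ ws {vs u} → Span vs u → Span (ws List.++ vs) u
  span-++ʳ []       s = s
  span-++ʳ (w ∷ ws) {vs} s = span-skip (ws List.++ vs) w (span-++ʳ ws s)

  span-map : ∀ a ws {u} → Span ws u → Span (List.map (a *_) ws) (a * u)
  span-map a []       u≈0 = trans (*-congˡ u≈0) (zeroʳ a)
  span-map a (w ∷ ws) {u} (q , s) = q , span-resp (List.map (a *_) ws)
    (solve 4 (λ a u w q → a :* (u :- q :* w) := a :* u :- q :* (a :* w)) refl a u w ⟦ q ⟧)
    (span-map a ws s)

  combination : ∀ {n} → Vector ℚ n → Vector Carrier n → Carrier
  combination q us = sum (λ i → ⟦ q i ⟧ * us i)

  sum-≈0 : ∀ {n} {us : Vector Carrier n} → (∀ i → us i ≈ 0#) → sum us ≈ 0#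
  sum-≈0 {n} us≈0 = trans (sum-cong-≋ us≈0) (sum-replicate-zero n)

  total : ∀ {n} → Vector ℚ n → ℚ
  total = Vector.foldr ℚ._+_ 0ℚ

  total-homo : ∀ {n} (q : Vector ℚ n) → ⟦ total q ⟧ ≈ sum (⟦_⟧ ∘ q)
  total-homo {zero}  q = 0-homo
  total-homo {suc n} q = trans (+-homo (q zero) (total (q ∘ suc))) (+-congˡ (total-homo (q ∘ suc)))

  all-≡0 : ∀ {n} {q : Vector ℚ n} → ¬ (∃[ i ] q i ≢ 0ℚ) → ∀ i → q i ≡ 0ℚ
  all-≡0 {q = q} none i = decidable-stable (q i ℚ.≟ 0ℚ) (λ q≢0 → none (i , q≢0))

  -- Gaussian elimination, by induction on `ws`. If all coefficients of `w` are 0, it is dropped;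
  -- otherwise some `us j` with `c j ≢ 0` serves as pivot, and the remaining vectors, cleared of
  -- `w`, lie in the span of `ws`. Without generators all vectors vanish, and every coefficient may
  -- be 1.
  dependent : ∀ {n} ws (us : Vector Carrier n) → length ws ℕ.< n → (∀ i → Span ws (us i)) →
              ∃[ q ] (∃[ i ] q i ≢ 0ℚ) × combination q us ≈ 0#
  dependent {suc n} [] us _ us≈0 =
    (λ _ → 1ℚ) , (zero , λ ()) , sum-≈0 (λ i → trans (*-congˡ (us≈0 i)) (zeroʳ ⟦ 1ℚ ⟧))
  dependent {suc n} (w ∷ ws) us (ℕ.s≤s ws<n) span with any? (λ i → ¬? (proj₁ (span i) ℚ.≟ 0ℚ))
  ... | no none = dependent ws us (ℕ.m≤n⇒m≤1+n ws<n) λ i →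
        span-drop ws w (trans (reflexive (≡.cong ⟦_⟧ (all-≡0 {q = proj₁ ∘ span} none i))) 0-homo) (proj₂ (span i))
  ... | yes (j , cⱼ≢0) = extend (dependent ws us′ ws<n span′)
    where
    c : Vector ℚ (suc n)
    c = proj₁ ∘ span
    instance
      _ : ℚ.NonZero (c j)
      _ = ℚ.≢-nonZero cⱼ≢0
    r : Vector ℚ n
    r i = c (punchIn j i) ℚ.* ℚ.1/ c j
    us′ : Vector Carrier n
    us′ i = us (punchIn j i) - ⟦ r i ⟧ * us j
    r*c : ∀ i → r i ℚ.* c j ≡ c (punchIn j i)
    r*c i = ≡.trans (ℚ.*-assoc (c (punchIn j i)) (ℚ.1/ c j) (c j))
      (≡.trans (≡.cong (c (punchIn j i) ℚ.*_) (ℚ.*-inverseˡ (c j))) (ℚ.*-identityʳ (c (punchIn j i))))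
    span′ : ∀ i → Span ws (us′ i)
    span′ i = span-resp ws (begin
        (u - ⟦ c (punchIn j i) ⟧ * w) + ⟦ ℚ.- r i ⟧ * (us j - ⟦ c j ⟧ * w)
          ≈⟨ +-cong (+-congˡ (-‿cong (*-congʳ (trans (reflexive (≡.cong ⟦_⟧ (≡.sym (r*c i)))) (*-homo (r i) (c j))))))
                    (*-congʳ (-‿homo (r i))) ⟩
        (u - ⟦ r i ⟧ * ⟦ c j ⟧ * w) + - ⟦ r i ⟧ * (us j - ⟦ c j ⟧ * w)
          ≈⟨ solve 5 (λ u v w r c → (u :- r :* c :* w) :+ :- r :* (v :- c :* w) := u :- r :* v) refl u (us j) w ⟦ r i ⟧ ⟦ c j ⟧ ⟩
        us′ i ∎)
      (span-+ ws (proj₂ (span (punchIn j i))) (span-· ws (ℚ.- r i) (proj₂ (span j))))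
      where u = us (punchIn j i)
    extend : (∃[ q ] (∃[ i ] q i ≢ 0ℚ) × combination q us′ ≈ 0#) →
             ∃[ q ] (∃[ i ] q i ≢ 0ℚ) × combination q us ≈ 0#
    extend (q , (i , qᵢ≢0) , q·us′≈0) = q⁺ , (punchIn j i , λ eq → qᵢ≢0 (≡.trans (≡.sym (insertAt-punchIn q j s i)) eq)) ,
      (begin
        combination q⁺ us
          ≈⟨ sum-remove {i = j} (λ i → ⟦ q⁺ i ⟧ * us i) ⟩
        ⟦ q⁺ j ⟧ * us j + sum (λ i → ⟦ q⁺ (punchIn j i) ⟧ * us (punchIn j i))
          ≈⟨ +-cong (*-congʳ (reflexive (≡.cong ⟦_⟧ (insertAt-lookup q j s))))
               (sum-cong-≋ λ i → *-congʳ (reflexive (≡.cong ⟦_⟧ (insertAt-punchIn q j s i)))) ⟩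
        ⟦ s ⟧ * us j + sum (λ i → ⟦ q i ⟧ * us (punchIn j i))
          ≈⟨ +-cong s*u (trans (sum-cong-≋ (λ i →
               solve 4 (λ q u r v → q :* u := q :* (u :- r :* v) :+ (q :* r) :* v) refl ⟦ q i ⟧ (us (punchIn j i)) ⟦ r i ⟧ (us j)))
               (∑-distrib-+ (λ i → ⟦ q i ⟧ * us′ i) (λ i → (⟦ q i ⟧ * ⟦ r i ⟧) * us j))) ⟩
        - T + (combination q us′ + T)
          ≈⟨ solve 2 (λ t c → :- t :+ (c :+ t) := c) refl T (combination q us′) ⟩
        combination q us′
          ≈⟨ q·us′≈0 ⟩
        0# ∎)
      where
      -- A relation `Σ qᵢ us′ᵢ = 0` contains `us j` with the coefficient `- Σ qᵢ rᵢ`, which becomes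
      -- the entry of `q⁺` at the pivot.
      s : ℚ
      s = ℚ.- total (λ i → q i ℚ.* r i)
      q⁺ : Vector ℚ (suc n)
      q⁺ = insertAt q j s
      T : Carrier
      T = sum (λ i → (⟦ q i ⟧ * ⟦ r i ⟧) * us j)
      s*u : ⟦ s ⟧ * us j ≈ - T
      s*u = begin
        ⟦ s ⟧ * us j
          ≈⟨ *-congʳ (trans (-‿homo (total (λ i → q i ℚ.* r i))) (-‿cong (trans (total-homo (λ i → q i ℚ.* r i))
               (sum-cong-≋ (λ i → *-homo (q i) (r i)))))) ⟩
        - sum (λ i → ⟦ q i ⟧ * ⟦ r i ⟧) * us j
          ≈⟨ solve 2 (λ a b → :- a :* b := :- (a :* b)) refl (sum (λ i → ⟦ q i ⟧ * ⟦ r i ⟧)) (us j) ⟩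
        - (sum (λ i → ⟦ q i ⟧ * ⟦ r i ⟧) * us j)
          ≈⟨ -‿cong (*-distribʳ-sum (us j) (λ i → ⟦ q i ⟧ * ⟦ r i ⟧)) ⟩
        - T ∎

  -- Polynomials in a set of generators, filtered by degree

  data Poly (S : Pred Carrier 0ℓ) : ℕ → Carrier → Set where
    rational : ∀ {L} q → Poly S L ⟦ q ⟧
    add      : ∀ {L u v} → Poly S L u → Poly S L v → Poly S L (u + v)
    product  : ∀ {L s u} → S s → Poly S L u → Poly S (suc L) (s * u)
    resp     : ∀ {L u v} → u ≈ v → Poly S L u → Poly S L v

  module _ {S : Pred Carrier 0ℓ} where

    poly-mono : ∀ {K L u} → K ℕ.≤ L → Poly S K u → Poly S L u
    poly-mono K≤L         (rational q)  = rational q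
    poly-mono K≤L         (add p r)     = add (poly-mono K≤L p) (poly-mono K≤L r)
    poly-mono (ℕ.s≤s K≤L) (product s p) = product s (poly-mono K≤L p)
    poly-mono K≤L         (resp eq p)   = resp eq (poly-mono K≤L p)

    poly-0 : ∀ {L} → Poly S L 0#
    poly-0 = resp 0-homo (rational 0ℚ)

    poly-1 : ∀ {L} → Poly S L 1#
    poly-1 = resp 1-homo (rational 1ℚ)

    poly-gen : ∀ {s} → S s → Poly S 1 s
    poly-gen {s} s∈S = resp (*-identityʳ s) (product s∈S poly-1)

    poly-· : ∀ q {L u} → Poly S L u → Poly S L (⟦ q ⟧ * u)
    poly-· q (rational r)              = resp (*-homo q r) (rational (q ℚ.* r))
    poly-· q (add {u = u} {v} p r)     = resp (sym (distribˡ ⟦ q ⟧ u v)) (add (poly-· q p) (poly-· q r))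
    poly-· q (product {s = s} {u} x p) = resp (solve 3 (λ s q u → s :* (q :* u) := q :* (s :* u)) refl s ⟦ q ⟧ u)
                                           (product x (poly-· q p))
    poly-· q (resp eq p)               = resp (*-congˡ eq) (poly-· q p)

    poly-* : ∀ {K L u v} → Poly S K u → Poly S L v → Poly S (K ℕ.+ L) (u * v)
    poly-* {K} {L} (rational q)          r = poly-mono (ℕ.m≤n+m L K) (poly-· q r)
    poly-* {v = v} (add {u = a} {b} p q) r = resp (sym (distribʳ v a b)) (add (poly-* p r) (poly-* q r))
    poly-* {v = v} (product {s = s} {u} x p) r = resp (sym (*-assoc s u v)) (product x (poly-* p r))
    poly-* (resp eq p)                   r = resp (*-congʳ eq) (poly-* p r)

    poly-neg : ∀ {L u} → Poly S L u → Poly S L (- u)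
    poly-neg {u = u} p = resp (begin
      ⟦ ℚ.- 1ℚ ⟧ * u  ≈⟨ *-congʳ (trans (-‿homo 1ℚ) (-‿cong 1-homo)) ⟩
      - 1# * u        ≈⟨ solve 2 (λ a u → :- a :* u := :- (a :* u)) refl 1# u ⟩
      - (1# * u)      ≈⟨ -‿cong (*-identityˡ u) ⟩
      - u             ∎) (poly-· (ℚ.- 1ℚ) p)

    poly-^ : ∀ {K u} → Poly S K u → ∀ n → Poly S (n ℕ.* K) (u ^ n)
    poly-^ p zero    = poly-1
    poly-^ p (suc n) = poly-* p (poly-^ p n)

  poly-⊆ : ∀ {S T : Pred Carrier 0ℓ} → S ⊆ T → ∀ {L u} → Poly S L u → Poly T L u
  poly-⊆ S⊆T (rational q)  = rational q
  poly-⊆ S⊆T (add p r)     = add (poly-⊆ S⊆T p) (poly-⊆ S⊆T r)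
  poly-⊆ S⊆T (product s p) = product (S⊆T s) (poly-⊆ S⊆T p)
  poly-⊆ S⊆T (resp eq p)   = resp eq (poly-⊆ S⊆T p)

  -- Up to the common denominator D, the polynomials of degree ≤ L in elements
  -- of S lie in a space of dimension ≤ N.
  Dimension≤ : Pred Carrier 0ℓ → ℕ → ℕ → Set
  Dimension≤ S L N = ∃[ D ] D ≉ 0# × ∃[ ws ] length ws ℕ.≤ N × (∀ u → Poly S L u → Span ws (D * u))

  -- This dimension is O(Lᵐ), so that ℚ(S) has transcendence degree ≤ m.
  Growth : ℕ → Pred Carrier 0ℓ → Set
  Growth m S = ∃[ C ] ∀ L → Dimension≤ S L (C ℕ.* suc L ℕ.^ m)

  -- Growth under adjunction of one element

  infixl 5 _▷_

  _▷_ : Pred Carrier 0ℓ → Carrier → Pred Carrier 0ℓ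
  S ▷ t = S ∪ (_≈ t)

  module _ (S : Pred Carrier 0ℓ) (t : Carrier) where

    -- Polynomials of degree < n in t with coefficients of degree ≤ M
    data Low (n M : ℕ) : Carrier → Set where
      nil : Low n M 0#
      term : ∀ {i a} → i ℕ.< n → Poly S M a → Low n M (t ^ i * a)
      add  : ∀ {u v} → Low n M u → Low n M v → Low n M (u + v)
      resp : ∀ {u v} → u ≈ v → Low n M u → Low n M v

  multiples : Carrier → ℕ → List Carrier → List Carrier
  multiples t zero    ws = []
  multiples t (suc n) ws = List.map (t ^ n *_) ws List.++ multiples t n ws

  length-multiples : ∀ t n ws → length (multiples t n ws) ≡ n ℕ.* length ws
  length-multiples t zero    ws = ≡.refl
  length-multiples t (suc n) ws = ≡.trans (length-++ (List.map (t ^ n *_) ws))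
    (≡.cong₂ ℕ._+_ (length-map (t ^ n *_) ws) (length-multiples t n ws))

  span-multiples : ∀ {t n i} ws {u} → i ℕ.< n → Span ws u → Span (multiples t n ws) (t ^ i * u)
  span-multiples {t} {suc n} {i} ws (ℕ.s≤s i≤n) s with ℕ.m≤n⇒m<n∨m≡n i≤n
  ... | inj₁ i<n    = span-++ʳ (List.map (t ^ n *_) ws) (span-multiples ws i<n s)
  ... | inj₂ ≡.refl = span-++ˡ (List.map (t ^ n *_) ws) (span-map (t ^ n) ws s)

  module _ {S : Pred Carrier 0ℓ} {t : Carrier} where

    low-mono : ∀ {n n′ M M′ u} → n ℕ.≤ n′ → M ℕ.≤ M′ → Low S t n M u → Low S t n′ M′ u
    low-mono n≤n′ M≤M′ nil         = nil
    low-mono n≤n′ M≤M′ (term i<n p) = term (ℕ.≤-trans i<n n≤n′) (poly-mono M≤M′ p)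
    low-mono n≤n′ M≤M′ (add l k)    = add (low-mono n≤n′ M≤M′ l) (low-mono n≤n′ M≤M′ k)
    low-mono n≤n′ M≤M′ (resp eq l)  = resp eq (low-mono n≤n′ M≤M′ l)

    low-* : ∀ {n K M a u} → Poly S K a → Low S t n M u → Low S t n (K ℕ.+ M) (a * u)
    low-* {a = a} p nil                = resp (sym (zeroʳ a)) nil
    low-* {a = a} p (term {i} {b} i<n q) = resp (solve 3 (λ x a b → x :* (a :* b) := a :* (x :* b)) refl (t ^ i) a b)
                                             (term i<n (poly-* p q))
    low-* {a = a} p (add {u} {v} l k)   = resp (sym (distribˡ a u v)) (add (low-* p l) (low-* p k))
    low-* p (resp eq l)                 = resp (*-congˡ eq) (low-* p l)

    low-t* : ∀ {n M u} → Low S t n M u → Low S t (suc n) M (t * u)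
    low-t* nil                 = resp (sym (zeroʳ t)) nil
    low-t* (term {i} {a} i<n p) = resp (*-assoc t (t ^ i) a) (term (ℕ.s≤s i<n) p)
    low-t* (add {u} {v} l k)    = resp (sym (distribˡ t u v)) (add (low-t* l) (low-t* k))
    low-t* (resp eq l)          = resp (*-congˡ eq) (low-t* l)

    low-span : ∀ {n M D ws} → (∀ a → Poly S M a → Span ws (D * a)) →
               ∀ {u} → Low S t n M u → Span (multiples t n ws) (D * u)
    low-span {n} {D = D} {ws} span nil                 = span-resp (multiples t n ws) (sym (zeroʳ D)) (span-0 (multiples t n ws))
    low-span {n} {D = D} {ws} span (term {i} {a} i<n p) = span-resp (multiples t n ws)
      (solve 3 (λ x d a → x :* (d :* a) := d :* (x :* a)) refl (t ^ i) D a)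
      (span-multiples ws i<n (span a p))
    low-span {n} {D = D} {ws} span (add {u} {v} l k)    = span-resp (multiples t n ws) (sym (distribˡ D u v))
      (span-+ (multiples t n ws) (low-span span l) (low-span span k))
    low-span {n} {D = D} {ws} span (resp eq l)          = span-resp (multiples t n ws) (*-congˡ eq) (low-span span l)

    -- Collecting powers of `t`: a factor `t` raises only the power, a factor from `S` only the
    -- degree of the coefficient, so both are bounded by `L`.
    poly-low : ∀ {L u} → Poly (S ▷ t) L u → Low S t (suc L) L u
    poly-low (rational q)                 = resp (*-identityˡ ⟦ q ⟧) (term (ℕ.s≤s ℕ.z≤n) (rational q))
    poly-low (add p r)                    = add (poly-low p) (poly-low r)
    poly-low (product (inj₁ s∈S) p)       = low-mono (ℕ.n≤1+n _) ℕ.≤-refl (low-* (poly-gen s∈S) (poly-low p))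
    poly-low (product (inj₂ s≈t) p)       = resp (*-congʳ (sym s≈t)) (low-mono ℕ.≤-refl (ℕ.n≤1+n _) (low-t* (poly-low p)))
    poly-low (resp eq p)                  = resp eq (poly-low p)

    -- Degree `≤ L` leaves room for `L + 1` powers of `t`, so the dimension bound grows by the
    -- factor `L + 1`, whatever `t` is.
    growth-▷ : ∀ {m} → Growth m S → Growth (suc m) (S ▷ t)
    growth-▷ {m} (C , g) = C , λ L → extend L (g L)
      where
      extend : ∀ L → Dimension≤ S L (C ℕ.* suc L ℕ.^ m) → Dimension≤ (S ▷ t) L (C ℕ.* suc L ℕ.^ suc m)
      extend L (D , D≉0 , ws , ws≤ , span) =
        D , D≉0 , multiples t (suc L) ws , bound , λ u p → low-span {D = D} {ws} span (poly-low p)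
        where
        bound : length (multiples t (suc L) ws) ℕ.≤ C ℕ.* suc L ℕ.^ suc m
        bound = ℕ.≤-trans (ℕ.≤-reflexive (length-multiples t (suc L) ws)) (ℕ.≤-trans (ℕ.*-monoʳ-≤ (suc L) ws≤)
          (ℕ.≤-reflexive (≡.trans (≡.sym (ℕ.*-assoc (suc L) C _))
            (≡.trans (≡.cong (ℕ._* suc L ℕ.^ m) (ℕ.*-comm (suc L) C)) (ℕ.*-assoc C (suc L) _)))))

  ^-distribʳ-* : ∀ m a b → (a ℕ.* b) ℕ.^ m ≡ a ℕ.^ m ℕ.* b ℕ.^ m
  ^-distribʳ-* zero    a b = ≡.refl
  ^-distribʳ-* (suc m) a b = ≡.trans (≡.cong (a ℕ.* b ℕ.*_) (^-distribʳ-* m a b)) (interchange a b (a ℕ.^ m) (b ℕ.^ m))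
    where open import Algebra.Properties.CommutativeSemigroup ℕ.*-commutativeSemigroup using (interchange)

  evaluateᴿ : List Carrier → Carrier → Carrier
  evaluateᴿ p x = foldr (λ c v → c + x * v) 0# p

  -- Here `t` is a root of a polynomial of degree `n = length cs` with leading coefficient `c` and
  -- lower coefficients `cs`. As `c` need not be invertible in the ring generated by `S`, its powers
  -- are moved to the common denominator.
  module _ {S : Pred Carrier 0ℓ} {t c : Carrier} {cs : List Carrier} {d : ℕ}
    (cs-poly : All (Poly S d) cs) (c-poly : Poly S d c) (c≉0 : c ≉ 0#)
    (root : evaluateᴿ cs t + c * t ^ length cs ≈ 0#) where

    private
      n = length cs

      0<n : 0 ℕ.< n
      0<n = nonempty cs root
        where
        nonempty : ∀ cs → evaluateᴿ cs t + c * t ^ length cs ≈ 0# → 0 ℕ.< length cs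
        nonempty []       eq = ⊥-elim (c≉0 (trans (sym (trans (+-identityˡ (c * 1#)) (*-identityʳ c))) eq))
        nonempty (_ ∷ cs) _  = ℕ.s≤s ℕ.z≤n

      evaluate-low : ∀ {M a} → Poly S M a → ∀ k {ds} → All (Poly S d) ds → k ℕ.+ length ds ℕ.≤ n →
                     Low S t n (d ℕ.+ M) (t ^ k * (evaluateᴿ ds t * a))
      evaluate-low {a = a} p k []                   _  = resp (sym (trans (*-congˡ (zeroˡ a)) (zeroʳ (t ^ k)))) nil
      evaluate-low {a = a} p k (_∷_ {x} {ds} q qs) k≤n = resp
        (solve 5 (λ x t y e a → y :* (x :* a) :+ (t :* y) :* (e :* a) := y :* ((x :+ t :* e) :* a)) refl
          x t (t ^ k) (evaluateᴿ ds t) a)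
        (add (term (ℕ.≤-trans (ℕ.≤-trans (ℕ.s≤s (ℕ.m≤m+n k (length ds))) (ℕ.≤-reflexive (≡.sym (ℕ.+-suc k (length ds))))) k≤n)
               (poly-* q p))
          (evaluate-low p (suc k) qs (≡.subst (ℕ._≤ n) (ℕ.+-suc k (length ds)) k≤n)))

      low-ct* : ∀ {M u} → Low S t n M u → Low S t n (d ℕ.+ M) (c * t * u)
      low-ct* nil = resp (sym (zeroʳ (c * t))) nil
      low-ct* (term {i} {a} i<n p) with ℕ.m≤n⇒m<n∨m≡n i<n
      ... | inj₁ 1+i<n = resp (solve 4 (λ t x c a → (t :* x) :* (c :* a) := (c :* t) :* (x :* a)) refl t (t ^ i) c a)
                           (term 1+i<n (poly-* c-poly p))
      -- The power reaches `n`: the equation replaces `c * t ^ n` by `- E`, which involves only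
      -- powers below `n`.
      ... | inj₂ 1+i≡n = resp (begin
            t ^ 0 * (E * - a)          ≈⟨ trans (*-identityˡ (E * - a))
                                            (solve 3 (λ e y a → e :* :- a := y :* a :+ :- (e :+ y) :* a) refl E Y a) ⟩
            Y * a + - (E + Y) * a      ≈⟨ +-congˡ (*-congʳ (trans (-‿cong E+Y≈0) -0#≈0#)) ⟩
            Y * a + 0# * a             ≈⟨ trans (+-congˡ (zeroˡ a)) (+-identityʳ (Y * a)) ⟩
            Y * a                      ≈⟨ solve 4 (λ t x c a → (c :* (t :* x)) :* a := (c :* t) :* (x :* a)) refl t (t ^ i) c a ⟩
            c * t * (t ^ i * a)        ∎)
            (evaluate-low (poly-neg p) 0 cs-poly ℕ.≤-refl)
        where
        E = evaluateᴿ cs t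
        Y = c * t ^ suc i
        E+Y≈0 : E + Y ≈ 0#
        E+Y≈0 = ≡.subst (λ k → E + c * t ^ k ≈ 0#) (≡.sym 1+i≡n) root
      low-ct* (add {u} {v} l k) = resp (sym (distribˡ (c * t) u v)) (add (low-ct* l) (low-ct* k))
      low-ct* (resp eq l)       = resp (*-congˡ eq) (low-ct* l)

      -- Each of the at most `L` factors is paired with one factor `c`. A factor `t` is then reduced
      -- by `low-ct*` at the cost of degree `d`, and a factor from `S` costs `1 + d`, whence the
      -- degree `L * suc d`.
      poly-reduce : ∀ {L u} → Poly (S ▷ t) L u → Low S t n (L ℕ.* suc d) (c ^ L * u)
      poly-reduce {L} (rational q) = resp (*-identityˡ (c ^ L * ⟦ q ⟧))
        (term 0<n (poly-mono (ℕ.*-monoʳ-≤ L (ℕ.n≤1+n d)) (≡.subst (λ k → Poly S k (c ^ L * ⟦ q ⟧)) (ℕ.+-identityʳ (L ℕ.* d))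
          (poly-* (poly-^ c-poly L) (rational {L = 0} q)))))
      poly-reduce {L} (add {u = u} {v} p r) = resp (sym (distribˡ (c ^ L) u v)) (add (poly-reduce p) (poly-reduce r))
      poly-reduce {suc L} (product {s = s} {u} (inj₁ s∈S) p) = resp
        (solve 4 (λ c s x u → (s :* c) :* (x :* u) := (c :* x) :* (s :* u)) refl c s (c ^ L) u)
        (low-* (poly-* (poly-gen s∈S) c-poly) (poly-reduce p))
      poly-reduce {suc L} (product {s = s} {u} (inj₂ s≈t) p) = resp
        (trans (solve 4 (λ c t x u → (c :* t) :* (x :* u) := (c :* x) :* (t :* u)) refl c t (c ^ L) u) (*-congˡ (*-congʳ (sym s≈t))))
        (low-mono ℕ.≤-refl (ℕ.n≤1+n _) (low-ct* (poly-reduce p)))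
      poly-reduce {L} (resp eq p) = resp (*-congˡ eq) (poly-reduce p)

    -- The number `n` of powers of `t` does not depend on `L`, and passing from `L` to `L * suc d`
    -- multiplies the bound by at most `suc d ^ m`; hence the exponent `m` stays.
    growth-root : ∀ {m} → Growth m S → Growth m (S ▷ t)
    growth-root {m} (C , g) = n ℕ.* (C ℕ.* suc d ℕ.^ m) , λ L → extend L (g (L ℕ.* suc d))
      where
      extend : ∀ L → Dimension≤ S (L ℕ.* suc d) (C ℕ.* suc (L ℕ.* suc d) ℕ.^ m) →
               Dimension≤ (S ▷ t) L (n ℕ.* (C ℕ.* suc d ℕ.^ m) ℕ.* suc L ℕ.^ m)
      extend L (D , D≉0 , ws , ws≤ , span) =
        D * c ^ L , *-≉0 D≉0 (^-≉0 c≉0 L) , multiples t n ws , bound ,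
        λ u p → span-resp (multiples t n ws) (sym (*-assoc D (c ^ L) u)) (low-span {D = D} {ws} span (poly-reduce p))
        where
        degree : suc (L ℕ.* suc d) ℕ.^ m ℕ.≤ suc d ℕ.^ m ℕ.* suc L ℕ.^ m
        degree = ℕ.≤-trans (ℕ.^-monoˡ-≤ m (ℕ.≤-trans (ℕ.s≤s (ℕ.m≤n+m (L ℕ.* suc d) d)) (ℕ.≤-reflexive (ℕ.*-comm (suc L) (suc d)))))
          (ℕ.≤-reflexive (^-distribʳ-* m (suc d) (suc L)))
        bound : length (multiples t n ws) ℕ.≤ n ℕ.* (C ℕ.* suc d ℕ.^ m) ℕ.* suc L ℕ.^ m
        bound = ℕ.≤-trans (ℕ.≤-reflexive (length-multiples t n ws)) (ℕ.≤-trans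
          (ℕ.*-monoʳ-≤ n (ℕ.≤-trans ws≤ (ℕ.≤-trans (ℕ.*-monoʳ-≤ C degree) (ℕ.≤-reflexive (≡.sym (ℕ.*-assoc C _ _))))))
          (ℕ.≤-reflexive (≡.sym (ℕ.*-assoc n _ _))))

  -- The ring generated by a set

  InRing : Pred Carrier 0ℓ → Carrier → Set
  InRing S u = ∃[ d ] Poly S d u

  module _ {S : Pred Carrier 0ℓ} where

    inRing-resp : ∀ {u v} → u ≈ v → InRing S u → InRing S v
    inRing-resp u≈v (d , p) = d , resp u≈v p

    inRing-gen : ∀ {s} → S s → InRing S s
    inRing-gen s∈S = 1 , poly-gen s∈S

    inRing-rational : ∀ q → InRing S ⟦ q ⟧
    inRing-rational q = 0 , rational q

    inRing-0 : InRing S 0#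
    inRing-0 = 0 , poly-0

    inRing-1 : InRing S 1#
    inRing-1 = 0 , poly-1

    inRing-+ : ∀ {u v} → InRing S u → InRing S v → InRing S (u + v)
    inRing-+ (d , p) (e , q) = d ℕ.+ e , add (poly-mono (ℕ.m≤m+n d e) p) (poly-mono (ℕ.m≤n+m e d) q)

    inRing-* : ∀ {u v} → InRing S u → InRing S v → InRing S (u * v)
    inRing-* (d , p) (e , q) = d ℕ.+ e , poly-* p q

    inRing-neg : ∀ {u} → InRing S u → InRing S (- u)
    inRing-neg (d , p) = d , poly-neg p

    inRing-^ : ∀ {u} → InRing S u → ∀ n → InRing S (u ^ n)
    inRing-^ (d , p) n = n ℕ.* d , poly-^ p n

    inRing-combination : ∀ {n} (q : Vector ℚ n) {us} → (∀ i → InRing S (us i)) → InRing S (combination q us)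
    inRing-combination {zero}  q r = inRing-0
    inRing-combination {suc n} q r = inRing-+ (inRing-* (inRing-rational (q zero)) (r zero)) (inRing-combination (q ∘ suc) (r ∘ suc))

    commonDegree : ∀ {cs} → All (InRing S) cs → ∃[ d ] All (Poly S d) cs
    commonDegree []             = 0 , []
    commonDegree ((d , p) ∷ ps) with commonDegree ps
    ... | e , qs = d ℕ.+ e , poly-mono (ℕ.m≤m+n d e) p ∷ All.map (poly-mono (ℕ.m≤n+m e d)) qs

    commonDegreeᵛ : ∀ {n} {us : Vector Carrier n} → (∀ i → InRing S (us i)) → ∃[ d ] ∀ i → Poly S d (us i)
    commonDegreeᵛ {zero}  r = 0 , λ ()
    commonDegreeᵛ {suc n} r with r zero | commonDegreeᵛ (r ∘ suc)
    ... | d , p | e , q = d ℕ.+ e , λ where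
      zero    → poly-mono (ℕ.m≤m+n d e) p
      (suc i) → poly-mono (ℕ.m≤n+m e d) (q i)

  inRing-⊆ : ∀ {S T : Pred Carrier 0ℓ} → S ⊆ T → ∀ {u} → InRing S u → InRing T u
  inRing-⊆ S⊆T (d , p) = d , poly-⊆ S⊆T p

  -- Leading coefficients and algebraic elements

  vanishing-evaluate : ∀ p → ¬ Any (_≉ 0#) p → ∀ t → evaluateᴿ p t ≈ 0#
  vanishing-evaluate []      none t = refl
  vanishing-evaluate (c ∷ p) none t = trans
    (+-cong (stable c 0# (none ∘ here)) (trans (*-congˡ (vanishing-evaluate p (none ∘ there) t)) (zeroʳ t)))
    (+-identityˡ 0#)

  -- Which coefficient is the last nonzero one cannot be decided, hence the double negation. If the
  -- tail has a nonzero coefficient, its leading coefficient serves; if not, the tail vanishes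
  -- identically and the head leads.
  leadingCoefficient : ∀ {P : Pred Carrier 0ℓ} p → All P p → Any (_≉ 0#) p →
    ¬ ¬ (∃[ cs ] ∃[ c ] All P cs × P c × c ≉ 0# × (∀ t → evaluateᴿ p t ≈ evaluateᴿ cs t + c * t ^ length cs))
  leadingCoefficient (c ∷ p) (c∈P ∷ p⊆P) any k = k ([] , c , [] , c∈P , head≉0 any , λ t → begin
      c + t * evaluateᴿ p t  ≈⟨ +-congˡ (trans (*-congˡ (vanishing-evaluate p none t)) (zeroʳ t)) ⟩
      c + 0#                 ≈⟨ +-comm c 0# ⟩
      0# + c                 ≈⟨ +-congˡ (sym (*-identityʳ c)) ⟩
      0# + c * 1#            ∎)
    where
    none : ¬ Any (_≉ 0#) p
    none any′ = leadingCoefficient p p⊆P any′ λ (cs , d , cs⊆P , d∈P , d≉0 , eq) →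
      k (c ∷ cs , d , c∈P ∷ cs⊆P , d∈P , d≉0 , λ t → trans (+-congˡ (*-congˡ (eq t)))
        (solve 5 (λ c t e d x → c :+ t :* (e :+ d :* x) := (c :+ t :* e) :+ d :* (t :* x)) refl
          c t (evaluateᴿ cs t) d (t ^ length cs)))
    head≉0 : Any (_≉ 0#) (c ∷ p) → c ≉ 0#
    head≉0 (here c≉0)   = c≉0
    head≉0 (there any′) = ⊥-elim (none any′)

  growth-algebraic : ∀ {m S t} p → All (InRing S) p → Any (_≉ 0#) p → evaluateᴿ p t ≈ 0# →
                     Growth m S → ¬ ¬ Growth m (S ▷ t)
  growth-algebraic {m} {t = t} p p⊆S p≉0 root g k = leadingCoefficient p p⊆S p≉0 λ (cs , c , cs⊆S , c∈S , c≉0 , eq) →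
    withDegree (commonDegree (c∈S ∷ cs⊆S)) c≉0 (trans (sym (eq t)) root)
    where
    withDegree : ∀ {c cs} → ∃[ d ] All (Poly _ d) (c ∷ cs) → c ≉ 0# → evaluateᴿ cs t + c * t ^ length cs ≈ 0# → ⊥
    withDegree (d , c-poly ∷ cs-poly) c≉0 eq = k (growth-root cs-poly c-poly c≉0 eq {m} g)

  -- Polynomials in several variables and their monomials

  evaluatePolynomial : ∀ n → Polynomial n → Vector Carrier n → Carrier
  evaluatePolynomial zero    q w = ⟦ q ⟧
  evaluatePolynomial (suc n) p w = foldr (λ c v → evaluatePolynomial n c (w ∘ suc) + w zero * v) 0# p

  combination-++ : ∀ m {n} (q : Vector ℚ (m ℕ.+ n)) (us : Vector Carrier m) (vs : Vector Carrier n) →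
    combination q (us ++ vs) ≈ combination (take m q) us + combination (drop m q) vs
  combination-++ zero    q us vs = sym (+-identityˡ _)
  combination-++ (suc m) q us vs = begin
    X + combination (q ∘ suc) ((us ++ vs) ∘ suc)
      ≈⟨ +-congˡ (sum-cong-≋ λ i → *-congˡ {⟦ q (suc i) ⟧} (reflexive ([,]-map (splitAt m i)))) ⟩
    X + combination (q ∘ suc) ((us ∘ suc) ++ vs)
      ≈⟨ +-congˡ (combination-++ m (q ∘ suc) (us ∘ suc) vs) ⟩
    X + (combination (take m (q ∘ suc)) (us ∘ suc) + combination (drop m (q ∘ suc)) vs)
      ≈⟨ sym (+-assoc X _ _) ⟩
    combination (take (suc m) q) us + combination (drop (suc m) q) vs ∎
    where X = ⟦ q zero ⟧ * us zero

  combination-* : ∀ {n} (q : Vector ℚ n) a (us : Vector Carrier n) →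
                  combination q (λ i → a * us i) ≈ a * combination q us
  combination-* q a us = trans
    (sum-cong-≋ λ i → solve 3 (λ q a u → q :* (a :* u) := a :* (q :* u)) refl ⟦ q i ⟧ a (us i))
    (sym (*-distribˡ-sum a (λ i → ⟦ q i ⟧ * us i)))

  combination-*ʳ : ∀ {n} (q : Vector ℚ n) (us : Vector Carrier n) a →
                   combination q (λ i → us i * a) ≈ combination q us * a
  combination-*ʳ q us a = trans (sum-cong-≋ λ i → sym (*-assoc ⟦ q i ⟧ (us i) a))
    (sym (*-distribʳ-sum a (λ i → ⟦ q i ⟧ * us i)))

  -- Polynomials of degree < b in each of the n variables
  module Box (b : ℕ) where

    rows : ∀ {m} {A : Set} k → (Vector ℚ m → A) → Vector ℚ (k ℕ.* m) → List A
    rows zero    f q = []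
    rows {m} (suc k) f q = f (take m q) ∷ rows k f (drop m q)

    -- The `b ^ suc n` coefficients are cut into `b` blocks of length `b ^ n`, one for each power of
    -- the first variable; `monomials` is ordered in the same way.
    polynomial : ∀ n → Vector ℚ (b ℕ.^ n) → Polynomial n
    polynomial zero    q = q zero
    polynomial (suc n) q = rows b (polynomial n) q

    powers : ∀ {m} k → Carrier → Vector Carrier m → Vector Carrier (k ℕ.* m)
    powers zero    y us = λ ()
    powers (suc k) y us = us ++ (λ i → y * powers k y us i)

    monomials : ∀ n → Vector Carrier n → Vector Carrier (b ℕ.^ n)
    monomials zero    y = λ _ → 1#
    monomials (suc n) y = powers b (y zero) (monomials n (y ∘ suc))

    evaluate-polynomial : ∀ n q y → evaluatePolynomial n (polynomial n q) y ≈ combination q (monomials n y)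
    evaluate-polynomial zero    q y = sym (trans (+-identityʳ _) (*-identityʳ ⟦ q zero ⟧))
    evaluate-polynomial (suc n) q y = evaluate-rows b q
      where
      us = monomials n (y ∘ suc)
      evaluate-rows : ∀ k (q : Vector ℚ (k ℕ.* b ℕ.^ n)) →
        foldr (λ c v → evaluatePolynomial n c (y ∘ suc) + y zero * v) 0# (rows k (polynomial n) q) ≈
        combination q (powers k (y zero) us)
      evaluate-rows zero    q = refl
      evaluate-rows (suc k) q = sym (trans (combination-++ (b ℕ.^ n) q us (λ i → y zero * powers k (y zero) us i))
        (+-cong (sym (evaluate-polynomial n (take (b ℕ.^ n) q) (y ∘ suc)))
          (trans (combination-* (drop (b ℕ.^ n) q) (y zero) (powers k (y zero) us))
            (*-congˡ (sym (evaluate-rows k (drop (b ℕ.^ n) q)))))))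

    polynomial-zero : ∀ n q → IsZero n (polynomial n q) → ∀ i → q i ≡ 0ℚ
    polynomial-zero zero    q q≡0 zero = q≡0
    polynomial-zero (suc n) q = rows-zero b q
      where
      rows-zero : ∀ k (q : Vector ℚ (k ℕ.* b ℕ.^ n)) → All (IsZero n) (rows k (polynomial n) q) → ∀ i → q i ≡ 0ℚ
      rows-zero (suc k) q (z ∷ zs) i with splitAt (b ℕ.^ n) i in eq
      ... | inj₁ j = ≡.subst (λ i → q i ≡ 0ℚ) (splitAt⁻¹-↑ˡ eq) (polynomial-zero n (take (b ℕ.^ n) q) z j)
      ... | inj₂ j = ≡.subst (λ i → q i ≡ 0ℚ) (splitAt⁻¹-↑ʳ {b ℕ.^ n} eq) (rows-zero k (drop (b ℕ.^ n) q) zs j)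

    module _ {S : Pred Carrier 0ℓ} {d : ℕ} where

      powers-poly : ∀ {m e y} {us : Vector Carrier m} k → Poly S d y → (∀ i → Poly S e (us i)) →
                    ∀ i → Poly S (k ℕ.* d ℕ.+ e) (powers k y us i)
      powers-poly {m} {e} {y} {us} (suc k) p ps i with splitAt m i
      ... | inj₁ j = poly-mono (ℕ.m≤n+m e (suc k ℕ.* d)) (ps j)
      ... | inj₂ j = ≡.subst (λ l → Poly S l (y * powers k y us j)) (≡.sym (ℕ.+-assoc d (k ℕ.* d) e))
                       (poly-* p (powers-poly k p ps j))

      monomials-poly : ∀ n {y : Vector Carrier n} → (∀ i → Poly S d (y i)) →
                       ∀ i → Poly S (n ℕ.* (b ℕ.* d)) (monomials n y i)
      monomials-poly zero    p i = poly-1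
      monomials-poly (suc n) p i = powers-poly b (p zero) (monomials-poly n (p ∘ suc)) i

  -- The (L + 1)ⁿ monomials of degree ≤ L in each yᵢ exceed the dimension bound.
  growth-dependent : ∀ {m n S} {y : Vector Carrier n} → Growth m S → m ℕ.< n → (∀ i → InRing S (y i)) →
                     ¬ (∀ p → evaluatePolynomial n p y ≈ 0# → IsZero n p)
  growth-dependent {m} {n} {S} {y} (C , g) m<n y∈S independent = withDegree (commonDegreeᵛ y∈S)
    where
    withDegree : ∃[ d ] (∀ i → Poly S d (y i)) → ⊥
    withDegree (d , y-poly) = atL (g M)
      where
      -- `M` bounds the degree of the monomials, and `M + 1 ≤ E (L + 1)`. By the choice of `L`, the
      -- dimension is at most `C Eᵐ (L + 1)ᵐ = L (L + 1)ᵐ`, less than the number `(L + 1)ⁿ` of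
      -- monomials.
      E = suc (n ℕ.* d)
      L = C ℕ.* E ℕ.^ m
      M = n ℕ.* (suc L ℕ.* d)
      open Box (suc L)
      degree : suc M ℕ.≤ E ℕ.* suc L
      degree = ℕ.+-mono-≤ (ℕ.s≤s (ℕ.z≤n {L})) (ℕ.≤-reflexive (≡.trans (≡.cong (n ℕ.*_) (ℕ.*-comm (suc L) d)) (≡.sym (ℕ.*-assoc n d (suc L)))))
      small : C ℕ.* suc M ℕ.^ m ℕ.< suc L ℕ.^ n
      small = ℕ.≤-<-trans (ℕ.*-monoʳ-≤ C (ℕ.≤-trans (ℕ.^-monoˡ-≤ m degree) (ℕ.≤-reflexive (^-distribʳ-* m E (suc L)))))
        (ℕ.≤-<-trans (ℕ.≤-reflexive (≡.sym (ℕ.*-assoc C (E ℕ.^ m) (suc L ℕ.^ m))))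
          (ℕ.<-≤-trans (ℕ.*-monoˡ-< (suc L ℕ.^ m) {{ℕ.m^n≢0 (suc L) m}} (ℕ.n<1+n L)) (ℕ.^-monoʳ-≤ (suc L) m<n)))
      atL : Dimension≤ S M (C ℕ.* suc M ℕ.^ m) → ⊥
      atL (D , D≉0 , ws , ws≤ , span) = relation (dependent ws (λ i → D * monomials n y i) (ℕ.≤-<-trans ws≤ small)
          (λ i → span (monomials n y i) (monomials-poly n y-poly i)))
        where
        relation : ∃[ q ] (∃[ i ] q i ≢ 0ℚ) × combination q (λ i → D * monomials n y i) ≈ 0# → ⊥
        -- After cancelling `D`, the relation is a polynomial with a nonzero coefficient that
        -- vanishes at `y`.
        relation (q , (i , qᵢ≢0) , eq) = qᵢ≢0 (polynomial-zero n q (independent (polynomial n q)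
          (trans (evaluate-polynomial n q y) (cancel-0 D _ D≉0 (trans (sym (combination-* q D (monomials n y))) eq)))) i)

  -- Linear independence over ℚ

  ⟦⟧-≉0 : ∀ {q} → q ≢ 0ℚ → ⟦ q ⟧ ≉ 0#
  ⟦⟧-≉0 {q} q≢0 q≈0 = 1≉0 (begin
    1#                    ≈⟨ sym 1-homo ⟩
    ⟦ 1ℚ ⟧                ≡⟨ ≡.cong ⟦_⟧ (≡.sym (ℚ.*-inverseʳ q)) ⟩
    ⟦ q ℚ.* ℚ.1/ q ⟧      ≈⟨ *-homo q (ℚ.1/ q) ⟩
    ⟦ q ⟧ * ⟦ ℚ.1/ q ⟧    ≈⟨ *-congʳ q≈0 ⟩
    0# * ⟦ ℚ.1/ q ⟧       ≈⟨ zeroˡ ⟦ ℚ.1/ q ⟧ ⟩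
    0#                    ∎)
    where instance _ = ℚ.≢-nonZero q≢0

  Independent : ∀ {n} → Vector Carrier n → Set
  Independent us = ∀ q → combination q us ≈ 0# → ∀ i → q i ≡ 0ℚ

  Relation : ∀ {n} → Vector Carrier n → Set
  Relation us = ∃[ q ] (∃[ i ] q i ≢ 0ℚ) × combination q us ≈ 0#

  -- A search through all rational vectors does not terminate, so the alternative is classical.
  -- Comparing single rationals is decidable, which turns the absence of relations into
  -- independence.
  independent⊎relation : ∀ {n} (us : Vector Carrier n) → ¬ ¬ (Independent us ⊎ Relation us)
  independent⊎relation us k = k (inj₁ λ q eq → all-≡0 {q = q} λ some → k (inj₂ (q , some , eq)))

  -- The coefficient of `u` cannot be 0, as `us` would then satisfy a nontrivial relation; dividing
  -- by it solves for `u`.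
  relation⇒combination : ∀ {n u} {us : Vector Carrier n} → Independent us → Relation (u Vector.∷ us) →
                         ∃[ r ] u ≈ combination r us
  relation⇒combination {u = u} {us} independent (q , some , eq) with q zero ℚ.≟ 0ℚ
  ... | yes q₀≡0 = ⊥-elim (nonzero some)
    where
    tail≈0 : combination (q ∘ suc) us ≈ 0#
    tail≈0 = begin
      combination (q ∘ suc) us                       ≈⟨ sym (+-identityˡ _) ⟩
      0# + combination (q ∘ suc) us                  ≈⟨ +-congʳ (sym (trans (*-congʳ (trans (reflexive (≡.cong ⟦_⟧ q₀≡0)) 0-homo)) (zeroˡ u))) ⟩
      ⟦ q zero ⟧ * u + combination (q ∘ suc) us      ≈⟨ eq ⟩
      0#                                             ∎
    nonzero : ¬ (∃[ i ] q i ≢ 0ℚ)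
    nonzero (zero  , q₀≢0) = q₀≢0 q₀≡0
    nonzero (suc i , qᵢ≢0) = qᵢ≢0 (independent (q ∘ suc) tail≈0 i)
  ... | no q₀≢0 = (λ i → ℚ.- p ℚ.* q (suc i)) , (begin
    u                               ≈⟨ sym (trans (*-congʳ p*q₀) (*-identityˡ u)) ⟩
    ⟦ p ⟧ * ⟦ q zero ⟧ * u          ≈⟨ solve 4 (λ p q u c → p :* q :* u := :- p :* c :+ p :* (q :* u :+ c)) refl ⟦ p ⟧ ⟦ q zero ⟧ u c ⟩
    - ⟦ p ⟧ * c + ⟦ p ⟧ * (⟦ q zero ⟧ * u + c)
                                    ≈⟨ +-cong (*-congʳ (sym (-‿homo p))) (trans (*-congˡ eq) (zeroʳ ⟦ p ⟧)) ⟩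
    ⟦ ℚ.- p ⟧ * c + 0#              ≈⟨ +-identityʳ _ ⟩
    ⟦ ℚ.- p ⟧ * c                   ≈⟨ *-distribˡ-sum ⟦ ℚ.- p ⟧ (λ i → ⟦ q (suc i) ⟧ * us i) ⟩
    sum (λ i → ⟦ ℚ.- p ⟧ * (⟦ q (suc i) ⟧ * us i))
                                    ≈⟨ sum-cong-≋ (λ i → trans (sym (*-assoc ⟦ ℚ.- p ⟧ ⟦ q (suc i) ⟧ (us i)))
                                         (*-congʳ (sym (*-homo (ℚ.- p) (q (suc i)))))) ⟩
    combination (λ i → ℚ.- p ℚ.* q (suc i)) us ∎)
    where
    instance _ = ℚ.≢-nonZero q₀≢0
    p = ℚ.1/ q zero
    c = combination (q ∘ suc) us
    p*q₀ : ⟦ p ⟧ * ⟦ q zero ⟧ ≈ 1#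
    p*q₀ = trans (sym (*-homo p (q zero))) (trans (reflexive (≡.cong ⟦_⟧ (ℚ.*-inverseˡ (q zero)))) 1-homo)

  -- Adjoining roots

  evaluate-monomial : ∀ d c t → evaluateᴿ (List.replicate d 0# List.++ c ∷ []) t ≈ c * t ^ d
  evaluate-monomial zero    c t = trans (+-congˡ (zeroʳ t)) (trans (+-identityʳ c) (sym (*-identityʳ c)))
  evaluate-monomial (suc d) c t = trans (+-identityˡ _) (trans (*-congˡ (evaluate-monomial d c t))
    (solve 3 (λ t c x → t :* (c :* x) := c :* (t :* x)) refl t c (t ^ d)))

  -- Classical existence, with the double negation in continuation form
  Enlarge : ℕ → Pred Carrier 0ℓ → (Pred Carrier 0ℓ → Set) → Set₁
  Enlarge m S P = ((T : Pred Carrier 0ℓ) → S ⊆ T → Growth m T → P T → ⊥) → ⊥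

  enlarge-root : ∀ {m S t} p → All (InRing S) p → Any (_≉ 0#) p → evaluateᴿ p t ≈ 0# →
                 Growth m S → Enlarge m S (λ T → InRing T t)
  enlarge-root {m} {S} {t} p p⊆S p≉0 root g k =
    growth-algebraic {m} p p⊆S p≉0 root g λ g′ → k (S ▷ t) inj₁ g′ (inRing-gen (inj₂ refl))

  -‿≉0 : ∀ {x} → x ≉ 0# → - x ≉ 0#
  -‿≉0 {x} x≉0 -x≈0 = x≉0 (trans (solve 1 (λ x → x := :- :- x) refl x) (trans (-‿cong -x≈0) -0#≈0#))

  -- `t` is a root of `a Xᵈ⁺¹ - b`, and the constant coefficient `- b ≉ 0` ensures that this is not
  -- the zero polynomial.
  enlarge-radical : ∀ {m S t a b} d → InRing S a → InRing S b → b ≉ 0# → a * t ^ suc d ≈ b →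
                    Growth m S → Enlarge m S (λ T → InRing T t)
  enlarge-radical {m} {t = t} {a} {b} d a∈S b∈S b≉0 eq = enlarge-root {m} (- b ∷ List.replicate d 0# List.++ a ∷ [])
    (inRing-neg b∈S ∷ All.++⁺ (All.replicate⁺ d inRing-0) (a∈S ∷ [])) (here (-‿≉0 b≉0)) (begin
      - b + t * evaluateᴿ (List.replicate d 0# List.++ a ∷ []) t  ≈⟨ +-congˡ (*-congˡ (evaluate-monomial d a t)) ⟩
      - b + t * (a * t ^ d)                                       ≈⟨ +-congˡ (solve 3 (λ t a x → t :* (a :* x) := a :* (t :* x)) refl t a (t ^ d)) ⟩
      - b + a * t ^ suc d                                         ≈⟨ +-congˡ eq ⟩
      - b + b                                                     ≈⟨ -‿inverseˡ b ⟩
      0#                                                          ∎)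

  -- For `ζ = exp (iπ/6)` the last hypothesis is `2 i sin (π/6) = i`. It gives `ζ² = 1 + i ζ`, hence
  -- `ζ³ = ζ + i ζ² = ζ + i - ζ = i`.
  ζ³≈i : ∀ {i ζ ζ⁻¹} → i * i ≈ - 1# → ζ * ζ⁻¹ ≈ 1# → ζ ≈ ζ⁻¹ + i → ζ * (ζ * ζ) ≈ i
  ζ³≈i {i} {ζ} {ζ⁻¹} i²≈-1 ζζ⁻¹≈1 ζ≈ = begin
    ζ * (ζ * ζ)                 ≈⟨ *-congˡ ζ² ⟩
    ζ * (1# + i * ζ)            ≈⟨ trans (distribˡ ζ 1# (i * ζ)) (+-congʳ (*-identityʳ ζ)) ⟩
    ζ + ζ * (i * ζ)             ≈⟨ solve 2 (λ i z → z :+ z :* (i :* z) := z :+ i :* (z :* z)) refl i ζ ⟩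
    ζ + i * (ζ * ζ)             ≈⟨ +-congˡ (trans (*-congˡ ζ²) (trans (distribˡ i 1# (i * ζ)) (+-congʳ (*-identityʳ i)))) ⟩
    ζ + (i + i * (i * ζ))       ≈⟨ +-congˡ (+-congˡ (trans (sym (*-assoc i i ζ)) (*-congʳ i²≈-1))) ⟩
    ζ + (i + - 1# * ζ)          ≈⟨ solve 3 (λ i z o → z :+ (i :+ :- o :* z) := i :+ (z :- o :* z)) refl i ζ 1# ⟩
    i + (ζ - 1# * ζ)            ≈⟨ +-congˡ (trans (+-congˡ (-‿cong (*-identityˡ ζ))) (-‿inverseʳ ζ)) ⟩
    i + 0#                      ≈⟨ +-identityʳ i ⟩
    i                           ∎
    where
    ζ² : ζ * ζ ≈ 1# + i * ζ
    ζ² = trans (*-congˡ ζ≈) (trans (distribˡ ζ ζ⁻¹ i) (+-cong ζζ⁻¹≈1 (*-comm ζ i)))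

  ι-*-numerator : ∀ q → ι (suc (ℚ.denominator-1 q)) ℚ.* q ≡ ℚ.numerator q ℚ./ 1
  ι-*-numerator q@(mkℚ n d _) = ≡.trans (≡.cong (ℚ._* q) (ι≡ (suc d))) (ℚ.toℚᵘ-injective (ℚᵘ.≃-trans
    (ℚ.toℚᵘ-homo-* (ℤ.+ suc d ℚ./ 1) q) (ℚᵘ.≃-trans
    (ℚᵘ.*-cong (ℚ.toℚᵘ-fromℚᵘ (ℚᵘ.mkℚᵘ (ℤ.+ suc d) 0)) (ℚᵘ.≃-refl {ℚᵘ.mkℚᵘ n d})) (ℚᵘ.≃-trans
    (ℚᵘ.*≡* (≡.trans (ℤ.*-identityʳ (ℤ.+ suc d ℤ.* n)) (≡.trans (ℤ.*-comm (ℤ.+ suc d) n)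
      (≡.cong (λ e → n ℤ.* (ℤ.+ suc e)) (≡.sym (ℕ.+-identityʳ d))))))
    (ℚᵘ.≃-sym (ℚ.toℚᵘ-fromℚᵘ (ℚᵘ.mkℚᵘ n 0)))))))

  -- Homomorphisms from addition to multiplication

  module Exponential
    (E : Carrier → Carrier)
    (E-cong : ∀ x y → x ≈ y → E x ≈ E y)
    (E-+ : ∀ x y → E (x + y) ≈ E x * E y)
    (E-0 : E 0# ≈ 1#)
    where

    E-ι : ∀ n x → E (⟦ ι n ⟧ * x) ≈ E x ^ n
    E-ι zero    x = trans (E-cong _ _ (trans (*-congʳ 0-homo) (zeroˡ x))) E-0
    E-ι (suc n) x = begin
      E (⟦ 1ℚ ℚ.+ ι n ⟧ * x)     ≈⟨ E-cong _ _ (trans (*-congʳ (trans (+-homo 1ℚ (ι n)) (+-congʳ 1-homo)))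
                                       (trans (distribʳ x 1# ⟦ ι n ⟧) (+-congʳ (*-identityˡ x)))) ⟩
      E (x + ⟦ ι n ⟧ * x)        ≈⟨ E-+ x (⟦ ι n ⟧ * x) ⟩
      E x * E (⟦ ι n ⟧ * x)      ≈⟨ *-congˡ (E-ι n x) ⟩
      E x * E x ^ n              ∎

    E-neg : ∀ x → E x * E (- x) ≈ 1#
    E-neg x = trans (sym (E-+ x (- x))) (trans (E-cong _ _ (-‿inverseʳ x)) E-0)

    E≉0 : ∀ x → E x ≉ 0#
    E≉0 x eq = 1≉0 (trans (sym (E-neg x)) (trans (*-congʳ eq) (zeroˡ (E (- x)))))

    -- For `z = iπ/6` this yields `exp (iπ) = -1`: by `ζ³≈i` the value at `3 z` is `i`, and its
    -- square is the value at `6 z`.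
    E-sixth : ∀ {i} z → i * i ≈ - 1# → E z ≈ E (- z) + i → E ((z + (z + z)) + (z + (z + z))) ≈ - 1#
    E-sixth {i} z i²≈-1 E-z≈ = begin
      E (t + t)    ≈⟨ E-+ t t ⟩
      E t * E t    ≈⟨ *-cong E-t E-t ⟩
      i * i        ≈⟨ i²≈-1 ⟩
      - 1#         ∎
      where
      t = z + (z + z)
      E-t : E t ≈ i
      E-t = trans (E-+ z (z + z)) (trans (*-congˡ (E-+ z z)) (ζ³≈i i²≈-1 (E-neg z) E-z≈))

    -- With `q = n / (d + 1)`, `t` satisfies `tᵈ⁺¹ = (E x)ⁿ`. For negative `n` the power of `E x`
    -- goes to the other side, because the ring need not contain its inverse.
    enlarge-rational-power : ∀ {m S x} q → InRing S (E x) → Growth m S → Enlarge m S (λ T → InRing T (E (⟦ q ⟧ * x)))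
    enlarge-rational-power {m} {S} {x} q@(mkℚ n d _) Ex∈S = cases n (ι-*-numerator q)
      where
      t = E (⟦ q ⟧ * x)
      t^1+d : ∀ {r} → ι (suc d) ℚ.* q ≡ r → t ^ suc d ≈ E (⟦ r ⟧ * x)
      t^1+d {r} eq = trans (sym (E-ι (suc d) (⟦ q ⟧ * x))) (E-cong _ _ (trans (sym (*-assoc ⟦ ι (suc d) ⟧ ⟦ q ⟧ x))
        (*-congʳ (trans (sym (*-homo (ι (suc d)) q)) (reflexive (≡.cong ⟦_⟧ eq))))))
      cases : ∀ n → ι (suc d) ℚ.* q ≡ n ℚ./ 1 → Growth m S → Enlarge m S (λ T → InRing T t)
      cases (ℤ.+ k)      eq = enlarge-radical {m} d inRing-1 (inRing-^ Ex∈S k) (^-≉0 (E≉0 x) k)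
        (trans (*-identityˡ _) (trans (t^1+d (≡.trans eq (≡.sym (ι≡ k)))) (E-ι k x)))
      cases ℤ.-[1+ k ] eq = enlarge-radical {m} d (inRing-^ Ex∈S (suc k)) inRing-1 1≉0 (begin
        E x ^ suc k * t ^ suc d
          ≈⟨ *-cong (sym (E-ι (suc k) x)) (t^1+d (≡.trans eq (≡.cong ℚ.-_ (≡.sym (ι≡ (suc k)))))) ⟩
        E (⟦ ι (suc k) ⟧ * x) * E (⟦ ℚ.- ι (suc k) ⟧ * x)
          ≈⟨ *-congˡ (E-cong _ _ (trans (*-congʳ (-‿homo (ι (suc k)))) (solve 2 (λ a x → :- a :* x := :- (a :* x)) refl ⟦ ι (suc k) ⟧ x))) ⟩
        E (⟦ ι (suc k) ⟧ * x) * E (- (⟦ ι (suc k) ⟧ * x))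
          ≈⟨ E-neg (⟦ ι (suc k) ⟧ * x) ⟩
        1# ∎)

    enlarge-combination : ∀ {m S n} r (xs : Vector Carrier n) → (∀ i → InRing S (E (xs i))) → Growth m S →
                          Enlarge m S (λ T → InRing T (E (combination r xs)))
    enlarge-combination {S = S} {zero}  r xs _ g k = k S (λ s → s) g (inRing-resp (sym E-0) inRing-1)
    enlarge-combination {m} {n = suc n} r xs xs∈S g k =
      enlarge-rational-power {m} (r zero) (xs∈S zero) g λ T S⊆T g′ head∈T →
      enlarge-combination {m} (r ∘ suc) (xs ∘ suc) (inRing-⊆ S⊆T ∘ xs∈S ∘ suc) g′ λ U T⊆U g″ tail∈U →
      k U (T⊆U ∘ S⊆T) g″ (inRing-resp (sym (E-+ _ _)) (inRing-* (inRing-⊆ T⊆U head∈T) tail∈U))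

    -- Towers of exponents

    module Tower
      (l : Carrier) (E-l : E l ≈ - 1#)
      (schanuel : ∀ n (z : Vector Carrier n) → Independent z →
        ¬ ¬ (∃[ f ] ∀ p → evaluatePolynomial n p ((z ++ (E ∘ z)) ∘ f) ≈ 0# → IsZero n p))
      where

      -- There are `rank + 1` exponents but only growth `rank`. The surplus of one stems from the
      -- exponent 1, whose power `E l = - 1` is rational; the contradiction with Schanuel's
      -- conjecture rests on it.
      record State : Set₁ where
        field
          {rank}      : ℕ
          exponents   : Vector Carrier (suc rank)
          generators  : Pred Carrier 0ℓ
          growth      : Growth rank generators
          independent : Independent exponents
          exponents∈  : ∀ i → InRing generators (exponents i)
          powers∈     : ∀ i → InRing generators (E (exponents i * l))

      open State

      enlarge : ∀ σ {T} → generators σ ⊆ T → Growth (rank σ) T → State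
      enlarge σ {T} S⊆T g = record
        { exponents   = exponents σ
        ; generators  = T
        ; growth      = g
        ; independent = independent σ
        ; exponents∈  = inRing-⊆ S⊆T ∘ exponents∈ σ
        ; powers∈     = inRing-⊆ S⊆T ∘ powers∈ σ
        }

      extend : ∀ σ {T} x → generators σ ⊆ T → Growth (suc (rank σ)) T → Independent (x Vector.∷ exponents σ) →
               InRing T x → InRing T (E (x * l)) → State
      extend σ {T} x S⊆T g indep x∈T Ex∈T = record
        { exponents   = x Vector.∷ exponents σ
        ; generators  = T
        ; growth      = g
        ; independent = indep
        ; exponents∈  = λ where
            zero    → x∈T
            (suc i) → inRing-⊆ S⊆T (exponents∈ σ i)
        ; powers∈     = λ where
            zero    → Ex∈T
            (suc i) → inRing-⊆ S⊆T (powers∈ σ i)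
        }

      Extend : State → (Pred Carrier 0ℓ → Set) → Set₁
      Extend σ P = ((τ : State) → generators σ ⊆ generators τ → P (generators τ) → ⊥) → ⊥

      -- A new exponent either raises both the rank and the growth by one, or is a
      -- rational combination of the old ones, and then its power is algebraic.
      extend-pair : ∀ σ x → InRing (generators σ) x ⊎ InRing (generators σ) (E (x * l)) →
                    Extend σ (λ T → InRing T x × InRing T (E (x * l)))
      extend-pair σ x x∈ k = independent⊎relation (x Vector.∷ exponents σ) λ where
          (inj₁ indep) → free x∈ indep
          (inj₂ rel)   → bound (relation⇒combination {us = exponents σ} (independent σ) rel)
        where
        S = generators σ
        free : InRing S x ⊎ InRing S (E (x * l)) → Independent (x Vector.∷ exponents σ) → ⊥
        -- Only the missing one of `x` and `E (x * l)` is adjoined, here the power, so that the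
        -- growth rises by one along with `rank`.
        free (inj₁ x∈S)  indep = k (extend σ x inj₁ (growth-▷ {m = rank σ} (growth σ)) indep x∈T Ex∈T) inj₁ (x∈T , Ex∈T)
          where
          x∈T  = inRing-⊆ inj₁ x∈S
          Ex∈T = inRing-gen (inj₂ refl)
        free (inj₂ Ex∈S) indep = k (extend σ x inj₁ (growth-▷ {m = rank σ} (growth σ)) indep x∈T Ex∈T) inj₁ (x∈T , Ex∈T)
          where
          x∈T  = inRing-gen (inj₂ refl)
          Ex∈T = inRing-⊆ inj₁ Ex∈S
        bound : ∃[ r ] x ≈ combination r (exponents σ) → ⊥
        bound (r , x≈) = enlarge-combination {rank σ} r (λ i → exponents σ i * l) (powers∈ σ) (growth σ) λ T S⊆T g Ex∈T →
          k (enlarge σ S⊆T g) S⊆T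
            ( inRing-resp (sym x≈) (inRing-⊆ S⊆T (inRing-combination r (exponents∈ σ)))
            , inRing-resp (E-cong _ _ (trans (combination-*ʳ r (exponents σ) l) (*-congʳ (sym x≈)))) Ex∈T )

      -- The quantification over all states lets several reachable elements be collected in one
      -- state, each by enlarging the state obtained for the previous ones.
      Reachable : Carrier → Set₁
      Reachable u = ∀ σ → Extend σ (λ T → InRing T u)

      reachable-resp : ∀ {u v} → u ≈ v → Reachable u → Reachable v
      reachable-resp u≈v r σ k = r σ λ τ σ⊆τ u∈τ → k τ σ⊆τ (inRing-resp u≈v u∈τ)

      reachable-rational : ∀ q → Reachable ⟦ q ⟧
      reachable-rational q σ k = k σ (λ s → s) (inRing-rational q)

      reachable-neg : ∀ {u} → Reachable u → Reachable (- u)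
      reachable-neg r σ k = r σ λ τ σ⊆τ u∈τ → k τ σ⊆τ (inRing-neg u∈τ)

      module _ {u v : Carrier} (r : Reachable u) (s : Reachable v) where

        reachable-both : ∀ σ → Extend σ (λ T → InRing T u × InRing T v)
        reachable-both σ k = r σ λ τ σ⊆τ u∈τ → s τ λ υ τ⊆υ v∈υ → k υ (τ⊆υ ∘ σ⊆τ) (inRing-⊆ τ⊆υ u∈τ , v∈υ)

        reachable-+ : Reachable (u + v)
        reachable-+ σ k = reachable-both σ λ τ σ⊆τ (u∈τ , v∈τ) → k τ σ⊆τ (inRing-+ u∈τ v∈τ)

        reachable-* : Reachable (u * v)
        reachable-* σ k = reachable-both σ λ τ σ⊆τ (u∈τ , v∈τ) → k τ σ⊆τ (inRing-* u∈τ v∈τ)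

      reachable-power : ∀ {x} → Reachable x → Reachable (E (x * l))
      reachable-power {x} r σ k = r σ λ τ σ⊆τ x∈τ → extend-pair τ x (inj₁ x∈τ) λ υ τ⊆υ (_ , Ex∈υ) → k υ (τ⊆υ ∘ σ⊆τ) Ex∈υ

      reachable-log : ∀ {x} → Reachable (E (x * l)) → Reachable x
      reachable-log {x} r σ k = r σ λ τ σ⊆τ Ex∈τ → extend-pair τ x (inj₂ Ex∈τ) λ υ τ⊆υ (x∈υ , _) → k υ (τ⊆υ ∘ σ⊆τ) x∈υ

      reachable-all : ∀ {p} → All Reachable p → ∀ σ → Extend σ (λ T → All (InRing T) p)
      reachable-all []       σ k = k σ (λ s → s) []
      reachable-all (r ∷ rs) σ k = r σ λ τ σ⊆τ u∈τ → reachable-all rs τ λ υ τ⊆υ p∈υ →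
        k υ (τ⊆υ ∘ σ⊆τ) (inRing-⊆ τ⊆υ u∈τ ∷ p∈υ)

      reachable-root : ∀ {t} p → All Reachable p → Any (_≉ 0#) p → evaluateᴿ p t ≈ 0# → Reachable t
      reachable-root p p-reachable p≉0 root σ k = reachable-all p-reachable σ λ τ σ⊆τ p∈τ →
        enlarge-root {rank τ} p p∈τ p≉0 root (growth τ) λ T τ⊆T g t∈T → k (enlarge τ τ⊆T g) (τ⊆T ∘ σ⊆τ) t∈T

      -- The inverse of `x` is a root of `x X - 1`, so division is covered by `reachable-root`.
      reachable-inverse : ∀ {x y} → Reachable x → x * y ≈ 1# → Reachable y
      reachable-inverse {x} {y} r xy≈1 = reachable-root (- 1# ∷ x ∷ [])
        (reachable-neg (reachable-resp 1-homo (reachable-rational 1ℚ)) ∷ r ∷ []) (here (-‿≉0 1≉0)) (begin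
          - 1# + y * (x + y * 0#)  ≈⟨ +-congˡ (*-congˡ (trans (+-congˡ (zeroʳ y)) (+-identityʳ x))) ⟩
          - 1# + y * x             ≈⟨ +-congˡ (trans (*-comm y x) xy≈1) ⟩
          - 1# + 1#                ≈⟨ -‿inverseˡ 1# ⟩
          0#                       ∎)

      -- The initial state and the transcendence bound

      initial : State
      initial = record
        { rank        = 0
        ; exponents   = λ _ → 1#
        ; generators  = λ _ → ⊥
        -- Without generators only rationals arise, and these are spanned by 1, so the dimension is
        -- at most 1 for each `L`.
        ; growth      = 1 , λ L → 1# , 1≉0 , 1# ∷ [] , ℕ.≤-refl , λ u p → span-resp (1# ∷ []) (sym (*-identityˡ u)) (rational-span p)
        ; independent = λ q eq → λ where
            zero → decidable-stable (q zero ℚ.≟ 0ℚ) λ q≢0 → ⟦⟧-≉0 q≢0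
              (trans (sym (trans (+-identityʳ _) (*-identityʳ ⟦ q zero ⟧))) eq)
        ; exponents∈  = λ _ → inRing-1
        ; powers∈     = λ _ → inRing-resp (trans (sym E-l) (E-cong _ _ (sym (*-identityˡ l)))) (inRing-neg inRing-1)
        }
        where
        rational-span : ∀ {L u} → Poly (λ _ → ⊥) L u → Span (1# ∷ []) u
        rational-span (rational q) = q , trans (+-congˡ (-‿cong (*-identityʳ ⟦ q ⟧))) (-‿inverseʳ ⟦ q ⟧)
        rational-span (add p r)    = span-+ (1# ∷ []) (rational-span p) (rational-span r)
        rational-span (resp eq p)  = span-resp (1# ∷ []) eq (rational-span p)

      -- Schanuel's conjecture finds `n` algebraically independent numbers among the `z i` and
      -- `E (z i)`, and `growth-dependent` forbids this in a ring of growth `m < n`.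
      schanuel-bound : ∀ {m n S} (z : Vector Carrier n) → m ℕ.< n → Growth m S → Independent z →
                       (∀ i → InRing S (z i)) → ¬ (∀ i → InRing S (E (z i)))
      schanuel-bound {m} {n} {S} z m<n g indep z∈S Ez∈S = schanuel n z indep λ (f , algIndep) →
        growth-dependent {m} g m<n (both ∘ f) algIndep
        where
        both : ∀ i → InRing S ((z ++ (E ∘ z)) i)
        both i with splitAt n i
        ... | inj₁ j = z∈S j
        ... | inj₂ j = Ez∈S j

      l≉0 : l ≉ 0#
      l≉0 l≈0 = ⟦⟧-≉0 {1ℚ ℚ.+ 1ℚ} (λ ()) (begin
        ⟦ 1ℚ ℚ.+ 1ℚ ⟧  ≈⟨ trans (+-homo 1ℚ 1ℚ) (+-cong 1-homo 1-homo) ⟩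
        1# + 1#        ≈⟨ +-congˡ (trans (sym E-0) (trans (E-cong _ _ (sym l≈0)) E-l)) ⟩
        1# + - 1#      ≈⟨ -‿inverseʳ 1# ⟩
        0#             ∎)

      ¬reachable-log : ∀ {w} → w ≉ 0# → Reachable w → ¬ Reachable (E w)
      ¬reachable-log {w} w≉0 r s = reachable-both r s initial λ σ _ (w∈σ , Ew∈σ) → contradict σ w∈σ Ew∈σ
        where
        contradict : ∀ σ → InRing (generators σ) w → InRing (generators σ) (E w) → ⊥
        contradict σ w∈S Ew∈S = independent⊎relation (w Vector.∷ zs) λ where
            -- `l` is adjoined as if it were transcendental: growth `rank + 1` against the
            -- `rank + 2` numbers `w` and `zs i`.
            (inj₁ indep) → schanuel-bound {suc (rank σ)} (w Vector.∷ zs) ℕ.≤-refl (growth-▷ {t = l} {rank σ} (growth σ)) indep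
              (λ where
                zero    → inRing-⊆ inj₁ w∈S
                (suc i) → zs∈ i)
              (λ where
                zero    → inRing-⊆ inj₁ Ew∈S
                (suc i) → inRing-⊆ inj₁ (powers∈ σ i))
            (inj₂ rel) → algebraic (relation⇒combination {us = zs} zs-independent rel)
          where
          S = generators σ
          zs : Vector Carrier (suc (rank σ))
          zs i = exponents σ i * l
          zs∈ : ∀ i → InRing (S ▷ l) (zs i)
          zs∈ i = inRing-* (inRing-⊆ inj₁ (exponents∈ σ i)) (inRing-gen (inj₂ refl))
          zs-independent : Independent zs
          zs-independent q eq = independent σ q (cancel-0 l _ l≉0
            (trans (*-comm l _) (trans (sym (combination-*ʳ q (exponents σ) l)) eq)))
          algebraic : ∃[ r ] w ≈ combination r zs → ⊥
          -- `l` is a root of `x X - w`, so adjoining it keeps the growth at `rank`, against the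
          -- `rank + 1` numbers `zs i`.
          algebraic (r , w≈) = growth-algebraic {rank σ} (- w ∷ x ∷ []) (inRing-neg w∈S ∷ x∈S ∷ []) (there (here x≉0)) root (growth σ)
            λ g → schanuel-bound {rank σ} zs ℕ.≤-refl g zs-independent zs∈ (λ i → inRing-⊆ inj₁ (powers∈ σ i))
            where
            x = combination r (exponents σ)
            x∈S = inRing-combination r (exponents∈ σ)
            w≈xl : w ≈ x * l
            w≈xl = trans w≈ (combination-*ʳ r (exponents σ) l)
            x≉0 : x ≉ 0#
            x≉0 x≈0 = w≉0 (trans w≈xl (trans (*-congʳ x≈0) (zeroˡ l)))
            root : evaluateᴿ (- w ∷ x ∷ []) l ≈ 0#
            root = begin
              - w + l * (x + l * 0#)  ≈⟨ +-congˡ (*-congˡ (trans (+-congˡ (zeroʳ l)) (+-identityʳ x))) ⟩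
              - w + l * x             ≈⟨ +-congˡ (trans (*-comm l x) (sym w≈xl)) ⟩
              - w + w                 ≈⟨ -‿inverseˡ w ⟩
              0#                      ∎

open import Defs
open import Algebra.Bundles using (CommutativeSemiring)
open import Algebra.Structures using (IsCommutativeRing)
open import Data.Empty using (⊥-elim)
open import Data.Fin.Base using (zero; suc)
import Data.Integer.Base as ℤ
open import Data.List.Base using ([]; _∷_)
open import Data.List.Properties using (foldr-cong)
open import Data.List.Relation.Unary.All as All using ([]; _∷_)
open import Data.List.Relation.Unary.Any as Any using (here)
open import Data.Nat.Base as ℕ using (ℕ; zero; suc)
import Data.Nat.Properties as ℕ
open import Data.Product.Base using (∃-syntax; _×_; _,_; proj₁; proj₂)
open import Data.Rational.Base
open import Data.Rational.Properties
open import Data.Rational.Solver using (module +-*-Solver)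
open import Data.Sum.Base using (_⊎_; inj₁; inj₂)
open import Data.Vec.Functional using (Vector; _++_) renaming (foldr to foldrᵛ)
open import Function.Base using (_∘_)
open import Relation.Binary.PropositionalEquality using (_≡_; refl; sym; trans; cong; cong₂; subst; subst₂; isEquivalence)
open import Relation.Nullary using (yes; no)
open import Relation.Unary using (_∪_)

open +-*-Solver using (solve; _:=_; _:+_; _:*_; _:-_; :-_; con)

-- Complex numbers

Eventually : (ℕ → Set) → Set
Eventually P = ∃[ N ] ∀ n → N ℕ.≤ n → P n

Vanishing : (ℕ → ℚ) → Set
Vanishing r = ∀ ε → 0ℚ < ε → Eventually (λ n → r n < ε)

module _ {P Q : ℕ → Set} where

  eventually-map : (∀ n → P n → Q n) → Eventually P → Eventually Q
  eventually-map f (N , p) = N , λ n N≤n → f n (p n N≤n)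

  eventually-× : Eventually P → Eventually Q → Eventually (λ n → P n × Q n)
  eventually-× (M , p) (N , q) = M ℕ.+ N , λ n M+N≤n →
    p n (ℕ.m+n≤o⇒m≤o M M+N≤n) , q n (ℕ.m+n≤o⇒n≤o M M+N≤n)

always : ∀ {P : ℕ → Set} → (∀ n → P n) → Eventually P
always p = 0 , λ n _ → p n

vanishing-mono : ∀ {r s} → Eventually (λ n → r n ≤ s n) → Vanishing s → Vanishing r
vanishing-mono r≤s v ε 0<ε = eventually-map (λ n (le , lt) → ≤-<-trans le lt) (eventually-× r≤s (v ε 0<ε))

vanishing-+ : ∀ {r s} → Vanishing r → Vanishing s → Vanishing (λ n → r n + s n)
vanishing-+ {r} {s} v w ε 0<ε = eventually-map
  (λ n (a , b) → subst (r n + s n <_) (halves ε) (+-mono-< a b))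
  (eventually-× (v (½ * ε) (half-pos 0<ε)) (w (½ * ε) (half-pos 0<ε)))

vanishing-* : ∀ {K r} → 0ℚ ≤ K → Vanishing r → Vanishing (λ n → K * r n)
vanishing-* {K} 0≤K v ε 0<ε = withδ (scale 0≤K 0<ε)
  where
  withδ : (∃[ δ ] 0ℚ < δ × K * δ < ε) → Eventually _
  withδ (δ , 0<δ , Kδ<ε) = eventually-map
    (λ n r<δ → ≤-<-trans (*-monoˡ-≤-nonNeg K {{nonNegative 0≤K}} (<⇒≤ r<δ)) Kδ<ε) (v δ 0<δ)

vanishing-cancel : ∀ {κ r} → 0ℚ < κ → Vanishing (λ n → κ * r n) → Vanishing r
vanishing-cancel {κ} 0<κ v ε 0<ε = eventually-map
  (λ n → *-cancelˡ-<-nonNeg κ {{nonNegative (<⇒≤ 0<κ)}})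
  (v (κ * ε) (subst (_< κ * ε) (*-zeroʳ κ) (*-monoʳ-<-pos κ {{positive 0<κ}} 0<ε)))

vanishing-0 : ∀ {r} → (∀ n → r n ≡ 0ℚ) → Vanishing r
vanishing-0 r≡0 ε 0<ε = always (λ n → subst (_< ε) (sym (r≡0 n)) 0<ε)

BoundedAway : (ℕ → ℚ) → Set
BoundedAway s = ∃[ δ ] 0ℚ < δ × Eventually (λ n → δ ≤ ∣ s n ∣)

-- One late term decides. It is within `ε / 4` of all later ones; if it is below `ε / 2`, they stay
-- below `ε`, and otherwise they stay at least `ε / 4` away from 0.
¬boundedAway⇒vanishing : ∀ {s} → Cauchy s → ¬ BoundedAway s → Vanishing (λ n → ∣ s n ∣)
¬boundedAway⇒vanishing {s} cs ¬away ε 0<ε = decide (cs q 0<q)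
  where
  h = ½ * ε
  q = ½ * h
  0<q : 0ℚ < q
  0<q = half-pos (half-pos 0<ε)
  q<h : q < h
  q<h = subst₂ _<_ (+-identityʳ q) (halves h) (+-monoʳ-< q 0<q)
  difference : ∀ a b → ∣ a ∣ ≤ ∣ a - b ∣ + ∣ b ∣
  difference a b = subst (λ x → ∣ x ∣ ≤ ∣ a - b ∣ + ∣ b ∣)
    (solve 2 (λ a b → (a :- b) :+ b := a) refl a b) (∣p+q∣≤∣p∣+∣q∣ (a - b) b)
  decide : (∃[ N ] ∀ m n → N ℕ.≤ m → N ℕ.≤ n → ∣ s m - s n ∣ < q) → Eventually (λ n → ∣ s n ∣ < ε)
  decide (N , c) with ∣ s N ∣ <? h
  ... | yes small = N , λ n N≤n → ≤-<-trans (difference (s n) (s N))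
          (subst (∣ s n - s N ∣ + ∣ s N ∣ <_) (halves ε) (+-mono-< (<-trans (c n N N≤n ℕ.≤-refl) q<h) small))
  ... | no large = ⊥-elim (¬away (q , 0<q , N , λ n N≤n →
          subst₂ _≤_ (solve 1 (λ q → :- q :+ (q :+ q) := q) refl q)
                     (solve 2 (λ q x → :- q :+ (q :+ x) := x) refl q ∣ s n ∣)
            (+-monoʳ-≤ (- q) (≤-trans (≤-trans (≤-reflexive (halves h)) (≮⇒≥ large))
              (≤-trans (difference (s N) (s n)) (+-monoˡ-≤ ∣ s n ∣ (<⇒≤ (c N n ℕ.≤-refl N≤n))))))))

boundedAway⇒¬vanishing : ∀ {s} → BoundedAway s → ¬ Vanishing (λ n → ∣ s n ∣)
boundedAway⇒¬vanishing (δ , 0<δ , away) v with eventually-× away (v δ 0<δ)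
... | N , both = <-irrefl refl (≤-<-trans (proj₁ (both N ℕ.≤-refl)) (proj₂ (both N ℕ.≤-refl)))

-- A difference bounded away from 0 refutes equality outright. A doubly negated equality therefore
-- excludes it, and then the difference vanishes.
≈ᴿ-stable : ∀ {x y} → ¬ ¬ (x ≈ᴿ y) → x ≈ᴿ y
≈ᴿ-stable {x} {y} ¬¬x≈y = ¬boundedAway⇒vanishing (cauchy (x -ᴿ y))
  λ away → ¬¬x≈y (boundedAway⇒¬vanishing away)

-- The ring of Gaussian rationals

0ᵢ 1ᵢ : ℚ[i]
0ᵢ = 0ℚ ,i 0ℚ
1ᵢ = 1ℚ ,i 0ℚ

negate : ℚ[i] → ℚ[i]
negate z = (- re z) ,i (- im z)

ℚ[i]-commutativeRing : CommutativeRing 0ℓ 0ℓ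
ℚ[i]-commutativeRing = record
  { Carrier = ℚ[i]
  ; _≈_ = _≡_
  ; _+_ = _⊕_
  ; _*_ = _⊛_
  ; -_  = negate
  ; 0#  = 0ᵢ
  ; 1#  = 1ᵢ
  ; isCommutativeRing = record
    { isRing = record
      { +-isAbelianGroup = record
        { isGroup = record
          { isMonoid = record
            { isSemigroup = record
              { isMagma = record { isEquivalence = isEquivalence ; ∙-cong = cong₂ _⊕_ }
              ; assoc = λ x y z → cong₂ _,i_ (+-assoc (re x) (re y) (re z)) (+-assoc (im x) (im y) (im z))
              }
            ; identity = (λ x → cong₂ _,i_ (+-identityˡ (re x)) (+-identityˡ (im x)))
                       , (λ x → cong₂ _,i_ (+-identityʳ (re x)) (+-identityʳ (im x)))
            }
          ; inverse = (λ x → cong₂ _,i_ (+-inverseˡ (re x)) (+-inverseˡ (im x)))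
                    , (λ x → cong₂ _,i_ (+-inverseʳ (re x)) (+-inverseʳ (im x)))
          ; ⁻¹-cong = cong negate
          }
        ; comm = λ x y → cong₂ _,i_ (+-comm (re x) (re y)) (+-comm (im x) (im y))
        }
      ; *-cong = cong₂ _⊛_
      ; *-assoc = λ x y z → cong₂ _,i_
          (solve 6 (λ a b c d e f → (a :* c :- b :* d) :* e :- (a :* d :+ b :* c) :* f
              := a :* (c :* e :- d :* f) :- b :* (c :* f :+ d :* e)) refl (re x) (im x) (re y) (im y) (re z) (im z))
          (solve 6 (λ a b c d e f → (a :* c :- b :* d) :* f :+ (a :* d :+ b :* c) :* e
              := a :* (c :* f :+ d :* e) :+ b :* (c :* e :- d :* f)) refl (re x) (im x) (re y) (im y) (re z) (im z))
      ; *-identity = (λ x → cong₂ _,i_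
            (solve 2 (λ a b → con 1ℚ :* a :- con 0ℚ :* b := a) refl (re x) (im x))
            (solve 2 (λ a b → con 1ℚ :* b :+ con 0ℚ :* a := b) refl (re x) (im x)))
          , (λ x → cong₂ _,i_
            (solve 2 (λ a b → a :* con 1ℚ :- b :* con 0ℚ := a) refl (re x) (im x))
            (solve 2 (λ a b → a :* con 0ℚ :+ b :* con 1ℚ := b) refl (re x) (im x)))
      ; distrib = (λ x y z → cong₂ _,i_
            (solve 6 (λ a b c d e f → a :* (c :+ e) :- b :* (d :+ f) := (a :* c :- b :* d) :+ (a :* e :- b :* f))
              refl (re x) (im x) (re y) (im y) (re z) (im z))
            (solve 6 (λ a b c d e f → a :* (d :+ f) :+ b :* (c :+ e) := (a :* d :+ b :* c) :+ (a :* f :+ b :* e))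
              refl (re x) (im x) (re y) (im y) (re z) (im z)))
          , (λ x y z → cong₂ _,i_
            (solve 6 (λ a b c d e f → (c :+ e) :* a :- (d :+ f) :* b := (c :* a :- d :* b) :+ (e :* a :- f :* b))
              refl (re x) (im x) (re y) (im y) (re z) (im z))
            (solve 6 (λ a b c d e f → (c :+ e) :* b :+ (d :+ f) :* a := (c :* b :+ d :* a) :+ (e :* b :+ f :* a))
              refl (re x) (im x) (re y) (im y) (re z) (im z)))
      }
    ; *-comm = λ x y → cong₂ _,i_
        (solve 4 (λ a b c d → a :* c :- b :* d := c :* a :- d :* b) refl (re x) (im x) (re y) (im y))
        (solve 4 (λ a b c d → a :* d :+ b :* c := c :* b :+ d :* a) refl (re x) (im x) (re y) (im y))
    }
  }

private
  module Qᵢ = CommutativeRing ℚ[i]-commutativeRing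

-- Equality and ring operations on ℂ

dist : ℂ → ℂ → ℕ → ℚ
dist z w n = ‖ approx z n ⊝ approx w n ‖

vanishing⇒≈ : ∀ z w → Vanishing (dist z w) → z ≈ w
vanishing⇒≈ z w v =
  vanishing-mono (always λ n → ∣re∣≤‖‖ (approx z n ⊝ approx w n)) v ,
  vanishing-mono (always λ n → ∣im∣≤‖‖ (approx z n ⊝ approx w n)) v

≈⇒vanishing : ∀ z w → z ≈ w → Vanishing (dist z w)
≈⇒vanishing z w (p , q) = vanishing-+ p q

‖⊝‖-self : ∀ a → ‖ a ⊝ a ‖ ≡ 0ℚ
‖⊝‖-self a = cong ‖_‖ {a ⊝ a} {0ᵢ} (Qᵢ.-‿inverseʳ a)

-- The operations of ℂ act termwise on approximations, so each ring law follows in this way from the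
-- same law for Gaussian rationals.
pointwise : ∀ z w → (∀ n → approx z n ≡ approx w n) → z ≈ w
pointwise z w eq = vanishing⇒≈ z w (vanishing-0 λ n →
  trans (cong (λ x → ‖ x ⊝ approx w n ‖) (eq n)) (‖⊝‖-self (approx w n)))

≈-refl : ∀ z → z ≈ z
≈-refl z = pointwise z z (λ _ → refl)

≈-sym : ∀ z w → z ≈ w → w ≈ z
≈-sym z w (p , q) =
  vanishing-mono (always λ n → ≤-reflexive (∣-∣-sym (seq (Re w) n) (seq (Re z) n))) p ,
  vanishing-mono (always λ n → ≤-reflexive (∣-∣-sym (seq (Im w) n) (seq (Im z) n))) q

≈-trans : ∀ x y z → x ≈ y → y ≈ z → x ≈ z
≈-trans x y z (p , q) (p′ , q′) =
  vanishing-mono (always λ n → ∣-∣-triangle (seq (Re x) n) (seq (Re y) n) (seq (Re z) n)) (vanishing-+ p p′) ,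
  vanishing-mono (always λ n → ∣-∣-triangle (seq (Im x) n) (seq (Im y) n) (seq (Im z) n)) (vanishing-+ q q′)

≈-stable : ∀ z w → ¬ ¬ (z ≈ w) → z ≈ w
≈-stable z w ¬¬z≈w =
  ≈ᴿ-stable {Re z} {Re w} (λ k → ¬¬z≈w (k ∘ proj₁)) , ≈ᴿ-stable {Im z} {Im w} (λ k → ¬¬z≈w (k ∘ proj₂))

+ℂ-cong : ∀ x y u v → x ≈ y → u ≈ v → x +ℂ u ≈ y +ℂ v
+ℂ-cong x y u v x≈y u≈v = vanishing⇒≈ (x +ℂ u) (y +ℂ v)
  (vanishing-mono (always λ n → subst (_≤ dist x y n + dist u v n)
      (cong ‖_‖ (⊕-⊝ (approx x n) (approx y n) (approx u n) (approx v n)))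
      (‖⊕‖-≤ (approx x n ⊝ approx y n) (approx u n ⊝ approx v n) ≤-refl ≤-refl))
    (vanishing-+ (≈⇒vanishing x y x≈y) (≈⇒vanishing u v u≈v)))

-ℂ-cong : ∀ x y → x ≈ y → -ℂ x ≈ -ℂ y
-ℂ-cong x y (p , q) =
  vanishing-mono (always λ n → ≤-reflexive (eq (seq (Re x) n) (seq (Re y) n))) p ,
  vanishing-mono (always λ n → ≤-reflexive (eq (seq (Im x) n) (seq (Im y) n))) q
  where
  eq : ∀ a b → ∣ - a - - b ∣ ≡ ∣ a - b ∣
  eq a b = trans (cong ∣_∣ (solve 2 (λ a b → :- a :- :- b := :- (a :- b)) refl a b)) (∣-p∣≡∣p∣ (a - b))

*ℂ-cong : ∀ x y u v → x ≈ y → u ≈ v → x *ℂ u ≈ y *ℂ v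
*ℂ-cong x y u v x≈y u≈v = withBounds (approx-bounded x) (approx-bounded v)
  where
  split : ∀ x y u v → x ⊛ (u ⊝ v) ⊕ v ⊛ (x ⊝ y) ≡ x ⊛ u ⊝ y ⊛ v
  split x y u v = cong₂ _,i_
    (solve 8 (λ a a′ b b′ c c′ d d′ →
        (a :* (c :- d) :- a′ :* (c′ :- d′)) :+ (d :* (a :- b) :- d′ :* (a′ :- b′))
        := (a :* c :- a′ :* c′) :- (b :* d :- b′ :* d′))
      refl (re x) (im x) (re y) (im y) (re u) (im u) (re v) (im v))
    (solve 8 (λ a a′ b b′ c c′ d d′ →
        (a :* (c′ :- d′) :+ a′ :* (c :- d)) :+ (d :* (a′ :- b′) :+ d′ :* (a :- b))
        := (a :* c′ :+ a′ :* c) :- (b :* d′ :+ b′ :* d))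
      refl (re x) (im x) (re y) (im y) (re u) (im u) (re v) (im v))
  withBounds : Bounded (approx x) → Bounded (approx v) → x *ℂ u ≈ y *ℂ v
  withBounds (A , 0≤A , bx) (B , 0≤B , bv) = vanishing⇒≈ (x *ℂ u) (y *ℂ v)
    (vanishing-mono
      (eventually-map (λ n (xA , vB) → subst (λ e → ‖ e ‖ ≤ A * dist u v n + B * dist x y n)
          (split (approx x n) (approx y n) (approx u n) (approx v n))
          (‖⊕‖-≤ (approx x n ⊛ (approx u n ⊝ approx v n)) (approx v n ⊛ (approx x n ⊝ approx y n))
            (‖⊛‖-≤ (approx x n) (approx u n ⊝ approx v n) xA ≤-refl)
            (‖⊛‖-≤ (approx v n) (approx x n ⊝ approx y n) vB ≤-refl)))
        (eventually-× bx bv))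
      (vanishing-+ (vanishing-* 0≤A (≈⇒vanishing u v u≈v)) (vanishing-* 0≤B (≈⇒vanishing x y x≈y))))

ℂ-commutativeRing : CommutativeRing 0ℓ 0ℓ
ℂ-commutativeRing = record
  { Carrier = ℂ
  ; _≈_ = _≈_
  ; _+_ = _+ℂ_
  ; _*_ = _*ℂ_
  ; -_  = -ℂ_
  ; 0#  = 0ℂ
  ; 1#  = 1ℂ
  ; isCommutativeRing = record
    { isRing = record
      { +-isAbelianGroup = record
        { isGroup = record
          { isMonoid = record
            { isSemigroup = record
              { isMagma = record
                { isEquivalence = record
                  { refl  = λ {x} → ≈-refl x
                  ; sym   = λ {x} {y} → ≈-sym x y
                  ; trans = λ {x} {y} {z} → ≈-trans x y z
                  }
                ; ∙-cong = λ {x} {y} {u} {v} → +ℂ-cong x y u v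
                }
              ; assoc = λ x y z → pointwise ((x +ℂ y) +ℂ z) (x +ℂ (y +ℂ z)) λ n →
                  Qᵢ.+-assoc (approx x n) (approx y n) (approx z n)
              }
            ; identity = (λ x → pointwise (0ℂ +ℂ x) x λ n → Qᵢ.+-identityˡ (approx x n))
                       , (λ x → pointwise (x +ℂ 0ℂ) x λ n → Qᵢ.+-identityʳ (approx x n))
            }
          ; inverse = (λ x → pointwise (-ℂ x +ℂ x) 0ℂ λ n → Qᵢ.-‿inverseˡ (approx x n))
                    , (λ x → pointwise (x +ℂ -ℂ x) 0ℂ λ n → Qᵢ.-‿inverseʳ (approx x n))
          ; ⁻¹-cong = λ {x} {y} → -ℂ-cong x y
          }
        ; comm = λ x y → pointwise (x +ℂ y) (y +ℂ x) λ n → Qᵢ.+-comm (approx x n) (approx y n)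
        }
      ; *-cong = λ {x} {y} {u} {v} → *ℂ-cong x y u v
      ; *-assoc = λ x y z → pointwise ((x *ℂ y) *ℂ z) (x *ℂ (y *ℂ z)) λ n →
          Qᵢ.*-assoc (approx x n) (approx y n) (approx z n)
      ; *-identity = (λ x → pointwise (1ℂ *ℂ x) x λ n → Qᵢ.*-identityˡ (approx x n))
                   , (λ x → pointwise (x *ℂ 1ℂ) x λ n → Qᵢ.*-identityʳ (approx x n))
      ; distrib = (λ x y z → pointwise (x *ℂ (y +ℂ z)) (x *ℂ y +ℂ x *ℂ z) λ n →
                      Qᵢ.distribˡ (approx x n) (approx y n) (approx z n))
                , (λ x y z → pointwise ((y +ℂ z) *ℂ x) (y *ℂ x +ℂ z *ℂ x) λ n →
                      Qᵢ.distribʳ (approx x n) (approx y n) (approx z n))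
      }
    ; *-comm = λ x y → pointwise (x *ℂ y) (y *ℂ x) λ n → Qᵢ.*-comm (approx x n) (approx y n)
    }
  }

-- Absence of zero divisors in ℂ

≉0⇒¬¬boundedAway : ∀ z → z ≉ 0ℂ → ¬ ¬ (BoundedAway (seq (Re z)) ⊎ BoundedAway (seq (Im z)))
≉0⇒¬¬boundedAway z z≉0 k = z≉0 (part (Re z) (k ∘ inj₁) , part (Im z) (k ∘ inj₂))
  where
  part : ∀ x → ¬ BoundedAway (seq x) → x ≈ᴿ fromℚᴿ 0ℚ
  part x ¬away = vanishing-mono (always λ n → ≤-reflexive (cong ∣_∣ (+-identityʳ (seq x n))))
    (¬boundedAway⇒vanishing (cauchy x) ¬away)

conj : ℚ[i] → ℚ[i]
conj z = re z ,i (- im z)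

‖conj‖ : ∀ z → ‖ conj z ‖ ≡ ‖ z ‖
‖conj‖ z = cong (∣ re z ∣ +_) (∣-p∣≡∣p∣ (im z))

-- conj z ⊛ (z ⊛ w) = ∣z∣² w
conj-cancel : ∀ {δ B} z w → 0ℚ ≤ δ → δ ≤ re z * re z + im z * im z → ‖ z ‖ ≤ B →
              δ * ‖ w ‖ ≤ B * ‖ z ⊛ w ‖
conj-cancel {δ} {B} z w 0≤δ δ≤ zB = ≤-trans
  (*-mono 0≤δ δ≤ (0≤‖‖ w) ≤-refl)
  (subst (_≤ B * ‖ z ⊛ w ‖) norm
    (‖⊛‖-≤ (conj z) (z ⊛ w) (subst (_≤ B) (sym (‖conj‖ z)) zB) ≤-refl))
  where
  N = re z * re z + im z * im z
  0≤N : 0ℚ ≤ N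
  0≤N = ≤-trans 0≤δ δ≤
  eq : conj z ⊛ (z ⊛ w) ≡ N · w
  eq = cong₂ _,i_
    (solve 4 (λ a b c d → a :* (a :* c :- b :* d) :- :- b :* (a :* d :+ b :* c) := (a :* a :+ b :* b) :* c)
      refl (re z) (im z) (re w) (im w))
    (solve 4 (λ a b c d → a :* (a :* d :+ b :* c) :+ :- b :* (a :* c :- b :* d) := (a :* a :+ b :* b) :* d)
      refl (re z) (im z) (re w) (im w))
  norm : ‖ conj z ⊛ (z ⊛ w) ‖ ≡ N * ‖ w ‖
  norm = trans (cong ‖_‖ eq) (trans
    (cong₂ _+_ (trans (∣p*q∣≡∣p∣*∣q∣ N (re w)) (cong (_* ∣ re w ∣) (0≤p⇒∣p∣≡p 0≤N)))
               (trans (∣p*q∣≡∣p∣*∣q∣ N (im w)) (cong (_* ∣ im w ∣) (0≤p⇒∣p∣≡p 0≤N))))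
    (sym (*-distribˡ-+ N (∣ re w ∣) (∣ im w ∣))))

square-mono : ∀ {δ} a → 0ℚ ≤ δ → δ ≤ ∣ a ∣ → δ * δ ≤ a * a
square-mono {δ} a 0≤δ δ≤ with ∣p∣≡p∨∣p∣≡-p a
... | inj₁ eq = subst (λ x → δ * δ ≤ x * x) eq (*-mono 0≤δ δ≤ 0≤δ δ≤)
... | inj₂ eq = subst (δ * δ ≤_) (trans (cong (λ x → x * x) eq) (solve 1 (λ a → :- a :* :- a := a :* a) refl a))
                  (*-mono 0≤δ δ≤ 0≤δ δ≤)

0≤square : ∀ a → 0ℚ ≤ a * a
0≤square a = square-mono a ≤-refl (0≤∣p∣ a)

-- Stability of `w ≈ 0ℂ` permits a case distinction on which part of `z` is bounded away from 0.
-- Then `∣z∣² ≥ δ²` from some index on, and `conj-cancel` bounds `δ² ‖ w ‖` by a multiple of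
-- `‖ z w ‖`.
*ℂ-cancel-0 : ∀ z w → z ≉ 0ℂ → z *ℂ w ≈ 0ℂ → w ≈ 0ℂ
*ℂ-cancel-0 z w z≉0 zw≈0 = ≈-stable w 0ℂ λ w≉0 → ≉0⇒¬¬boundedAway z z≉0 λ where
    (inj₁ (δ , 0<δ , away)) → w≉0 (divide δ 0<δ (eventually-map (λ n δ≤ → subst (_≤ norm² n) (+-identityʳ (δ * δ))
      (+-mono-≤ (square-mono (seq (Re z) n) (<⇒≤ 0<δ) δ≤) (0≤square (seq (Im z) n)))) away))
    (inj₂ (δ , 0<δ , away)) → w≉0 (divide δ 0<δ (eventually-map (λ n δ≤ → subst (_≤ norm² n) (+-identityˡ (δ * δ))
      (+-mono-≤ (0≤square (seq (Re z) n)) (square-mono (seq (Im z) n) (<⇒≤ 0<δ) δ≤))) away))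
  where
  norm² : ℕ → ℚ
  norm² n = seq (Re z) n * seq (Re z) n + seq (Im z) n * seq (Im z) n
  divide : ∀ δ → 0ℚ < δ → Eventually (λ n → δ * δ ≤ norm² n) → w ≈ 0ℂ
  divide δ 0<δ away = withBound (approx-bounded z)
    where
    0<δ² : 0ℚ < δ * δ
    0<δ² = subst (_< δ * δ) (*-zeroʳ δ) (*-monoʳ-<-pos δ {{positive 0<δ}} 0<δ)
    ⊝0 : ∀ a → a ⊝ 0ᵢ ≡ a
    ⊝0 a = cong₂ _,i_ (+-identityʳ (re a)) (+-identityʳ (im a))
    withBound : Bounded (approx z) → w ≈ 0ℂ
    withBound (B , 0≤B , zB) = vanishing⇒≈ w 0ℂ (vanishing-cancel 0<δ² (vanishing-mono
      (eventually-map (λ n (δ≤ , zB) → subst₂ (λ a b → δ * δ * ‖ a ‖ ≤ B * ‖ b ‖)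
          (sym (⊝0 (approx w n))) (sym (⊝0 (approx (z *ℂ w) n)))
          (conj-cancel (approx z n) (approx w n) (<⇒≤ 0<δ²) δ≤ zB))
        (eventually-× away zB))
      (vanishing-* 0≤B (≈⇒vanishing (z *ℂ w) 0ℂ zw≈0))))

-- The exponential function respects equality

exp-cong : ∀ z w → z ≈ w → exp z ≈ exp w
exp-cong z w z≈w = withBounds (approx-bounded z) (approx-bounded w)
  where
  withBounds : Bounded (approx z) → Bounded (approx w) → exp z ≈ exp w
  withBounds (A , 0≤A , zA) (B , 0≤B , wB) = withM (archimedean ((A + B) + (A + B)))
    where
    C = A + B
    withM : (∃[ M ] C + C ≤ ι M) → exp z ≈ exp w
    -- From order `M` on, all truncated series share the Lipschitz constant `K` on the ball of
    -- radius `C`, which eventually contains the approximations of both arguments.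
    withM (M , 2C≤M) = vanishing⇒≈ (exp z) (exp w) (vanishing-mono
      (eventually-map (λ n (M≤n , zA , wB) → ≤-trans
          (sum-lipschitz (approx z n) (approx w n)
            (≤-trans zA (subst (_≤ C) (+-identityʳ A) (+-monoʳ-≤ A 0≤B)))
            (≤-trans wB (subst (_≤ C) (+-identityˡ B) (+-monoˡ-≤ B 0≤A))) ≤-refl n)
          (*-monoʳ-≤-nonNeg (dist z w n) {{nonNegative (0≤‖‖ (approx z n ⊝ approx w n))}} (SD≤K n M≤n)))
        (eventually-× (M , λ n M≤n → M≤n) (eventually-× zA wB)))
      (vanishing-* 0≤K (≈⇒vanishing z w z≈w)))
      where open Tail (+-nonneg 0≤A 0≤B) M (≤-trans 2C≤M (ι-mono (ℕ.n≤1+n M)))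

-- Products of power series

module Convolution (R : CommutativeSemiring 0ℓ 0ℓ) where

  private
    module R = CommutativeSemiring R
  open R using (Carrier; 0#; 1#) renaming (_≈_ to _≋_; _+_ to _∔_; _*_ to _∙_)
  open import Algebra.Solver.Ring.NaturalCoefficients.Default R
    renaming (solve to solveR; _:=_ to _≔_; _:+_ to _⊞_; _:*_ to _⊠_; con to conR) using ()
  open import Relation.Binary.Reasoning.Setoid R.setoid

  -- The Cauchy product `Σ f i · g (n - i)` over `i ≤ n`, obtained by shifting `f` instead of
  -- subtracting indices.
  conv : (ℕ → Carrier) → (ℕ → Carrier) → ℕ → Carrier
  conv f g zero    = f 0 ∙ g 0
  conv f g (suc n) = f 0 ∙ g (suc n) ∔ conv (f ∘ suc) g n

  conv-cong : ∀ {f f′ g g′} → (∀ n → f n ≋ f′ n) → (∀ n → g n ≋ g′ n) → ∀ n → conv f g n ≋ conv f′ g′ n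
  conv-cong p q zero    = R.*-cong (p 0) (q 0)
  conv-cong p q (suc n) = R.+-cong (R.*-cong (p 0) (q (suc n))) (conv-cong (p ∘ suc) q n)

  conv-+ˡ : ∀ f f′ g n → conv (λ i → f i ∔ f′ i) g n ≋ conv f g n ∔ conv f′ g n
  conv-+ˡ f f′ g zero    = R.distribʳ (g 0) (f 0) (f′ 0)
  conv-+ˡ f f′ g (suc n) = R.trans (R.+-congˡ (conv-+ˡ (f ∘ suc) (f′ ∘ suc) g n))
    (solveR 5 (λ a b c d e → (a ⊞ b) ⊠ c ⊞ (d ⊞ e) ≔ (a ⊠ c ⊞ d) ⊞ (b ⊠ c ⊞ e)) R.refl
      (f 0) (f′ 0) (g (suc n)) (conv (f ∘ suc) g n) (conv (f′ ∘ suc) g n))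

  conv-+ʳ : ∀ f g g′ n → conv f (λ i → g i ∔ g′ i) n ≋ conv f g n ∔ conv f g′ n
  conv-+ʳ f g g′ zero    = R.distribˡ (f 0) (g 0) (g′ 0)
  conv-+ʳ f g g′ (suc n) = R.trans (R.+-congˡ (conv-+ʳ (f ∘ suc) g g′ n))
    (solveR 5 (λ c a b d e → c ⊠ (a ⊞ b) ⊞ (d ⊞ e) ≔ (c ⊠ a ⊞ d) ⊞ (c ⊠ b ⊞ e)) R.refl
      (f 0) (g (suc n)) (g′ (suc n)) (conv (f ∘ suc) g n) (conv (f ∘ suc) g′ n))

  conv-*ˡ : ∀ f g a n → conv (λ i → f i ∙ a) g n ≋ conv f g n ∙ a
  conv-*ˡ f g a zero    = solveR 3 (λ a b c → a ⊠ b ⊠ c ≔ a ⊠ c ⊠ b) R.refl (f 0) a (g 0)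
  conv-*ˡ f g a (suc n) = R.trans (R.+-congˡ (conv-*ˡ (f ∘ suc) g a n))
    (solveR 4 (λ a b c d → a ⊠ b ⊠ c ⊞ d ⊠ b ≔ (a ⊠ c ⊞ d) ⊠ b) R.refl (f 0) a (g (suc n)) (conv (f ∘ suc) g n))

  conv-*ʳ : ∀ f g a n → conv f (λ i → g i ∙ a) n ≋ conv f g n ∙ a
  conv-*ʳ f g a zero    = R.sym (R.*-assoc (f 0) (g 0) a)
  conv-*ʳ f g a (suc n) = R.trans (R.+-congˡ (conv-*ʳ (f ∘ suc) g a n))
    (solveR 4 (λ a b c d → a ⊠ (c ⊠ b) ⊞ d ⊠ b ≔ (a ⊠ c ⊞ d) ⊠ b) R.refl (f 0) a (g (suc n)) (conv (f ∘ suc) g n))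

  conv-shiftʳ : ∀ f g → g 0 ≋ 0# → ∀ n → conv f g (suc n) ≋ conv f (g ∘ suc) n
  conv-shiftʳ f g g0 zero    = R.trans (R.+-congˡ (R.trans (R.*-congˡ g0) (R.zeroʳ (f 1)))) (R.+-identityʳ _)
  conv-shiftʳ f g g0 (suc n) = R.+-congˡ (conv-shiftʳ (f ∘ suc) g g0 n)

  times : ℕ → Carrier
  times zero    = 0#
  times (suc n) = 1# ∔ times n

  -- Because `i + (n - i) = n`, multiplying each coefficient by its index obeys the product rule; on
  -- power series this is the operator `x d/dx`.
  conv-derivation : ∀ f g n →
    conv (λ i → times i ∙ f i) g n ∔ conv f (λ i → times i ∙ g i) n ≋ times n ∙ conv f g n
  conv-derivation f g zero    = solveR 2 (λ a b → conR 0 ⊠ a ⊠ b ⊞ a ⊠ (conR 0 ⊠ b) ≔ conR 0 ⊠ (a ⊠ b)) R.refl (f 0) (g 0)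
  conv-derivation f g (suc n) = begin
    (0# ∙ f 0 ∙ g (suc n) ∔ conv (λ i → times (suc i) ∙ f′ i) g n) ∔ (f 0 ∙ (times (suc n) ∙ g (suc n)) ∔ Y)
      ≈⟨ R.+-congʳ (R.+-congˡ (R.trans
           (conv-cong (λ i → solveR 2 (λ a b → (conR 1 ⊞ a) ⊠ b ≔ b ⊞ a ⊠ b) R.refl (times i) (f′ i)) (λ _ → R.refl) n)
           (conv-+ˡ f′ (λ i → times i ∙ f′ i) g n))) ⟩
    (0# ∙ f 0 ∙ g (suc n) ∔ (Z ∔ X)) ∔ (f 0 ∙ (times (suc n) ∙ g (suc n)) ∔ Y)
      ≈⟨ solveR 6 (λ a b t x y z → (conR 0 ⊠ a ⊠ b ⊞ (z ⊞ x)) ⊞ (a ⊠ (t ⊠ b) ⊞ y)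
                                 ≔ t ⊠ (a ⊠ b) ⊞ (z ⊞ (x ⊞ y)))
           R.refl (f 0) (g (suc n)) (times (suc n)) X Y Z ⟩
    times (suc n) ∙ (f 0 ∙ g (suc n)) ∔ (Z ∔ (X ∔ Y))
      ≈⟨ R.+-congˡ (R.+-congˡ (conv-derivation f′ g n)) ⟩
    times (suc n) ∙ (f 0 ∙ g (suc n)) ∔ (Z ∔ times n ∙ Z)
      ≈⟨ solveR 3 (λ p t z → (conR 1 ⊞ t) ⊠ p ⊞ (z ⊞ t ⊠ z) ≔ (conR 1 ⊞ t) ⊠ (p ⊞ z)) R.refl
           (f 0 ∙ g (suc n)) (times n) Z ⟩
    times (suc n) ∙ (f 0 ∙ g (suc n) ∔ Z) ∎
    where
    f′ = f ∘ suc
    X = conv (λ i → times i ∙ f′ i) g n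
    Y = conv f′ (λ i → times i ∙ g i) n
    Z = conv f′ g n

  -- The sequence aⁿ / n!
  IsExpTerms : Carrier → (ℕ → Carrier) → Set
  IsExpTerms a t = t 0 ≋ 1# × ∀ n → times (suc n) ∙ t (suc n) ≋ t n ∙ a

  -- The product rule replaces binomial coefficients: the series of `exp (a x)` and `exp (b x)` have
  -- logarithmic derivatives `a` and `b`, which add up for the product.
  conv-isExpTerms : ∀ {a b t u} → IsExpTerms a t → IsExpTerms b u → IsExpTerms (a ∔ b) (conv t u)
  conv-isExpTerms {a} {b} {t} {u} (t0 , tₛ) (u0 , uₛ) =
    R.trans (R.*-cong t0 u0) (R.*-identityˡ 1#) , λ n → begin
      times (suc n) ∙ conv t u (suc n)
        ≈⟨ R.sym (conv-derivation t u (suc n)) ⟩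
      (0# ∙ t 0 ∙ u (suc n) ∔ conv (λ i → times (suc i) ∙ t (suc i)) u n) ∔ conv t (λ i → times i ∙ u i) (suc n)
        ≈⟨ R.+-cong
             (R.+-cong (R.trans (R.*-congʳ (R.zeroˡ (t 0))) (R.zeroˡ (u (suc n))))
               (R.trans (conv-cong tₛ (λ _ → R.refl) n) (conv-*ˡ t u a n)))
             (R.trans (conv-shiftʳ t (λ i → times i ∙ u i) (R.zeroˡ (u 0)) n)
               (R.trans (conv-cong (λ _ → R.refl) uₛ n) (conv-*ʳ t u b n))) ⟩
      (0# ∔ conv t u n ∙ a) ∔ conv t u n ∙ b
        ≈⟨ solveR 3 (λ a b c → (conR 0 ⊞ c ⊠ a) ⊞ c ⊠ b ≔ c ⊠ (a ⊞ b)) R.refl a b (conv t u n) ⟩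
      conv t u n ∙ (a ∔ b) ∎

  module _ (inverse : ℕ → Carrier) (inverse-times : ∀ n → inverse n ∙ times (suc n) ≋ 1#) where

    isExpTerms-unique : ∀ {a t u} → IsExpTerms a t → IsExpTerms a u → ∀ n → t n ≋ u n
    isExpTerms-unique (t0 , tₛ) (u0 , uₛ) zero = R.trans t0 (R.sym u0)
    isExpTerms-unique {a} {t} {u} p@(_ , tₛ) q@(_ , uₛ) (suc n) = begin
      t (suc n)                                   ≈⟨ divide (t (suc n)) ⟩
      inverse n ∙ (times (suc n) ∙ t (suc n))     ≈⟨ R.*-congˡ (R.trans (tₛ n)
                                                       (R.trans (R.*-congʳ (isExpTerms-unique p q n)) (R.sym (uₛ n)))) ⟩
      inverse n ∙ (times (suc n) ∙ u (suc n))     ≈⟨ R.sym (divide (u (suc n))) ⟩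
      u (suc n)                                   ∎
      where
      divide : ∀ x → x ≋ inverse n ∙ (times (suc n) ∙ x)
      divide x = R.trans (R.sym (R.*-identityˡ x))
        (R.trans (R.*-congʳ (R.sym (inverse-times n))) (R.*-assoc (inverse n) (times (suc n)) x))

  sums : (ℕ → Carrier) → ℕ → Carrier
  sums f zero    = f 0
  sums f (suc n) = sums f n ∔ f (suc n)

  sums-front : ∀ f n → sums f (suc n) ≋ f 0 ∔ sums (f ∘ suc) n
  sums-front f zero    = R.refl
  sums-front f (suc n) = R.trans (R.+-congʳ (sums-front f n)) (R.+-assoc (f 0) (sums (f ∘ suc) n) (f (suc (suc n))))

  conv-const : ∀ f a n → conv f (λ _ → a) n ≋ sums f n ∙ a
  conv-const f a zero    = R.refl
  conv-const f a (suc n) = R.trans (R.+-congˡ (conv-const (f ∘ suc) a n))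
    (R.trans (R.sym (R.distribʳ a (f 0) (sums (f ∘ suc) n))) (R.*-congʳ (R.sym (sums-front f n))))

  -- Taking partial sums is multiplication by `1 / (1 - x)`, which commutes with products. In the
  -- proof, `sums g` is `g` plus its own shift.
  conv-sums : ∀ f g n → conv f (sums g) n ≋ sums (conv f g) n
  conv-sums f g zero    = R.refl
  conv-sums f g (suc n) = begin
    conv f (sums g) (suc n)                         ≈⟨ conv-cong {f} {f} (λ _ → R.refl) split (suc n) ⟩
    conv f (λ i → previous i ∔ g i) (suc n)         ≈⟨ conv-+ʳ f previous g (suc n) ⟩
    conv f previous (suc n) ∔ conv f g (suc n)      ≈⟨ R.+-congʳ (conv-shiftʳ f previous R.refl n) ⟩
    conv f (sums g) n ∔ conv f g (suc n)            ≈⟨ R.+-congʳ (conv-sums f g n) ⟩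
    sums (conv f g) (suc n)                         ∎
    where
    previous : ℕ → Carrier
    previous zero    = 0#
    previous (suc n) = sums g n
    split : ∀ i → sums g i ≋ previous i ∔ g i
    split zero    = R.sym (R.+-identityˡ (g 0))
    split (suc i) = R.refl

-- Exponential terms over ℚ and ℚ[i]

module Qconv = Convolution (CommutativeRing.commutativeSemiring +-*-commutativeRing)
module Qᵢconv = Convolution (CommutativeRing.commutativeSemiring ℚ[i]-commutativeRing)

times≡ι : ∀ n → Qconv.times n ≡ ι n
times≡ι zero    = refl
times≡ι (suc n) = cong (1ℚ +_) (times≡ι n)

timesᵢ≡ι : ∀ n → Qᵢconv.times n ≡ ι n ,i 0ℚ
timesᵢ≡ι zero    = refl
timesᵢ≡ι (suc n) = cong (1ᵢ ⊕_) (timesᵢ≡ι n)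

real-⊛ : ∀ p w → (p ,i 0ℚ) ⊛ w ≡ p · w
real-⊛ p w = cong₂ _,i_
  (solve 3 (λ p a b → p :* a :- con 0ℚ :* b := p :* a) refl p (re w) (im w))
  (solve 3 (λ p a b → p :* b :+ con 0ℚ :* a := p :* b) refl p (re w) (im w))

ι-cancel : ∀ k x → ι (suc k) * (inv k * x) ≡ x
ι-cancel k x = trans (solve 3 (λ i v x → i :* (v :* x) := v :* (i :* x)) refl (ι (suc k)) (inv k) x) (inv-cancel k x)

τ-isExpTerms : ∀ B → Qconv.IsExpTerms B (τ B)
τ-isExpTerms B = refl , λ n → trans (cong (_* τ B (suc n)) (times≡ι (suc n))) (ι-cancel n (τ B n * B))

expTerm-isExpTerms : ∀ z → Qᵢconv.IsExpTerms z (λ k → expTerm k z)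
expTerm-isExpTerms z = refl , λ n → trans (cong (_⊛ expTerm (suc n) z) (timesᵢ≡ι (suc n)))
  (trans (real-⊛ (ι (suc n)) (expTerm (suc n) z))
    (cong₂ _,i_ (ι-cancel n (re (expTerm n z ⊛ z))) (ι-cancel n (im (expTerm n z ⊛ z)))))

-- The binomial theorem: both sides satisfy the recursion of `IsExpTerms` for `A + B`, which has
-- only one solution.
τ-binomial : ∀ A B n → Qconv.conv (τ A) (τ B) n ≡ τ (A + B) n
τ-binomial A B = Qconv.isExpTerms-unique inv (λ n → trans (cong (inv n *_) (times≡ι (suc n))) (inv-ι n))
  (Qconv.conv-isExpTerms (τ-isExpTerms A) (τ-isExpTerms B)) (τ-isExpTerms (A + B))

expTerm-binomial : ∀ a b n → Qᵢconv.conv (λ k → expTerm k a) (λ k → expTerm k b) n ≡ expTerm n (a ⊕ b)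
expTerm-binomial a b = Qᵢconv.isExpTerms-unique (λ n → inv n ,i 0ℚ)
  (λ n → trans (real-⊛ (inv n) (Qᵢconv.times (suc n))) (trans (cong (inv n ·_) (timesᵢ≡ι (suc n)))
    (cong₂ _,i_ (inv-ι n) (*-zeroʳ (inv n)))))
  (Qᵢconv.conv-isExpTerms (expTerm-isExpTerms a) (expTerm-isExpTerms b)) (expTerm-isExpTerms (a ⊕ b))

expSum≡sums : ∀ z n → expSum n z ≡ Qᵢconv.sums (λ k → expTerm k z) n
expSum≡sums z zero    = refl
expSum≡sums z (suc n) = cong (_⊕ expTerm (suc n) z) (expSum≡sums z n)

sums-cong : ∀ {f g} → (∀ n → f n ≡ g n) → ∀ n → Qᵢconv.sums f n ≡ Qᵢconv.sums g n
sums-cong p zero    = p 0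
sums-cong p (suc n) = cong₂ _⊕_ (sums-cong p n) (p (suc n))

expSum-⊕ : ∀ a b n → Qᵢconv.conv (λ k → expTerm k a) (λ k → expSum k b) n ≡ expSum n (a ⊕ b)
expSum-⊕ a b n = trans (Qᵢconv.conv-cong {λ k → expTerm k a} (λ _ → refl) (expSum≡sums b) n)
  (trans (Qᵢconv.conv-sums (λ k → expTerm k a) (λ k → expTerm k b) n)
    (trans (sums-cong (expTerm-binomial a b) n) (sym (expSum≡sums (a ⊕ b) n))))

‖conv‖-≤ : ∀ {f g φ γ} n → (∀ i → ‖ f i ‖ ≤ φ i) → (∀ j → j ℕ.≤ n → ‖ g j ‖ ≤ γ j) →
           ‖ Qᵢconv.conv f g n ‖ ≤ Qconv.conv φ γ n
‖conv‖-≤ {f} {g} zero    fφ gγ = ‖⊛‖-≤ (f 0) (g 0) (fφ 0) (gγ 0 ℕ.≤-refl)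
‖conv‖-≤ {f} {g} (suc n) fφ gγ = ‖⊕‖-≤ (f 0 ⊛ g (suc n)) (Qᵢconv.conv (f ∘ suc) g n)
  (‖⊛‖-≤ (f 0) (g (suc n)) (fφ 0) (gγ (suc n) ℕ.≤-refl))
  (‖conv‖-≤ n (fφ ∘ suc) (λ j j≤n → gγ j (ℕ.m≤n⇒m≤1+n j≤n)))

inv-antitone : ∀ {m n} → m ℕ.≤ n → inv n ≤ inv m
inv-antitone {m} {n} m≤n = subst₂ _≤_
  (trans (solve 3 (λ a b c → a :* (b :* c) := b :* (c :* a)) refl (inv n) (inv m) (ι (suc m))) (inv-cancel m (inv n)))
  (trans (solve 3 (λ a b c → a :* (b :* c) := a :* (c :* b)) refl (inv n) (inv m) (ι (suc n)))
    (inv-cancel n (inv m)))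
  (*-monoˡ-≤-nonNeg (inv n) {{nonNegative (0≤inv n)}}
    (*-monoˡ-≤-nonNeg (inv m) {{nonNegative (0≤inv m)}} (ι-mono (ℕ.s≤s m≤n))))

-- Multiplicativity of the exponential function

module _ {B : ℚ} (0≤B : 0ℚ ≤ B) where

  -- Each step uses `1 / (d + j + 1) ≤ 1 / (d + 1)`; together these amount to `d! j! ≤ (d + j)!`.
  τ-submultiplicative : ∀ d j → τ B (d ℕ.+ j) ≤ τ B d * τ B j
  τ-submultiplicative zero    j = ≤-reflexive (sym (*-identityˡ (τ B j)))
  τ-submultiplicative (suc d) j = ≤-trans
    (*-mono (0≤inv (d ℕ.+ j)) (inv-antitone (ℕ.m≤m+n d j))
      (*-nonneg (0≤τ 0≤B (d ℕ.+ j)) 0≤B)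
      (*-monoʳ-≤-nonNeg B {{nonNegative 0≤B}} (τ-submultiplicative d j)))
    (≤-reflexive (solve 4 (λ v s t b → v :* (s :* t :* b) := v :* (s :* b) :* t) refl (inv d) (τ B d) (τ B j) B))

  -- The bound keeps the factor `τ B j` so that its convolution with `τ B` becomes `τ (B + B)` by
  -- the binomial theorem.
  expSum-tail : ∀ b → ‖ b ‖ ≤ B → ∀ d j → ‖ expSum (d ℕ.+ j) b ⊝ expSum j b ‖ ≤ Sτ B d * τ B j
  expSum-tail b bB zero    j = subst (_≤ 1ℚ * τ B j) (sym (‖⊝‖-self (expSum j b))) (*-nonneg (<⇒≤ 0<1) (0≤τ 0≤B j))
  expSum-tail b bB (suc d) j = subst₂ (λ x y → ‖ x ‖ ≤ y)
    (cong₂ _,i_ (eq (re (expSum n b)) (re (expSum j b)) (re t)) (eq (im (expSum n b)) (im (expSum j b)) (im t)))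
    (sym (*-distribʳ-+ (τ B j) (Sτ B d) (τ B (suc d))))
    (‖⊕‖-≤ (expSum n b ⊝ expSum j b) t (expSum-tail b bB d j)
      (≤-trans (term-bound b bB (suc n)) (τ-submultiplicative (suc d) j)))
    where
    n = d ℕ.+ j
    t = expTerm (suc n) b
    eq : ∀ x y z → (x - y) + z ≡ (x + z) - y
    eq = solve 3 (λ x y z → (x :- y) :+ z := (x :+ z) :- y) refl

  module _ {K : ℚ} (Sτ≤K : ∀ n → Sτ B n ≤ K) where

    -- Write `Sₙ` for the truncated series. Then `Sₙ(a) Sₙ(b) - Sₙ(a + b)` is the sum of
    -- `aⁱ / i! (Sₙ(b) - Sₙ₋ᵢ(b))` over `i ≤ n`. The tails are at most `K τ B (n - i)`, and summing
    -- against `τ B i` gives `K τ (B + B) n`, which tends to 0.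
    expSum-*-≤ : ∀ a b → ‖ a ‖ ≤ B → ‖ b ‖ ≤ B → ∀ n →
                 ‖ expSum n (a ⊕ b) ⊝ (expSum n a ⊛ expSum n b) ‖ ≤ K * τ (B + B) n
    expSum-*-≤ a b aB bB n = subst₂ _≤_ (trans (cong ‖_‖ defect) (‖⊝‖-sym P Q)) majorant
      (‖conv‖-≤ {γ = λ j → τ B j * K} n (term-bound a aB) λ j j≤n → ≤-trans
        (subst (λ m → ‖ expSum m b ⊝ expSum j b ‖ ≤ Sτ B (n ℕ.∸ j) * τ B j) (ℕ.m∸n+n≡m j≤n) (expSum-tail b bB (n ℕ.∸ j) j))
        (≤-trans (*-monoʳ-≤-nonNeg (τ B j) {{nonNegative (0≤τ 0≤B j)}} (Sτ≤K (n ℕ.∸ j)))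
          (≤-reflexive (*-comm K (τ B j)))))
      where
      t = λ k → expTerm k a
      P = expSum n a ⊛ expSum n b
      Q = expSum n (a ⊕ b)
      difference : ℕ → ℚ[i]
      difference j = expSum n b ⊝ expSum j b
      ‖⊝‖-sym : ∀ x y → ‖ x ⊝ y ‖ ≡ ‖ y ⊝ x ‖
      ‖⊝‖-sym x y = cong₂ _+_ (∣-∣-sym (re x) (re y)) (∣-∣-sym (im x) (im y))
      restore : ∀ x y → (x ⊝ y) ⊕ y ≡ x
      restore x y = cong₂ _,i_ (eq (re x) (re y)) (eq (im x) (im y))
        where
        eq : ∀ x y → (x - y) + y ≡ x
        eq = solve 2 (λ x y → (x :- y) :+ y := x) refl
      defect : Qᵢconv.conv t difference n ≡ P ⊝ Q
      defect = trans (cong₂ _,i_ (eq (re C) (re Q)) (eq (im C) (im Q))) (cong (_⊝ Q) C⊕Q≡P)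
        where
        C = Qᵢconv.conv t difference n
        eq : ∀ x y → x ≡ (x + y) - y
        eq = solve 2 (λ x y → x := (x :+ y) :- y) refl
        C⊕Q≡P : C ⊕ Q ≡ P
        C⊕Q≡P = trans (cong (C ⊕_) (sym (expSum-⊕ a b n)))
          (trans (sym (Qᵢconv.conv-+ʳ t difference (λ k → expSum k b) n))
          (trans (Qᵢconv.conv-cong {t} (λ _ → refl) (λ j → restore (expSum n b) (expSum j b)) n)
          (trans (Qᵢconv.conv-const t (expSum n b) n) (cong (_⊛ expSum n b) (sym (expSum≡sums a n))))))
      majorant : Qconv.conv (τ B) (λ j → τ B j * K) n ≡ K * τ (B + B) n
      majorant = trans (Qconv.conv-*ʳ (τ B) (τ B) K n) (trans (cong (_* K) (τ-binomial B B n)) (*-comm (τ (B + B) n) K))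

exp-+ : ∀ z w → exp (z +ℂ w) ≈ exp z *ℂ exp w
exp-+ z w = withBounds (approx-bounded z) (approx-bounded w)
  where
  withBounds : Bounded (approx z) → Bounded (approx w) → exp (z +ℂ w) ≈ exp z *ℂ exp w
  withBounds (A , 0≤A , zA) (B , 0≤B , wB) = withM (archimedean (C + C)) (archimedean ((C + C) + (C + C)))
    where
    C = A + B
    0≤C = +-nonneg 0≤A 0≤B
    withM : (∃[ M ] C + C ≤ ι M) → (∃[ M ] (C + C) + (C + C) ≤ ι M) → exp (z +ℂ w) ≈ exp z *ℂ exp w
    withM (M , 2C≤M) (M′ , 4C≤M′) = vanishing⇒≈ (exp (z +ℂ w)) (exp z *ℂ exp w) (vanishing-mono
      (eventually-map (λ n (zA , wB) → expSum-*-≤ 0≤C Sτ≤ (approx z n) (approx w n)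
          (≤-trans zA (subst (_≤ C) (+-identityʳ A) (+-monoʳ-≤ A 0≤B)))
          (≤-trans wB (subst (_≤ C) (+-identityˡ B) (+-monoˡ-≤ B 0≤A))) n)
        (eventually-× zA wB))
      (vanishing-* T.0≤K λ ε 0<ε → T′.τ-vanish 0<ε))
      where
      module T = Tail 0≤C M (≤-trans 2C≤M (ι-mono (ℕ.n≤1+n M)))
      module T′ = Tail (+-nonneg 0≤C 0≤C) M′ (≤-trans 4C≤M′ (ι-mono (ℕ.n≤1+n M′)))
      Sτ-mono : ∀ n j → Sτ C n ≤ Sτ C (j ℕ.+ n)
      Sτ-mono n zero    = ≤-refl
      Sτ-mono n (suc j) = subst (_≤ Sτ C (suc j ℕ.+ n)) (+-identityʳ (Sτ C n))
        (+-mono-≤ (Sτ-mono n j) (0≤τ 0≤C (suc (j ℕ.+ n))))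
      -- The bound of `T` starts at order `M`; as `Sτ C` increases, it holds for all orders.
      Sτ≤ : ∀ n → Sτ C n ≤ T.K
      Sτ≤ n = ≤-trans (Sτ-mono n M) (≤-trans
        (subst (_≤ Sτ C (M ℕ.+ n) + τ C (M ℕ.+ n)) (+-identityʳ (Sτ C (M ℕ.+ n)))
          (+-monoʳ-≤ (Sτ C (M ℕ.+ n)) (0≤τ 0≤C (M ℕ.+ n))))
        (T.Sτ≤K (M ℕ.+ n) (ℕ.m≤m+n M n)))

exp-0 : exp 0ℂ ≈ 1ℂ
exp-0 = pointwise (exp 0ℂ) 1ℂ sum
  where
  sum : ∀ n → expSum n 0ᵢ ≡ 1ᵢ
  sum zero    = refl
  sum (suc n) = cong₂ _⊕_ (sum n) (trans (cong (inv n ·_) (Qᵢ.zeroʳ (expTerm n 0ᵢ))) (cong₂ _,i_ (*-zeroʳ (inv n)) (*-zeroʳ (inv n))))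

1≉0 : 1ℂ ≉ 0ℂ
1≉0 (eq , _) = boundedAway⇒¬vanishing {λ _ → 1ℚ - 0ℚ} (1ℚ , 0<1 , always λ _ → ≤-refl) eq

-- The value of the exponential function at iπ

iℂ : ℂ
iℂ = fromℚᴿ 0ℚ +i fromℚᴿ 1ℚ

expTerm-conj : ∀ k x → expTerm k (0ℚ ,i (- x)) ≡ conj (expTerm k (0ℚ ,i x))
expTerm-conj zero    x = refl
expTerm-conj (suc k) x = trans (cong (λ t → inv k · (t ⊛ (0ℚ ,i (- x)))) (expTerm-conj k x)) (cong₂ _,i_
  (solve 4 (λ v a b x → v :* (a :* con 0ℚ :- :- b :* :- x) := v :* (a :* con 0ℚ :- b :* x)) refl (inv k) (re t) (im t) x)
  (solve 4 (λ v a b x → v :* (a :* :- x :+ :- b :* con 0ℚ) := :- (v :* (a :* x :+ b :* con 0ℚ))) refl (inv k) (re t) (im t) x))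
  where t = expTerm k (0ℚ ,i x)

expSum-conj : ∀ n x → expSum n (0ℚ ,i (- x)) ≡ conj (expSum n (0ℚ ,i x))
expSum-conj zero    x = refl
expSum-conj (suc n) x = trans (cong₂ _⊕_ (expSum-conj n x) (expTerm-conj (suc n) x))
  (cong (λ b → re (expSum (suc n) (0ℚ ,i x)) ,i b) (sym (neg-distrib-+ (im (expSum n (0ℚ ,i x))) (im (expTerm (suc n) (0ℚ ,i x))))))

iπ iπ/6 : ℂ
iπ   = fromℚᴿ 0ℚ +i π
iπ/6 = fromℚᴿ 0ℚ +i π/6

-- On the imaginary axis, negating the argument conjugates the value, so the two values differ by
-- `2 i sin (π/6)`, which is `i` by `sin-π/6`.
exp-π/6 : exp iπ/6 ≈ exp (-ℂ iπ/6) +ℂ iℂ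
exp-π/6 =
  vanishing-0 (λ n → trans (cong (λ s → ∣ re (expSum n (approx iπ/6 n)) - (re s + 0ℚ) ∣) (expSum-conj n (seq π/6 n)))
    (cong ∣_∣ (solve 1 (λ a → a :- (a :+ con 0ℚ) := con 0ℚ) refl (re (expSum n (approx iπ/6 n)))))) ,
  vanishing-mono (always λ n → subst (_≤ ∣ s n - ½ ∣ + ∣ s n - ½ ∣)
      (cong ∣_∣ (trans (solve 1 (λ a → (a :- con ½) :+ (a :- con ½) := a :- (:- a :+ con 1ℚ)) refl (s n))
        (cong (λ b → s n - (im b + 1ℚ)) (sym (expSum-conj n (seq π/6 n))))))
      (∣p+q∣≤∣p∣+∣q∣ (s n - ½) (s n - ½)))
    (vanishing-+ sin-π/6 sin-π/6)
  where
  s : ℕ → ℚ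
  s n = im (expSum n (approx iπ/6 n))

-- Opaque copies of the structure of ℂ keep the conversion checker from
-- unfolding complex numbers into Cauchy sequences.
opaque

  infix 4 _≋_

  _≋_ : ℂ → ℂ → Set
  _≋_ = _≈_

  plus mult : ℂ → ℂ → ℂ
  plus = _+ℂ_
  mult = _*ℂ_

  minus Exp : ℂ → ℂ
  minus = -ℂ_
  Exp   = exp

  ≈⇒≋ : ∀ x y → x ≈ y → x ≋ y
  ≈⇒≋ x y eq = eq

  ≋⇒≈ : ∀ {x y} → x ≋ y → x ≈ y
  ≋⇒≈ eq = eq

  plus≡ : ∀ x y → plus x y ≡ x +ℂ y
  plus≡ x y = refl

  mult≡ : ∀ x y → mult x y ≡ x *ℂ y
  mult≡ x y = refl

  minus≡ : ∀ x → minus x ≡ -ℂ x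
  minus≡ x = refl

  Exp≡exp : Exp ≡ exp
  Exp≡exp = refl

  Exp≡ : ∀ x → Exp x ≡ exp x
  Exp≡ x = refl

  sum-mult≡Σ : ∀ {n} (q : Vector ℚ n) (z : Vector ℂ n) →
    foldrᵛ plus 0ℂ (λ i → mult (fromℚ (q i)) (z i)) ≡ Σ[ (λ i → fromℚ (q i) *ℂ z i) ]
  sum-mult≡Σ q z = refl

  opaque-isCommutativeRing : IsCommutativeRing _≋_ plus mult minus 0ℂ 1ℂ
  opaque-isCommutativeRing = CommutativeRing.isCommutativeRing ℂ-commutativeRing

  fromℚ-plus : ∀ p q → fromℚ (p + q) ≋ plus (fromℚ p) (fromℚ q)
  fromℚ-plus p q = pointwise (fromℚ (p + q)) (fromℚ p +ℂ fromℚ q) λ _ → refl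

  fromℚ-mult : ∀ p q → fromℚ (p * q) ≋ mult (fromℚ p) (fromℚ q)
  fromℚ-mult p q = pointwise (fromℚ (p * q)) (fromℚ p *ℂ fromℚ q) λ _ → cong₂ _,i_
    (solve 2 (λ p q → p :* q := p :* q :- con 0ℚ :* con 0ℚ) refl p q)
    (solve 2 (λ p q → con 0ℚ := p :* con 0ℚ :+ con 0ℚ :* q) refl p q)

  fromℚ-minus : ∀ p → fromℚ (- p) ≋ minus (fromℚ p)
  fromℚ-minus p = pointwise (fromℚ (- p)) (-ℂ fromℚ p) λ _ → refl

  ≋-stable : ∀ x y → ¬ ¬ (x ≋ y) → x ≋ y
  ≋-stable = ≈-stable

  mult-cancel-0 : ∀ x y → ¬ (x ≋ 0ℂ) → mult x y ≋ 0ℂ → y ≋ 0ℂ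
  mult-cancel-0 = *ℂ-cancel-0

  Exp-cong : ∀ x y → x ≋ y → Exp x ≋ Exp y
  Exp-cong = exp-cong

  Exp-plus : ∀ x y → Exp (plus x y) ≋ mult (Exp x) (Exp y)
  Exp-plus = exp-+

  Exp-0 : Exp 0ℂ ≋ 1ℂ
  Exp-0 = exp-0

  i²≋-1 : mult iℂ iℂ ≋ minus 1ℂ
  i²≋-1 = pointwise (iℂ *ℂ iℂ) (-ℂ 1ℂ) λ _ → refl

-- ℂ as an instance of the abstract argument

ℂ-opaque : CommutativeRing 0ℓ 0ℓ
ℂ-opaque = record { isCommutativeRing = opaque-isCommutativeRing }

fromℚ-embedding : +-*-rawRing -Raw-AlmostCommutative⟶ fromCommutativeRing ℂ-opaque
fromℚ-embedding = record
  { ⟦_⟧    = fromℚ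
  ; +-homo = fromℚ-plus
  ; *-homo = fromℚ-mult
  ; -‿homo = fromℚ-minus
  ; 0-homo = ≈⇒≋ 0ℂ 0ℂ (≈-refl 0ℂ)
  ; 1-homo = ≈⇒≋ 1ℂ 1ℂ (≈-refl 1ℂ)
  }

open AlgebraicDependence ℂ-opaque fromℚ-embedding ≋-stable mult-cancel-0 (1≉0 ∘ ≋⇒≈)
open Exponential Exp Exp-cong Exp-plus Exp-0

-- Stated for variables `z` and `w`, so that the passage between opaque and plain operations is made
-- before π enters.
exp-sixth : ∀ z w → w ≈ (z +ℂ (z +ℂ z)) +ℂ (z +ℂ (z +ℂ z)) → exp z ≈ exp (-ℂ z) +ℂ iℂ → Exp w ≋ minus 1ℂ
exp-sixth z w w≈ exp-z≈ = CommutativeRing.trans ℂ-opaque (Exp-cong w 6z w≋6z) (E-sixth z i²≋-1 Exp-z≋)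
  where
  6z : ℂ
  6z = plus (plus z (plus z z)) (plus z (plus z z))
  w≋6z : w ≋ 6z
  w≋6z = subst (λ t → w ≋ plus (plus z t) (plus z t)) (sym (plus≡ z z))
    (subst (λ t → w ≋ plus t t) (sym (plus≡ z (z +ℂ z)))
      (subst (w ≋_) (sym (plus≡ (z +ℂ (z +ℂ z)) (z +ℂ (z +ℂ z))))
        (≈⇒≋ w ((z +ℂ (z +ℂ z)) +ℂ (z +ℂ (z +ℂ z))) w≈)))
  Exp-z≋ : Exp z ≋ plus (Exp (minus z)) iℂ
  Exp-z≋ = subst₂ (λ a y → a ≋ plus (Exp y) iℂ) (sym (Exp≡ z)) (sym (minus≡ z))
    (subst (λ b → exp z ≋ plus b iℂ) (sym (Exp≡ (-ℂ z)))
      (subst (exp z ≋_) (sym (plus≡ (exp (-ℂ z)) iℂ)) (≈⇒≋ (exp z) (exp (-ℂ z) +ℂ iℂ) exp-z≈)))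

exp-iπ : Exp iπ ≋ minus 1ℂ
exp-iπ = exp-sixth iπ/6 iπ
  (pointwise iπ ((iπ/6 +ℂ (iπ/6 +ℂ iπ/6)) +ℂ (iπ/6 +ℂ (iπ/6 +ℂ iπ/6))) λ n → cong (0ℚ ,i_)
    (solve 1 (λ x → con (ℤ.+ 6 / 1) :* x := (x :+ (x :+ x)) :+ (x :+ (x :+ x))) refl (seq π/6 n)))
  exp-π/6

evaluatePolynomial≡evaluate : ∀ n p w → evaluatePolynomial n p w ≡ evaluate n p w
evaluatePolynomial≡evaluate zero    q w = refl
evaluatePolynomial≡evaluate (suc n) p w = foldr-cong
  (λ c v → trans (plus≡ (evaluatePolynomial n c (w ∘ suc)) (mult (w zero) v))
    (cong₂ _+ℂ_ (evaluatePolynomial≡evaluate n c (w ∘ suc)) (mult≡ (w zero) v))) refl p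

evaluateᴿ≡evaluate₁ : ∀ p x → evaluateᴿ p x ≡ evaluate₁ p x
evaluateᴿ≡evaluate₁ p x = foldr-cong (λ c v → trans (plus≡ c (mult x v)) (cong (c +ℂ_) (mult≡ x v))) refl p

combination≡Σ : ∀ {n} (q : Vector ℚ n) (z : Vector ℂ n) → combination q z ≡ Σ[ (λ i → fromℚ (q i) *ℂ z i) ]
combination≡Σ = sum-mult≡Σ

-- Reachability of the algebraically based numbers, and the conclusions

module _ (schanuel : SchanuelConjecture) where

  opaque-schanuel : ∀ n (z : Vector ℂ n) → Independent z →
    ¬ ¬ (∃[ f ] ∀ p → evaluatePolynomial n p ((z ++ (Exp ∘ z)) ∘ f) ≋ 0ℂ → IsZero n p)
  opaque-schanuel n z independent k = schanuel n z
    (λ q eq → independent q (subst (_≋ 0ℂ) (sym (combination≡Σ q z)) (≈⇒≋ Σ[ (λ i → fromℚ (q i) *ℂ z i) ] 0ℂ eq)))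
    λ (f , _ , algIndep) → k (f , λ p eq → algIndep p (≋⇒≈
      (subst (λ E → evaluate n p ((z ++ (E ∘ z)) ∘ f) ≋ 0ℂ) Exp≡exp
        (subst (_≋ 0ℂ) (evaluatePolynomial≡evaluate n p ((z ++ (Exp ∘ z)) ∘ f)) eq))))

  open Tower iπ exp-iπ opaque-schanuel

  generated-reachable : ∀ {S} → (∀ {x} → S x → Reachable x) → ∀ {x} → Generated S x → Reachable x
  generated-reachable r (gen s)                  = r s
  generated-reachable r (≈-closed {x} {y} eq g)  = reachable-resp (≈⇒≋ x y eq) (generated-reachable r g)
  generated-reachable r 0-closed                 = reachable-rational 0ℚ
  generated-reachable r 1-closed                 = reachable-rational 1ℚ
  generated-reachable r (+-closed {x} {y} g h)   = subst Reachable (plus≡ x y)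
    (reachable-+ (generated-reachable r g) (generated-reachable r h))
  generated-reachable r (neg-closed {x} g)       = subst Reachable (minus≡ x) (reachable-neg (generated-reachable r g))
  generated-reachable r (*-closed {x} {y} g h)   = subst Reachable (mult≡ x y)
    (reachable-* (generated-reachable r g) (generated-reachable r h))
  generated-reachable r (⁻¹-closed {x} {y} g eq) = reachable-inverse (generated-reachable r g)
    (subst (_≋ 1ℂ) (sym (mult≡ x y)) (≈⇒≋ (x *ℂ y) 1ℂ eq))

  ELₙ-reachable : ∀ n {x} → ELₙ iπ n x → Reachable x
  ELₙ-reachable zero    {x} (q , x≈q) = reachable-resp (≈⇒≋ (fromℚ q) x (≈-sym x (fromℚ q) x≈q)) (reachable-rational q)
  ELₙ-reachable (suc n) {x} (p , p∈ , p≉0 , root) = reachable-root p (All.map (generated-reachable base) p∈)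
    (Any.map (λ c≉0 → c≉0 ∘ ≋⇒≈) p≉0)
    (subst (_≋ 0ℂ) (sym (evaluateᴿ≡evaluate₁ p x)) (≈⇒≋ (evaluate₁ p x) 0ℂ root))
    where
    base : ∀ {x} → (ELₙ iπ n ∪ Power iπ (ELₙ iπ n) ∪ Log iπ (ELₙ iπ n)) x → Reachable x
    base (inj₁ x∈)                       = ELₙ-reachable n x∈
    base {y} (inj₂ (inj₁ (x , x∈ , y≈))) = reachable-resp (≈⇒≋ (power iπ x) y (≈-sym y (power iπ x) y≈))
      (subst Reachable (Exp≡ (x *ℂ iπ)) (subst (λ t → Reachable (Exp t)) (mult≡ x iπ) (reachable-power (ELₙ-reachable n x∈))))
    base {w} (inj₂ (inj₂ w∈))            = reachable-log
      (subst (λ t → Reachable (Exp t)) (sym (mult≡ w iπ)) (subst Reachable (sym (Exp≡ (w *ℂ iπ))) (ELₙ-reachable n w∈)))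

  EL-reachable : ∀ {x} → ELᵃˡᵍ x → Reachable x
  EL-reachable (n , x∈) = ELₙ-reachable n x∈

  ¬EL-log : ∀ a w → ELᵃˡᵍ a → w ≉ 0ℂ → exp w ≈ a → ¬ ELᵃˡᵍ w
  ¬EL-log a w a∈ w≉0 exp-w≈a w∈ = ¬reachable-log (w≉0 ∘ ≋⇒≈) (EL-reachable w∈)
    (subst Reachable (sym (Exp≡ w)) (reachable-resp (≈⇒≋ a (exp w) (≈-sym (exp w) a exp-w≈a)) (EL-reachable a∈)))

  -- `i` is a root of `1 + X²`; it leads from π to `iπ`.
  i-reachable : Reachable iℂ
  i-reachable = reachable-root (1ℂ ∷ 0ℂ ∷ 1ℂ ∷ [])
    (reachable-rational 1ℚ ∷ reachable-rational 0ℚ ∷ reachable-rational 1ℚ ∷ []) (here (1≉0 ∘ ≋⇒≈))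
    (subst (_≋ 0ℂ) (sym (evaluateᴿ≡evaluate₁ (1ℂ ∷ 0ℂ ∷ 1ℂ ∷ []) iℂ)) (≈⇒≋ (evaluate₁ (1ℂ ∷ 0ℂ ∷ 1ℂ ∷ []) iℂ) 0ℂ
      (pointwise (evaluate₁ (1ℂ ∷ 0ℂ ∷ 1ℂ ∷ []) iℂ) 0ℂ λ _ → refl)))

  -- With π, also `iπ` would be reachable, a nonzero number whose exponential `- 1` is rational.
  ¬EL-π : ¬ ELᵃˡᵍ (fromℝ π)
  ¬EL-π π∈ = ¬reachable-log l≉0
    (reachable-resp (≈⇒≋ (iℂ *ℂ fromℝ π) iπ (pointwise (iℂ *ℂ fromℝ π) iπ λ n → cong₂ _,i_
        (solve 1 (λ x → con 0ℚ :* x :- con 1ℚ :* con 0ℚ := con 0ℚ) refl (seq π n))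
        (solve 1 (λ x → con 0ℚ :* con 0ℚ :+ con 1ℚ :* x := x) refl (seq π n))))
      (subst Reachable (mult≡ iℂ (fromℝ π)) (reachable-* i-reachable (EL-reachable π∈))))
    (reachable-resp (CommutativeRing.sym ℂ-opaque exp-iπ) (reachable-neg (reachable-rational 1ℚ)))

theorem11p5 : SchanuelConjecture →
    ((b l : ℂ) → AlgebraicOver Rational b → b ≉ 0ℂ → b ≉ 1ℂ → l ≉ 0ℂ → exp l ≈ b → ¬ ELᵃˡᵍ l)
    × ¬ ELᵃˡᵍ (fromℝ π)
    × ¬ ELᵃˡᵍ e
    × ((a w : ℂ) → ELᵃˡᵍ a → a ≉ 0ℂ → a ≉ 1ℂ → exp w ≈ a → ¬ ELᵃˡᵍ w)
theorem11p5 schanuel = algebraic , ¬EL-π schanuel , ¬e , general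
  where
  algebraic : (b l : ℂ) → AlgebraicOver Rational b → b ≉ 0ℂ → b ≉ 1ℂ → l ≉ 0ℂ → exp l ≈ b → ¬ ELᵃˡᵍ l
  algebraic b l (p , p∈ , p≉0 , root) _ _ =
    -- Level 1 already contains `b`, since the coefficients of `p` lie at level 0.
    ¬EL-log schanuel b l (1 , p , All.map (λ c∈ → gen (inj₁ c∈)) p∈ , p≉0 , root)
  ¬e : ¬ ELᵃˡᵍ e
  -- `1` is a nonzero logarithm of `e` and lies at level 0.
  ¬e e∈ = ¬EL-log schanuel e 1ℂ e∈ 1≉0 (≈-refl e) (0 , 1ℚ , ≈-refl 1ℂ)
  general : (a w : ℂ) → ELᵃˡᵍ a → a ≉ 0ℂ → a ≉ 1ℂ → exp w ≈ a → ¬ ELᵃˡᵍ w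
  general a w a∈ _ a≉1 exp-w≈a = ¬EL-log schanuel a w a∈
    -- `w ≈ 0` would give `a ≈ exp 0 ≈ 1`.
    (λ w≈0 → a≉1 (≈-trans a (exp w) 1ℂ (≈-sym (exp w) a exp-w≈a)
      (≈-trans (exp w) (exp 0ℂ) 1ℂ (exp-cong w 0ℂ w≈0) exp-0)))
    exp-w≈a
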